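{- Let $k,l\geq 2$ be integers. Then \[ \mathrm{ex}(n,C_{2l+1},\textnormal{rainbow- }C_{2k})= \begin{cases} \Theta(n^{l}) & \text{if } k\geq 3,\\ \Theta(n^{l+1/2}) & \text{if } k=2. \end{cases} \]
   Context: A proper edge-colouring of a graph assigns colours to edges so that any two edges sharing a vertex receive different colours. A subgraph of an edge-coloured graph is rainbow if all its edges have distinct colours. $\mathrm{ex}(n,H,\textnormal{rainbow- }F)$ denotes the maximum number of copies of $H$ in a properly edge-coloured graph on $n$ vertices containing no rainbow subgraph isomorphic to $F$. $C_m$ denotes the cycle of length $m$. Implied constants may depend on $k$ and $l$. -}

module Defs where

open import Data.Nat using (ℕ; zero; suc; _+_; _*_; _^_; _≤_; _/_)
open import Data.Bool using (Bool; true; false; _∧_; _∨_; not)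
open import Data.Fin using (Fin; zero; suc)
import Data.Fin as F
open import Data.List using (List; []; _∷_; [_]; map; concatMap; filterᵇ; length; allFin)
open import Data.Bool.ListAction using (and)
open import Data.Fin.Base using ()
open import Data.List.Base using ()
open import Data.Product using (Σ; ∃; _×_; _,_)
open import Relation.Nullary using (¬_)
open import Relation.Nullary.Decidable using (⌊_⌋)
open import Relation.Binary.PropositionalEquality using (_≡_; _≢_)

nextC : ∀ {m} → Fin m → Fin m
nextC {suc zero} zero = zero
nextC {suc (suc m)} zero = suc zero
nextC {suc (suc m)} (suc i) with nextC {suc m} i
... | zero = zero
... | suc j = suc (suc j)

record Graph (n : ℕ) : Set where
  field
    adj   : Fin n → Fin n → Bool
    sym   : ∀ u v → adj u v ≡ adj v u
    irref : ∀ v → adj v v ≡ false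
open Graph public

record ProperColouring {n : ℕ} (G : Graph n) : Set where
  field
    col    : Fin n → Fin n → ℕ
    colSym : ∀ u v → adj G u v ≡ true → col u v ≡ col v u
    proper : ∀ u v w → adj G u v ≡ true → adj G u w ≡ true → v ≢ w → col u v ≢ col u w
open ProperColouring public

record CycleMap {n : ℕ} (m : ℕ) (G : Graph n) (f : Fin m → Fin n) : Set where
  field
    inj   : ∀ i j → f i ≡ f j → i ≡ j
    edges : ∀ i → adj G (f i) (f (nextC i)) ≡ true

HasRainbowCycle : ∀ {n} (m : ℕ) (G : Graph n) → ProperColouring G → Set
HasRainbowCycle {n} m G c =
  Σ (Fin m → Fin n) λ f → CycleMap m G f ×
    (∀ i j → col c (f i) (f (nextC i)) ≡ col c (f j) (f (nextC j)) → i ≡ j)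

allFns : (m n : ℕ) → List (Fin m → Fin n)
allFns zero n = [ (λ ()) ]
allFns (suc m) n =
  concatMap (λ x → map (λ f → λ { zero → x ; (suc i) → f i }) (allFns m n)) (allFin n)

allB : ∀ {m} → (Fin m → Bool) → Bool
allB {m} p = and (map p (allFin m))

isCycleMapᵇ : ∀ {n} (m : ℕ) (G : Graph n) → (Fin m → Fin n) → Bool
isCycleMapᵇ m G f =
  allB (λ i → adj G (f i) (f (nextC i))) ∧
  allB (λ i → allB (λ j → ⌊ i F.≟ j ⌋ ∨ not ⌊ f i F.≟ f j ⌋))

labelledCycles : ∀ {n} (m : ℕ) (G : Graph n) → ℕ
labelledCycles {n} m G = length (filterᵇ (isCycleMapᵇ m G) (allFns m n))

-- Number of copies (subgraphs isomorphic to C_m), m ≥ 3: each copy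
-- corresponds to exactly 2m labelled copies (m rotations × 2 directions).
copiesC : ∀ {n} (m : ℕ) (G : Graph n) → ℕ
copiesC zero G = 0
copiesC (suc m) G = labelledCycles (suc m) G / (2 * suc m)

RainbowC2kFree : ∀ {n} (k : ℕ) (G : Graph n) → ProperColouring G → Set
RainbowC2kFree k G c = ¬ HasRainbowCycle (2 * k) G c

-- Θ-bounds for ex(n, C_{2l+1}, rainbow-C_{2k}), raised to power e to avoid
-- fractional exponents: ex^e = Θ(n^p).
-- Upper: every admissible graph has (#C_{2l+1})^e ≤ C n^p for n ≥ N.
ExUpper : (k l e p : ℕ) → Set
ExUpper k l e p = Σ ℕ λ C → Σ ℕ λ N → ∀ n → N ≤ n →
  (G : Graph n) (c : ProperColouring G) → RainbowC2kFree k G c →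
  copiesC (2 * l + 1) G ^ e ≤ C * n ^ p

ExLower : (k l e p : ℕ) → Set
ExLower k l e p = Σ ℕ λ C → Σ ℕ λ N → ∀ n → N ≤ n →
  Σ (Graph n) λ G → Σ (ProperColouring G) λ c → RainbowC2kFree k G c ×
  (n ^ p ≤ C * copiesC (2 * l + 1) G ^ e)

module Submission where

-- Upper bounds.  Growing a rainbow path greedily inside a dense part of the bipartite graph between N(v) and a set B closes up
-- to a rainbow C₂ₖ, so that graph has O(deg v + |B|) edges.  Hence O(n) two-edge walks start at v, and only O(deg v) of
-- them end in a vertex w that is heavy for v, that is, has a large constant number of common neighbours with v.
-- For k ≥ 3 there are O(n²) three-edge walks v a b x: discarding heavy pairs, a walk that has many siblings v a′ b′ x with the
-- same middle colour is charged to the walk b a v a′, which determines b′ through the colour, and if too many walks from v have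
-- few such siblings then greedy growth produces a rainbow C₂ₖ through v.  A closed walk of length 2l + 1 either contains a light
-- pair at distance two, and is then counted by walks of length 2l − 1, or starts with two consecutive heavy pairs.
-- For k = 2 codegrees of distinct vertices are at most 3, which bounds first the edges and then the cycles.
--
-- Lower bounds.  For k ≥ 3, blowing up l alternate vertices of C₂ₗ₊₁ creates only quadrilaterals and copies of C₂ₗ₊₁.
-- For k = 2, in the polarity graph over ℤ/p with p² ≈ n, a closed walk of odd length is determined by its first coordinates,
-- which are arbitrary.  The prime p comes from a lower bound on common multiples of 1, …, N, read off the Leibniz triangle.

open import Defs hiding (sym)
open import Data.Nat
open import Data.Nat.Properties
open import Data.Nat.DivMod
open import Data.Nat.Divisibility
open import Data.Nat.ListAction using (product)
open import Data.Nat.Primality using (Prime; prime?; euclidsLemma; prime⇒nonZero; prime⇒irreducible; ¬prime[0]; ¬prime[1])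
open import Data.Nat.Primality.Factorisation using (factorise)
open import Data.Nat.Tactic.RingSolver using (solve-∀)
open import Data.Integer using (ℤ) renaming (+_ to infix 8 ⁺_)
import Data.Integer as ℤ
import Data.Integer.DivMod as ℤ using (n%ℕd<d; a≡a%ℕn+[a/ℕn]*n)
import Data.Integer.Divisibility.Signed as ℤ
import Data.Integer.Properties as ℤ
import Data.Integer.Tactic.RingSolver as ℤSolver
open import Data.Bool using (Bool; true; false; _∧_; _∨_; not; if_then_else_; T)
open import Data.Bool.ListAction using (and)
open import Data.Fin using (Fin; zero; suc; toℕ; fromℕ<)
import Data.Fin as F
import Data.Fin.Properties as F
open import Data.List using (List; []; _∷_; [_]; map; concatMap; filterᵇ; length; allFin; cartesianProduct; _++_; lookup)
open import Data.List.Properties using (length-++; length-map; length-tabulate)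
open import Data.List.Membership.Propositional using (_∈_; _∉_)
open import Data.List.Membership.Propositional.Properties using (∈-allFin; ∈-cartesianProduct⁻; ∈-map⁻; ∈-map⁺)
open import Data.List.Relation.Unary.Any as Any using (Any; here; there; _─_)
open import Data.List.Relation.Unary.All as All using (All; []; _∷_)
import Data.List.Relation.Unary.All.Properties as All
open import Data.List.Relation.Unary.AllPairs using ([]; _∷_)
open import Data.List.Relation.Unary.Unique.Propositional using (Unique)
open import Data.List.Relation.Unary.Unique.Propositional.Properties using (allFin⁺; cartesianProduct⁺)
open import Data.Product using (Σ; ∃; _×_; _,_; proj₁; proj₂)
open import Data.Sum using (_⊎_; inj₁; inj₂)
open import Data.Empty using (⊥)
open import Function using (_∘_; id; case_of_)
open import Relation.Nullary using (¬_; Dec; yes; no; contradiction)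
open import Relation.Nullary.Decidable using (⌊_⌋; _×-dec_; _⊎-dec_)
open import Relation.Binary.PropositionalEquality hiding ([_])

-- Finite sums and counting

-- For k ≥ 3 the task is to save a factor n^(1/2). With O(n) two-edge walks at every vertex there
-- may still be about n^(3/2) edges, and closing such walks up to odd cycles gives only n^(l + 1/2),
-- the right order for k = 2. The saving is made on three-edge walks, of which the two-edge bound
-- alone would allow n^(5/2). Codegrees have no uniform bound for k ≥ 3, as two vertices may share
-- all other vertices as neighbours. Hence light pairs are bounded one by one and heavy pairs only
-- in total, by the degree. A greedy choice of a pair (a , b) between `v` and `x` fails only if a
-- forbidden vertex or colour rules out too many pairs. Properness and lightness control `a`, `b`
-- and the colours at `v` and `x`, but the colour of the middle edge may recur on many walks from
-- `v` to `x`. This is the reason for counting siblings.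

⟦_⟧ : Bool → ℕ
⟦ true ⟧ = 1
⟦ false ⟧ = 0

⟦⟧≤1 : ∀ b → ⟦ b ⟧ ≤ 1
⟦⟧≤1 true = ≤-refl
⟦⟧≤1 false = z≤n

⟦∧⟧ : ∀ a b → ⟦ a ∧ b ⟧ ≡ ⟦ a ⟧ * ⟦ b ⟧
⟦∧⟧ true b = sym (+-identityʳ _)
⟦∧⟧ false b = refl

⟦∧⟧³ : ∀ a b c → ⟦ a ∧ (b ∧ c) ⟧ ≡ ⟦ a ⟧ * (⟦ b ⟧ * ⟦ c ⟧)
⟦∧⟧³ a b c = trans (⟦∧⟧ a (b ∧ c)) (cong (⟦ a ⟧ *_) (⟦∧⟧ b c))

⟦∧⟧⁴ : ∀ a b c d → ⟦ a ∧ (b ∧ (c ∧ d)) ⟧ ≡ ⟦ a ⟧ * (⟦ b ⟧ * (⟦ c ⟧ * ⟦ d ⟧))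
⟦∧⟧⁴ a b c d = trans (⟦∧⟧ a _) (cong (⟦ a ⟧ *_) (⟦∧⟧³ b c d))

⟦⟧-mono : ∀ {a b} → (a ≡ true → b ≡ true) → ⟦ a ⟧ ≤ ⟦ b ⟧
⟦⟧-mono {true} h rewrite h refl = ≤-refl
⟦⟧-mono {false} h = z≤n

∧-true : ∀ {a b} → a ∧ b ≡ true → a ≡ true × b ≡ true
∧-true {true} e = refl , e

∧-intro : ∀ {a b} → a ≡ true → b ≡ true → a ∧ b ≡ true
∧-intro refl refl = refl

not-false : ∀ {a} → not a ≡ true → a ≡ false
not-false {false} _ = refl

⌊⌋-true : ∀ {p} {P : Set p} (d : Dec P) → P → ⌊ d ⌋ ≡ true
⌊⌋-true (yes _) _ = refl
⌊⌋-true (no ¬p) p = contradiction p ¬p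

⌊⌋-elim : ∀ {p} {P : Set p} (d : Dec P) → ⌊ d ⌋ ≡ true → P
⌊⌋-elim (yes p) _ = p

⌊⌋-false : ∀ {p} {P : Set p} (d : Dec P) → ⌊ d ⌋ ≡ false → ¬ P
⌊⌋-false (no ¬p) _ = ¬p

-- Sums run over lists, so that vertices, pairs and tuples are counted alike and elements can be
-- deleted.
∑ : {A : Set} → List A → (A → ℕ) → ℕ
∑ [] f = 0
∑ (x ∷ xs) f = f x + ∑ xs f

module _ {A : Set} where

  ∑-mono∈ : ∀ xs {f g : A → ℕ} → (∀ {x} → x ∈ xs → f x ≤ g x) → ∑ xs f ≤ ∑ xs g
  ∑-mono∈ [] h = z≤n
  ∑-mono∈ (x ∷ xs) h = +-mono-≤ (h (here refl)) (∑-mono∈ xs (h ∘ there))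

  ∑-mono : ∀ xs {f g : A → ℕ} → (∀ x → f x ≤ g x) → ∑ xs f ≤ ∑ xs g
  ∑-mono xs h = ∑-mono∈ xs (λ {x} _ → h x)

  ∑-cong : ∀ xs {f g : A → ℕ} → (∀ x → f x ≡ g x) → ∑ xs f ≡ ∑ xs g
  ∑-cong [] h = refl
  ∑-cong (x ∷ xs) h = cong₂ _+_ (h x) (∑-cong xs h)

  ∑-+ : ∀ xs (f g : A → ℕ) → ∑ xs (λ x → f x + g x) ≡ ∑ xs f + ∑ xs g
  ∑-+ [] f g = refl
  ∑-+ (x ∷ xs) f g rewrite ∑-+ xs f g = lem (f x) (g x) (∑ xs f) (∑ xs g)
    where
    lem : ∀ a b c d → a + b + (c + d) ≡ a + c + (b + d)
    lem = solve-∀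

  ∑-*ˡ : ∀ xs c (f : A → ℕ) → ∑ xs (λ x → c * f x) ≡ c * ∑ xs f
  ∑-*ˡ [] c f = sym (*-zeroʳ c)
  ∑-*ˡ (x ∷ xs) c f rewrite ∑-*ˡ xs c f = sym (*-distribˡ-+ c (f x) _)

  ∑-*ˡ² : ∀ xs c d (f : A → ℕ) → ∑ xs (λ x → c * (d * f x)) ≡ c * (d * ∑ xs f)
  ∑-*ˡ² xs c d f = trans (∑-*ˡ xs c (λ x → d * f x)) (cong (c *_) (∑-*ˡ xs d f))

  ∑-*ʳ : ∀ xs c (f : A → ℕ) → ∑ xs (λ x → f x * c) ≡ ∑ xs f * c
  ∑-*ʳ xs c f = trans (∑-cong xs (λ x → *-comm (f x) c)) (trans (∑-*ˡ xs c f) (*-comm c _))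

  ∑-const : ∀ (xs : List A) c → ∑ xs (λ _ → c) ≡ length xs * c
  ∑-const [] c = refl
  ∑-const (x ∷ xs) c = cong (c +_) (∑-const xs c)

  ∑-++ : ∀ xs ys (f : A → ℕ) → ∑ (xs ++ ys) f ≡ ∑ xs f + ∑ ys f
  ∑-++ [] ys f = refl
  ∑-++ (x ∷ xs) ys f rewrite ∑-++ xs ys f = sym (+-assoc (f x) _ _)

  ∑-member : ∀ {xs x} (f : A → ℕ) → x ∈ xs → f x ≤ ∑ xs f
  ∑-member {x ∷ xs} f (here refl) = m≤m+n _ _
  ∑-member {x ∷ xs} f (there p) = ≤-trans (∑-member f p) (m≤n+m _ _)

  ∑-─ : ∀ {p} {P : A → Set p} {xs} (q : Any P xs) (f : A → ℕ) → ∑ xs f ≡ f (Any.lookup q) + ∑ (xs ─ q) f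
  ∑-─ (here px) f = refl
  ∑-─ {xs = x ∷ xs} (there q) f rewrite ∑-─ q f = lem (f x) (f (Any.lookup q)) _
    where
    lem : ∀ a b c → a + (b + c) ≡ b + (a + c)
    lem = solve-∀

  length≡∑ : ∀ (xs : List A) → length xs ≡ ∑ xs (λ _ → 1)
  length≡∑ [] = refl
  length≡∑ (x ∷ xs) = cong suc (length≡∑ xs)

  ∑-filter : ∀ (p : A → Bool) xs (f : A → ℕ) → ∑ (filterᵇ p xs) f ≡ ∑ xs (λ x → ⟦ p x ⟧ * f x)
  ∑-filter p [] f = refl
  ∑-filter p (x ∷ xs) f with p x
  ... | true = cong₂ _+_ (sym (+-identityʳ (f x))) (∑-filter p xs f)
  ... | false = ∑-filter p xs f

  length-filterᵇ : ∀ (p : A → Bool) xs → length (filterᵇ p xs) ≡ ∑ xs (λ x → ⟦ p x ⟧)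
  length-filterᵇ p xs = trans (length≡∑ (filterᵇ p xs))
    (trans (∑-filter p xs (λ _ → 1)) (∑-cong xs (λ x → *-identityʳ _)))

  ∈-filterᵇ⁻ : ∀ (p : A → Bool) {xs x} → x ∈ filterᵇ p xs → x ∈ xs × p x ≡ true
  ∈-filterᵇ⁻ p {y ∷ ys} q with p y in eq
  ∈-filterᵇ⁻ p {y ∷ ys} (here refl) | true = here refl , eq
  ∈-filterᵇ⁻ p {y ∷ ys} (there q) | true = let a , b = ∈-filterᵇ⁻ p q in there a , b
  ∈-filterᵇ⁻ p {y ∷ ys} q | false = let a , b = ∈-filterᵇ⁻ p q in there a , b

  ∈-filterᵇ⁺ : ∀ (p : A → Bool) {xs x} → x ∈ xs → p x ≡ true → x ∈ filterᵇ p xs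
  ∈-filterᵇ⁺ p {y ∷ ys} (here refl) e rewrite e = here refl
  ∈-filterᵇ⁺ p {y ∷ ys} (there q) e with p y
  ... | true = there (∈-filterᵇ⁺ p q e)
  ... | false = ∈-filterᵇ⁺ p q e

  ∑>0 : ∀ xs (p : A → Bool) → 0 < ∑ xs (λ x → ⟦ p x ⟧) → ∃ λ x → x ∈ xs × p x ≡ true
  ∑>0 (x ∷ xs) p h with p x in eq
  ... | true = x , here refl , eq
  ... | false = let y , y∈ , e = ∑>0 xs p h in y , there y∈ , e

  -- Properness enters the counts in this form: a vertex has at most one neighbour along a given
  -- colour.
  ∑≤1 : ∀ {xs} → Unique xs → (p : A → Bool) → (∀ {x y} → p x ≡ true → p y ≡ true → x ≡ y) →
        ∑ xs (λ x → ⟦ p x ⟧) ≤ 1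
  ∑≤1 [] p h = z≤n
  ∑≤1 {x ∷ xs} (x∉ ∷ u) p h with p x in eq
  ... | false = ∑≤1 u p h
  ... | true = s≤s (≤-reflexive (zeros x∉))
    where
    zeros : ∀ {ys} → All (x ≢_) ys → ∑ ys (λ y → ⟦ p y ⟧) ≡ 0
    zeros [] = refl
    zeros {y ∷ ys} (x≢y ∷ q) with p y in eq′
    ... | true = contradiction (h eq eq′) x≢y
    ... | false = zeros q

∑-map : ∀ {A B : Set} (g : A → B) xs (f : B → ℕ) → ∑ (map g xs) f ≡ ∑ xs (f ∘ g)
∑-map g [] f = refl
∑-map g (x ∷ xs) f = cong (f (g x) +_) (∑-map g xs f)

∑-concatMap : ∀ {A B : Set} (g : A → List B) xs (f : B → ℕ) → ∑ (concatMap g xs) f ≡ ∑ xs (λ x → ∑ (g x) f)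
∑-concatMap g [] f = refl
∑-concatMap g (x ∷ xs) f = trans (∑-++ (g x) _ f) (cong (∑ (g x) f +_) (∑-concatMap g xs f))

∑-swap : ∀ {A B : Set} xs ys (f : A → B → ℕ) →
  ∑ xs (λ x → ∑ ys (f x)) ≡ ∑ ys (λ y → ∑ xs (λ x → f x y))
∑-swap [] ys f = sym (trans (∑-const ys 0) (*-zeroʳ (length ys)))
∑-swap (x ∷ xs) ys f rewrite ∑-swap xs ys f = sym (∑-+ ys (f x) _)

∑-pairs : ∀ {A B : Set} xs ys (f : A × B → ℕ) → ∑ (cartesianProduct xs ys) f ≡ ∑ xs (λ x → ∑ ys (λ y → f (x , y)))
∑-pairs [] ys f = refl
∑-pairs (x ∷ xs) ys f = trans (∑-++ (map (x ,_) ys) _ f) (cong₂ _+_ (∑-map (x ,_) ys f) (∑-pairs xs ys f))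

_==_ : ∀ {n} → Fin n → Fin n → Bool
u == v = ⌊ u F.≟ v ⌋

==-refl : ∀ {n} (u : Fin n) → (u == u) ≡ true
==-refl u = ⌊⌋-true (u F.≟ u) refl

length-allFin : ∀ n → length (allFin n) ≡ n
length-allFin n = length-tabulate {n = n} id

∑-allFin≤1 : ∀ {n} (p : Fin n → Bool) → (∀ {x y} → p x ≡ true → p y ≡ true → x ≡ y) →
  ∑ (allFin n) (λ x → ⟦ p x ⟧) ≤ 1
∑-allFin≤1 {n} = ∑≤1 (allFin⁺ n)

∑-==≤1 : ∀ {n} (u : Fin n) → ∑ (allFin n) (λ x → ⟦ x == u ⟧) ≤ 1
∑-==≤1 u = ∑-allFin≤1 (_== u) λ {x} {y} p q → trans (⌊⌋-elim (x F.≟ u) p) (sym (⌊⌋-elim (y F.≟ u) q))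

-- Induction on the list; the cross terms 2 a f(y) are absorbed by a² + f(y)².
cauchySchwarz : ∀ {A : Set} xs (f : A → ℕ) → ∑ xs f * ∑ xs f ≤ length xs * ∑ xs (λ x → f x * f x)
cauchySchwarz [] f = z≤n
cauchySchwarz (x ∷ xs) f = begin
  (a + S) * (a + S)                     ≡⟨ e₁ a S ⟩
  a * a + 2 * (a * S) + S * S ≤⟨ +-mono-≤ (+-monoʳ-≤ (a * a) cross) (cauchySchwarz xs f) ⟩
  a * a + (m * (a * a) + Q) + m * Q      ≡⟨ e₂ m a Q ⟩
  suc m * (a * a + Q)                    ∎
  where
  open ≤-Reasoning
  a = f x
  S = ∑ xs f
  Q = ∑ xs (λ y → f y * f y)
  m = length xs
  e₁ : ∀ a S → (a + S) * (a + S) ≡ a * a + 2 * (a * S) + S * S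
  e₁ = solve-∀
  e₂ : ∀ m a Q → a * a + (m * (a * a) + Q) + m * Q ≡ suc m * (a * a + Q)
  e₂ = solve-∀
  -- Written with b = a + d because subtraction truncates; the surplus is d².
  amgm′ : ∀ a d → 2 * (a * (a + d)) ≤ a * a + (a + d) * (a + d)
  amgm′ a d = ≤-trans (m≤m+n _ (d * d)) (≤-reflexive (eq a d))
    where
    eq : ∀ a d → 2 * (a * (a + d)) + d * d ≡ a * a + (a + d) * (a + d)
    eq = solve-∀
  amgm : ∀ a b → 2 * (a * b) ≤ a * a + b * b
  amgm a b with ≤-total a b
  ... | inj₁ a≤b with m≤n⇒∃[o]m+o≡n a≤b
  ...   | d , refl = amgm′ a d
  amgm a b | inj₂ b≤a with m≤n⇒∃[o]m+o≡n b≤a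
  ...   | d , refl rewrite *-comm (b + d) b = ≤-trans (amgm′ b d) (≤-reflexive (+-comm (b * b) _))
  cross : 2 * (a * S) ≤ m * (a * a) + Q
  cross = begin
    2 * (a * S)                        ≡⟨ cong (2 *_) (sym (∑-*ˡ xs a f)) ⟩
    2 * ∑ xs (λ y → a * f y)           ≡⟨ sym (∑-*ˡ xs 2 _) ⟩
    ∑ xs (λ y → 2 * (a * f y))         ≤⟨ ∑-mono xs (λ y → amgm a (f y)) ⟩
    ∑ xs (λ y → a * a + f y * f y)     ≡⟨ ∑-+ xs _ _ ⟩
    ∑ xs (λ _ → a * a) + Q             ≡⟨ cong (_+ Q) (∑-const xs _) ⟩
    m * (a * a) + Q                    ∎

-- Greedy selection and dense cores

-- A sublist, recorded only through its two uses: membership and domination of all sums.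
_≼_ : {A : Set} → List A → List A → Set
xs ≼ ys = (∀ {x} → x ∈ xs → x ∈ ys) × (∀ f → ∑ xs f ≤ ∑ ys f)

≼-refl : ∀ {A : Set} {xs : List A} → xs ≼ xs
≼-refl = id , λ _ → ≤-refl

≼-trans : ∀ {A : Set} {xs ys zs : List A} → xs ≼ ys → ys ≼ zs → xs ≼ zs
≼-trans (a , b) (c , d) = c ∘ a , λ f → ≤-trans (b f) (d f)

∈-─ : ∀ {A : Set} {p} {P : A → Set p} {xs x} (q : Any P xs) → x ∈ (xs ─ q) → x ∈ xs
∈-─ (here px) r = there r
∈-─ (there q) (here refl) = here refl
∈-─ (there q) (there r) = there (∈-─ q r)

─-≼ : ∀ {A : Set} {p} {P : A → Set p} {xs} (q : Any P xs) → (xs ─ q) ≼ xs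
─-≼ q = ∈-─ q , λ f → ≤-trans (m≤n+m _ _) (≤-reflexive (sym (∑-─ q f)))

length-─ : ∀ {A : Set} {p} {P : A → Set p} {xs} (q : Any P xs) → length xs ≡ suc (length (xs ─ q))
length-─ (here px) = refl
length-─ (there q) = cong suc (length-─ q)

any-lookup : ∀ {A : Set} {p} {P : A → Set p} {xs} (q : Any P xs) → P (Any.lookup q)
any-lookup (here px) = px
any-lookup (there q) = any-lookup q

-- A nonempty induced bipartite subgraph of minimum degree `D`: a path that has to avoid a bounded
-- number of vertices and colours never gets stuck in it.
record Core {I J : Set} (t : I → J → Bool) (D : ℕ) (xs : List I) (ys : List J) : Set where
  field
    lefts  : List I
    rights : List J
    lefts≼  : lefts ≼ xs
    rights≼ : rights ≼ ys
    {left₀} : I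
    {right₀} : J
    left₀∈ : left₀ ∈ lefts
    right₀∈ : right₀ ∈ rights
    leftDeg  : ∀ {i} → i ∈ lefts → D ≤ ∑ rights (λ j → ⟦ t i j ⟧)
    rightDeg : ∀ {j} → j ∈ rights → D ≤ ∑ lefts (λ i → ⟦ t i j ⟧)

module _ {I J : Set} (t : I → J → Bool) (D : ℕ) where

  private
    e : List I → List J → ℕ
    e xs ys = ∑ xs (λ i → ∑ ys (λ j → ⟦ t i j ⟧))

    -- Deleting a vertex of degree below `D` loses fewer than `D` edges and lowers the left side of
    -- the density hypothesis by `D`, so density survives. `N` bounds the number of deletions.
    core′ : ∀ N xs ys → length xs + length ys ≤ N → D * (length xs + length ys) < e xs ys → Core t D xs ys
    core′ N xs ys bound dense
      with Any.any? (λ i → ∑ ys (λ j → ⟦ t i j ⟧) <? D) xs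
    core′ N xs ys bound dense | yes q with N | bound | length-─ q
    ... | zero | b | le rewrite le with () ← b
    ... | suc N′ | b | le = record
      { lefts = lefts ; rights = rights ; lefts≼ = ≼-trans lefts≼ (─-≼ q) ; rights≼ = rights≼
      ; left₀∈ = left₀∈ ; right₀∈ = right₀∈  ; leftDeg = leftDeg ; rightDeg = rightDeg }
      where
      m = length (xs ─ q) + length ys
      dense′ : D * m < e (xs ─ q) ys
      dense′ = +-cancelˡ-< D (D * m) _ (begin-strict
        D + D * m                                 ≡⟨ sym (*-suc D m) ⟩
        D * suc m ≡⟨ cong (λ z → D * (z + length ys)) (sym le) ⟩
        D * (length xs + length ys)               <⟨ dense ⟩
        e xs ys                                   ≡⟨ ∑-─ q _ ⟩
        ∑ ys (λ j → ⟦ t (Any.lookup q) j ⟧) + e (xs ─ q) ys ≤⟨ +-monoˡ-≤ _ (<⇒≤ (any-lookup q)) ⟩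
        D + e (xs ─ q) ys                         ∎)
        where open ≤-Reasoning
      open Core (core′ N′ (xs ─ q) ys (≤-pred (≤-trans (≤-reflexive (cong (_+ length ys) (sym le))) b)) dense′)
    core′ N xs ys bound dense | no ¬q
      with Any.any? (λ j → ∑ xs (λ i → ⟦ t i j ⟧) <? D) ys
    core′ N xs ys bound dense | no ¬q | yes q with N | bound | length-─ q
    ... | zero | b | le rewrite le with () ← ≤-trans (m≤n+m _ (length xs)) b
    ... | suc N′ | b | le = record
      { lefts = lefts ; rights = rights ; lefts≼ = lefts≼ ; rights≼ = ≼-trans rights≼ (─-≼ q)
      ; left₀∈ = left₀∈ ; right₀∈ = right₀∈  ; leftDeg = leftDeg ; rightDeg = rightDeg }
      where
      m = length xs + length (ys ─ q)
      le′ : length xs + length ys ≡ suc m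
      le′ = trans (cong (length xs +_) le) (+-suc (length xs) _)
      dense′ : D * m < e xs (ys ─ q)
      dense′ = +-cancelˡ-< D (D * m) _ (begin-strict
        D + D * m                                 ≡⟨ sym (*-suc D m) ⟩
        D * suc m                                 ≡⟨ cong (D *_) (sym le′) ⟩
        D * (length xs + length ys)               <⟨ dense ⟩
        e xs ys                                   ≡⟨ ∑-swap xs ys _ ⟩
        ∑ ys (λ j → ∑ xs (λ i → ⟦ t i j ⟧))       ≡⟨ ∑-─ q _ ⟩
        ∑ xs (λ i → ⟦ t i (Any.lookup q) ⟧) + ∑ (ys ─ q) (λ j → ∑ xs (λ i → ⟦ t i j ⟧))
                                                  ≤⟨ +-mono-≤ (<⇒≤ (any-lookup q)) (≤-reflexive (∑-swap (ys ─ q) xs _)) ⟩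
        D + e xs (ys ─ q)                         ∎)
        where open ≤-Reasoning
      open Core (core′ N′ xs (ys ─ q) (≤-pred (≤-trans (≤-reflexive (sym le′)) b)) dense′)
    core′ N xs ys bound dense | no ¬q | no ¬r
      -- Nothing is left to delete, and strict density leaves an edge, whose ends witness that the
      -- core is nonempty.
      with ∑>0 (cartesianProduct xs ys) (λ (i , j) → t i j)
             (≤-trans (s≤s z≤n) (≤-trans dense (≤-reflexive (sym (∑-pairs xs ys _)))))
    ... | (i , j) , ij∈ , _ = record
      { lefts = xs ; rights = ys ; lefts≼ = ≼-refl ; rights≼ = ≼-refl
      ; left₀∈ = proj₁ (∈-cartesianProduct⁻ xs ys ij∈) ; right₀∈ = proj₂ (∈-cartesianProduct⁻ xs ys ij∈)
      ; leftDeg = λ i∈ → ≮⇒≥ (All.lookup (All.¬Any⇒All¬ xs ¬q) i∈)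
      ; rightDeg = λ j∈ → ≮⇒≥ (All.lookup (All.¬Any⇒All¬ ys ¬r) j∈) }

  core : ∀ xs ys → D * (length xs + length ys) < e xs ys → Core t D xs ys
  core xs ys = core′ _ xs ys ≤-refl

∑-split : ∀ {A : Set} (xs : List A) (p r : A → Bool) →
  ∑ xs (λ x → ⟦ p x ⟧) ≡ ∑ xs (λ x → ⟦ p x ∧ r x ⟧) + ∑ xs (λ x → ⟦ p x ∧ not (r x) ⟧)
∑-split xs p r = trans (∑-cong xs (λ x → lem (p x) (r x))) (∑-+ xs _ _)
  where
  lem : ∀ a b → ⟦ a ⟧ ≡ ⟦ a ∧ b ⟧ + ⟦ a ∧ not b ⟧
  lem false b = refl
  lem true false = refl
  lem true true = refl

-- A union bound: each exclusion removes at most `m` candidates. The induction strengthens `p` by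
-- the negated exclusion, which preserves the bounds for the others.
pick : ∀ {A : Set} (xs : List A) m (p : A → Bool) (es : List (A → Bool)) →
  All (λ e → ∑ xs (λ x → ⟦ p x ∧ e x ⟧) ≤ m) es → length es * m < ∑ xs (λ x → ⟦ p x ⟧) →
  ∃ λ x → x ∈ xs × p x ≡ true × All (λ e → e x ≡ false) es
pick xs m p [] [] h = let x , a , b = ∑>0 xs p h in x , a , b , []
pick xs m p (e ∷ es) (b ∷ bs) h
  with pick xs m (λ x → p x ∧ not (e x)) es (All.map (≤-trans (∑-mono xs (λ x → weaken (p x) (e x) _))) bs)
         (+-cancelˡ-< m _ _ (<-≤-trans h (≤-trans (≤-reflexive (∑-split xs p e)) (+-monoˡ-≤ _ b))))
  where
  weaken : ∀ a b c → ⟦ (a ∧ not b) ∧ c ⟧ ≤ ⟦ a ∧ c ⟧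
  weaken true true c = z≤n
  weaken true false c = ≤-refl
  weaken false b c = ≤-refl
... | x , x∈ , px , all = x , x∈ , proj₁ (∧-true px) , not-false (proj₂ (∧-true px)) ∷ all

module _ {A E : Set} (r : E → A → Bool) where

  bounded-map : ∀ xs {m} (p : A → Bool) (es : List E) → (∀ e → ∑ xs (λ x → ⟦ p x ∧ r e x ⟧) ≤ m) →
    All (λ f → ∑ xs (λ x → ⟦ p x ∧ f x ⟧) ≤ m) (map r es)
  bounded-map xs p [] h = []
  bounded-map xs p (e ∷ es) h = h e ∷ bounded-map xs p es h

  avoided-map : ∀ {es x} → All (λ f → f x ≡ false) (map r es) → ∀ {e} → e ∈ es → r e x ≡ false
  avoided-map (a ∷ as) (here refl) = a
  avoided-map (a ∷ as) (there e∈) = avoided-map as e∈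

-- Rainbow paths

module Rainbow {n : ℕ} (G : Graph n) (c : ProperColouring G) where

  adj-sym : ∀ {u v} → adj G u v ≡ true → adj G v u ≡ true
  adj-sym {u} {v} e = trans (Graph.sym G v u) e

  adj-≢ : ∀ {u v} → adj G u v ≡ true → u ≢ v
  adj-≢ {u} e refl with () ← trans (sym e) (irref G u)

  col-unique : ∀ {u v w} → adj G u v ≡ true → adj G u w ≡ true → col c u v ≡ col c u w → v ≡ w
  col-unique {u} {v} {w} a b e with v F.≟ w
  ... | yes p = p
  ... | no ≢ = contradiction e (proper c u v w a b ≢)

  -- RPath r u F Q: a rainbow path from the root r to the current end u; F lists the
  -- earlier vertices and Q the colours used, most recent first.
  data RPath (r : Fin n) : Fin n → List (Fin n) → List ℕ → Set where
    start : RPath r r [] []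
    step : ∀ {u w F Q} → RPath r u F Q → adj G w u ≡ true → w ∉ (u ∷ F) → col c w u ∉ Q →
           RPath r w (u ∷ F) (col c w u ∷ Q)

  length-colours : ∀ {r u F Q} → RPath r u F Q → length Q ≡ length F
  length-colours start = refl
  length-colours (step p _ _ _) = cong suc (length-colours p)

  root∈ : ∀ {r u F Q} → RPath r u F Q → r ∈ (u ∷ F)
  root∈ start = here refl
  root∈ (step p _ _ _) = there (root∈ p)

  private
    -- The successor along the list, with `z` following the last entry. It stands in for `nextC`, so
    -- that proofs can recurse on the path; for the closed cycle `z` is the first entry.
    after : Fin n → (xs : List (Fin n)) → Fin (length xs) → Fin n
    after z (x ∷ []) zero = z
    after z (x ∷ y ∷ ys) zero = y
    after z (x ∷ y ∷ ys) (suc i) = after z (y ∷ ys) i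

    after-next : ∀ z x xs (i : Fin (suc (length xs))) →
      (nextC i ≡ zero × after z (x ∷ xs) i ≡ z) ⊎
      (∃ λ j → nextC i ≡ suc j × after z (x ∷ xs) i ≡ lookup xs j)
    after-next z x [] zero = inj₁ (refl , refl)
    after-next z x (y ∷ ys) zero = inj₂ (zero , refl , refl)
    after-next z x (y ∷ ys) (suc i) with nextC i | after-next z y ys i
    ... | _ | inj₁ (refl , q) = inj₁ (refl , q)
    ... | _ | inj₂ (j , refl , q) = inj₂ (suc j , refl , q)

    lookup-next : ∀ x xs i → lookup (x ∷ xs) (nextC i) ≡ after x (x ∷ xs) i
    lookup-next x xs i with nextC i | after-next x x xs i
    ... | _ | inj₁ (refl , q) = sym q
    ... | _ | inj₂ (j , refl , q) = sym q

    lookup-∈ : ∀ (xs : List (Fin n)) i → lookup xs i ∈ xs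
    lookup-∈ (x ∷ xs) zero = here refl
    lookup-∈ (x ∷ xs) (suc i) = there (lookup-∈ xs i)

    path-inj : ∀ {r u F Q} → RPath r u F Q → ∀ i j → lookup (u ∷ F) i ≡ lookup (u ∷ F) j → i ≡ j
    path-inj p zero zero e = refl
    path-inj (step p _ w∉ _) zero (suc j) e = contradiction (subst (_∈ _) (sym e) (lookup-∈ _ j)) w∉
    path-inj (step p _ w∉ _) (suc i) zero e = contradiction (subst (_∈ _) e (lookup-∈ _ i)) w∉
    path-inj (step p _ _ _) (suc i) (suc j) e = cong suc (path-inj p i j e)

    path-adj : ∀ {r u F Q z} → RPath r u F Q → adj G r z ≡ true → ∀ i →
      adj G (lookup (u ∷ F) i) (after z (u ∷ F) i) ≡ true
    path-adj start a zero = a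
    path-adj (step p b _ _) a zero = b
    path-adj (step p _ _ _) a (suc i) = path-adj p a i

    edgeCol : Fin n → Fin n → (F : List (Fin n)) → Fin (suc (length F)) → ℕ
    edgeCol z u F i = col c (lookup (u ∷ F) i) (after z (u ∷ F) i)

    path-col∈ : ∀ {r u F Q} z → RPath r u F Q → ∀ i → edgeCol z u F i ∈ (Q ++ [ col c r z ])
    path-col∈ z start zero = here refl
    path-col∈ z (step p _ _ _) zero = here refl
    path-col∈ z (step p _ _ _) (suc i) = there (path-col∈ z p i)

    snoc-∉ : ∀ {x y : ℕ} Q → x ∉ Q → y ≢ x → x ∉ (Q ++ [ y ])
    snoc-∉ [] _ ne (here refl) = ne refl
    snoc-∉ (q ∷ Q) h ne (here refl) = h (here refl)
    snoc-∉ (q ∷ Q) h ne (there e) = snoc-∉ Q (h ∘ there) ne e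

    path-col-inj : ∀ {r u F Q} z → RPath r u F Q → col c r z ∉ Q → ∀ i j →
      edgeCol z u F i ≡ edgeCol z u F j → i ≡ j
    path-col-inj z p h zero zero e = refl
    path-col-inj {r} z (step {Q = Q} p _ _ γ∉) h zero (suc j) e =
      contradiction (subst (_∈ (Q ++ [ col c r z ])) (sym e) (path-col∈ z p j)) (snoc-∉ Q γ∉ (h ∘ here))
    path-col-inj {r} z (step {Q = Q} p _ _ γ∉) h (suc i) zero e =
      contradiction (subst (_∈ (Q ++ [ col c r z ])) e (path-col∈ z p i)) (snoc-∉ Q γ∉ (h ∘ here))
    path-col-inj z (step p _ _ _) h (suc i) (suc j) e = cong suc (path-col-inj z p (h ∘ there) i j e)

  -- The cycle is listed from the end `u` back to the root; the path has `length F` edges and the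
  -- edge from the root to `u` adds one.
  close : ∀ {r u F Q} → RPath r u F Q → adj G r u ≡ true → col c r u ∉ Q →
    HasRainbowCycle (suc (length F)) G c
  close {r} {u} {F} p a γ∉ = lookup (u ∷ F) , record { inj = path-inj p ; edges = adjacent } , rainbow
    where
    adjacent : ∀ i → adj G (lookup (u ∷ F) i) (lookup (u ∷ F) (nextC i)) ≡ true
    adjacent i rewrite lookup-next u F i = path-adj p a i
    rainbow : ∀ i j → col c (lookup (u ∷ F) i) (lookup (u ∷ F) (nextC i)) ≡
                      col c (lookup (u ∷ F) j) (lookup (u ∷ F) (nextC j)) → i ≡ j
    rainbow i j e rewrite lookup-next u F i | lookup-next u F j = path-col-inj u p γ∉ i j e

  -- The closing edge `r a` and the newest edge `a w` meet in `a`: equal colours would make `w` the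
  -- root, which already lies on the path.
  closing-fresh : ∀ {r u w a F Q Q′} → RPath r u F Q → w ∉ (u ∷ F) → adj G r a ≡ true → adj G a w ≡ true →
    col c r a ∉ Q′ → col c r a ∉ (col c a w ∷ Q′)
  closing-fresh {r} {a = a} p w∉ ra aw h (here e) =
    w∉ (subst (_∈ _) (col-unique (adj-sym ra) aw (trans (colSym c a r (adj-sym ra)) e)) (root∈ p))
  closing-fresh p w∉ ra aw h (there q) = h q

-- Greedy construction of rainbow cycles

-- Absence of repetitions, phrased by sums so that it passes to `≼`-smaller lists.
AtMostOnce : {A : Set} → List A → Set
AtMostOnce {A} xs = (p : A → Bool) → (∀ {x y} → p x ≡ true → p y ≡ true → x ≡ y) → ∑ xs (λ x → ⟦ p x ⟧) ≤ 1

≼-atMostOnce : ∀ {n} {xs : List (Fin n)} → xs ≼ allFin n → AtMostOnce xs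
≼-atMostOnce h p u = ≤-trans (proj₂ h _) (∑-allFin≤1 p u)

module Greedy {n : ℕ} (G : Graph n) (c : ProperColouring G) where

  open Rainbow G c

  abstract
    -- Two edges at `x` are controlled at once, typically the one that extends the path and a later
    -- one such as the closing edge. By properness each forbidden colour costs one candidate, as
    -- does each forbidden vertex.
    pickVertex : ∀ xs → AtMostOnce xs → (p : Fin n → Bool) → ∀ F w₁ Q₁ w₂ Q₂ →
      (∀ {x} → p x ≡ true → adj G w₁ x ≡ true) → (∀ {x} → p x ≡ true → adj G w₂ x ≡ true) →
      length F + length Q₁ + length Q₂ < ∑ xs (λ x → ⟦ p x ⟧) →
      ∃ λ x → x ∈ xs × p x ≡ true × x ∉ F × col c x w₁ ∉ Q₁ × col c w₂ x ∉ Q₂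
    pickVertex xs once p F w₁ Q₁ w₂ Q₂ adj₁ adj₂ h
      with pick xs 1 p (exV ++ (exC w₁ Q₁ ++ exC w₂ Q₂)) (All.++⁺ boundV (All.++⁺ (boundC w₁ Q₁ adj₁) (boundC w₂ Q₂ adj₂))) few
      where
      exV : List (Fin n → Bool)
      exV = map (λ u x → x == u) F
      exC : Fin n → List ℕ → List (Fin n → Bool)
      exC w = map (λ γ x → ⌊ col c w x ≟ γ ⌋)
      boundV : All (λ e → ∑ xs (λ x → ⟦ p x ∧ e x ⟧) ≤ 1) exV
      boundV = All.map⁺ (All.tabulate (λ {u} _ → once (λ x → p x ∧ (x == u)) λ {x} {y} q r →
        trans (⌊⌋-elim (x F.≟ u) (proj₂ (∧-true q))) (sym (⌊⌋-elim (y F.≟ u) (proj₂ (∧-true r))))))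
      boundC : ∀ w Q → (∀ {x} → p x ≡ true → adj G w x ≡ true) → All (λ e → ∑ xs (λ x → ⟦ p x ∧ e x ⟧) ≤ 1) (exC w Q)
      boundC w Q a = All.map⁺ (All.tabulate (λ {γ} _ → once (λ x → p x ∧ ⌊ col c w x ≟ γ ⌋) λ {x} {y} q r →
        col-unique (a (proj₁ (∧-true q))) (a (proj₁ (∧-true r)))
          (trans (⌊⌋-elim (_ ≟ γ) (proj₂ (∧-true q))) (sym (⌊⌋-elim (_ ≟ γ) (proj₂ (∧-true r)))))))
      count : length (exV ++ (exC w₁ Q₁ ++ exC w₂ Q₂)) * 1 ≡ length F + length Q₁ + length Q₂
      count = begin
        length (exV ++ (exC w₁ Q₁ ++ exC w₂ Q₂)) * 1         ≡⟨ *-identityʳ _ ⟩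
        length (exV ++ (exC w₁ Q₁ ++ exC w₂ Q₂))             ≡⟨ length-++ exV ⟩
        length exV + length (exC w₁ Q₁ ++ exC w₂ Q₂) ≡⟨ cong (length exV +_) (length-++ (exC w₁ Q₁)) ⟩
        length exV + (length (exC w₁ Q₁) + length (exC w₂ Q₂)) ≡⟨ cong₂ _+_ (length-map _ F) (cong₂ _+_ (length-map _ Q₁) (length-map _ Q₂)) ⟩
        length F + (length Q₁ + length Q₂) ≡⟨ sym (+-assoc (length F) _ _) ⟩
        length F + length Q₁ + length Q₂                     ∎
        where open ≡-Reasoning
      few : length (exV ++ (exC w₁ Q₁ ++ exC w₂ Q₂)) * 1 < ∑ xs (λ x → ⟦ p x ⟧)
      few = ≤-<-trans (≤-reflexive count) h
    ... | x , x∈ , px , all = x , x∈ , px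
      , (λ x∈F → ⌊⌋-false (x F.≟ x) (All.lookup (All.map⁻ (All.++⁻ˡ (map _ F) all)) x∈F) refl)
      , (λ γ∈ → ⌊⌋-false (col c w₁ x ≟ col c x w₁) (All.lookup (All.map⁻ (All.++⁻ˡ (map _ Q₁) (All.++⁻ʳ (map _ F) all))) γ∈) (colSym c w₁ x (adj₁ px)))
      , (λ γ∈ → ⌊⌋-false (col c w₂ x ≟ col c w₂ x) (All.lookup (All.map⁻ (All.++⁻ʳ (map _ Q₁) (All.++⁻ʳ (map _ F) all))) γ∈) refl)

  record Reach (r : Fin n) (End : Fin n → List (Fin n) → List ℕ → Set) (ℓ : ℕ) : Set where
    constructor reach
    field
      {end}    : Fin n
      {before} : List (Fin n)
      {colours} : List ℕ
      path : RPath r end before colours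
      atEnd : End end before colours
      length-path : length before ≡ ℓ

  -- A round adds two edges, as paths alternate between two kinds of vertices. The cap `m` on the
  -- length keeps the number of things to avoid bounded.
  Extends : Fin n → ℕ → (Fin n → Set) → (Fin n → List (Fin n) → List ℕ → Set) → Set
  Extends r m Inv End = ∀ {u F Q} → RPath r u F Q → Inv u → length F ≤ m → Reach r End (2 + length F)

  -- `t` counts the rounds after the first: `End` is known only after a round, so one always takes
  -- place.
  iterate : ∀ {r m Inv End} → (∀ {u F Q} → End u F Q → Inv u) → Extends r m Inv End →
    ∀ t {u F Q} → RPath r u F Q → Inv u → 2 * t + length F ≤ m → Reach r End (2 + 2 * t + length F)
  iterate inv ext zero p i le = ext p i le
  iterate {r} {End = End} inv ext (suc t) {F = F} p i le
    with ext p i (≤-trans (m≤n+m _ _) le)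
  ... | reach {before = F′} p′ e′ eq = subst (Reach r End) eq′
          (iterate inv ext t p′ (inv e′) (≤-trans (≤-reflexive (trans (cong (2 * t +_) eq) (lem t (length F)))) le))
    where
    lem : ∀ t f → 2 * t + (2 + f) ≡ 2 * suc t + f
    lem = solve-∀
    eq′ : 2 + 2 * t + length F′ ≡ 2 + 2 * suc t + length F
    eq′ = cong (2 +_) (trans (cong (2 * t +_) eq) (lem t (length F)))

  Closable : Fin n → (Fin n → Set) → Fin n → List (Fin n) → List ℕ → Set
  Closable r Good u F Q = Good u × col c r u ∉ Q

  -- One edge from the root, `suc j` rounds and the closing edge make 1 + 2 (j + 1) + 1 edges.
  neighbourCycle : ∀ j {r u} (Good : Fin n → Set) → (∀ {u} → Good u → adj G r u ≡ true) →
    Extends r (4 + 2 * j) Good (Closable r Good) → Good u → HasRainbowCycle (4 + 2 * j) G c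
  neighbourCycle j {r} {u} Good good-adj ext g
    with iterate proj₁ ext j (step start (adj-sym (good-adj g)) (λ { (here refl) → adj-≢ (good-adj g) refl }) (λ ())) g
           (≤-trans (≤-reflexive (+-comm (2 * j) 1)) (+-monoˡ-≤ (2 * j) {1} {4} (s≤s z≤n)))
  ... | reach p (g′ , γ∉) eq = subst (λ ℓ → HasRainbowCycle ℓ G c) (trans (cong suc eq) (lem j)) (close p (good-adj g′) γ∉)
    where
    lem : ∀ j → suc (2 + 2 * j + 1) ≡ 4 + 2 * j
    lem = solve-∀

-- Codegrees in a graph without a rainbow even cycle

module Codegrees {n : ℕ} (G : Graph n) where

  V : List (Fin n)
  V = allFin n

  A : Fin n → Fin n → ℕ
  A u v = ⟦ adj G u v ⟧

  A-sym : ∀ u v → A u v ≡ A v u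
  A-sym u v = cong ⟦_⟧ (Graph.sym G u v)

  deg : Fin n → ℕ
  deg v = ∑ V (A v)

  -- An entry of the squared adjacency matrix. On the diagonal it is the degree, so degenerate walks
  -- are included and a vertex of large degree is heavy for itself.
  codeg : Fin n → Fin n → ℕ
  codeg u w = ∑ V (λ a → A u a * A a w)

  twoWalks : Fin n → ℕ
  twoWalks v = ∑ V (λ a → A v a * deg a)

  deg≤n : ∀ v → deg v ≤ n
  deg≤n v = ≤-trans (∑-mono V (λ a → ⟦⟧≤1 (adj G v a)))
    (≤-reflexive (trans (sym (length≡∑ V)) (length-allFin n)))

  codeg-sym : ∀ u w → codeg u w ≡ codeg w u
  codeg-sym u w = ∑-cong V (λ a → trans (*-comm (A u a) _) (cong₂ _*_ (A-sym a w) (A-sym u a)))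

  codeg-count : ∀ u w → codeg u w ≡ ∑ V (λ a → ⟦ adj G u a ∧ adj G w a ⟧)
  codeg-count u w = ∑-cong V (λ a → trans (cong (A u a *_) (A-sym a w)) (sym (⟦∧⟧ (adj G u a) _)))

  ∑-codeg : ∀ xs v → ∑ xs (codeg v) ≡ ∑ V (λ a → A v a * ∑ xs (A a))
  ∑-codeg xs v = trans (∑-swap xs V _) (∑-cong V (λ a → ∑-*ˡ xs (A v a) (A a)))

  ∑-degree² : ∑ V (λ v → deg v * deg v) ≡ ∑ V twoWalks
  ∑-degree² = trans (∑-cong V (λ a → trans (cong (_* deg a) (∑-cong V (A-sym a))) (sym (∑-*ʳ V (deg a) _))))
    (∑-swap V V _)

module Constants (m : ℕ) where

  -- K exceeds the number of vertices and colours that a greedy step has to avoid, H is the codegree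
  -- threshold, M bounds every class of paths that one forbidden vertex or colour rules out, and D is
  -- the minimum degree that the core of poor walks needs.
  abstract
    K H M D : ℕ
    K = suc ((2 + m) + (1 + m) + (1 + m))
    H = 2 * K
    M = 2 * H + K
    D = suc (((2 + m) + (2 + m) + (2 + m) + (2 + m) + (2 + m)) * M) + K

    K-nonZero : NonZero K
    K-nonZero = _

    H-nonZero : NonZero H
    H-nonZero = _

    roomy : ∀ {a b c} → a ≤ 2 + m → b ≤ 1 + m → c ≤ 1 + m → a + b + c < K
    roomy p q r = s≤s (+-mono-≤ (+-mono-≤ p q) r)

    K≤H : K ≤ H
    K≤H = m≤m+n K (K + 0)

    K-double : ∀ d → K * (d + d) ≡ H * d
    K-double d = lem K d
      where
      lem : ∀ K d → K * (d + d) ≡ 2 * K * d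
      lem = solve-∀

    H≤M : H ≤ M
    H≤M = ≤-trans (m≤m+n H (H + 0)) (m≤m+n (2 * H) K)

    M-split : ∀ {x y} → M < x + y → y < 2 * H → K ≤ x
    M-split {x} {y} h l = +-cancelˡ-≤ (2 * H) K x
      (≤-trans (<⇒≤ h) (≤-trans (+-monoʳ-≤ x (<⇒≤ l)) (≤-reflexive (+-comm x (2 * H)))))

    roomy₅ : ∀ {q r s t u} → q ≤ 2 + m → r ≤ 2 + m → s ≤ 2 + m → t ≤ 2 + m → u ≤ 2 + m → (q + r + s + t + u) * M < D
    roomy₅ a b c d e = s≤s (≤-trans (*-monoˡ-≤ M (+-mono-≤ (+-mono-≤ (+-mono-≤ (+-mono-≤ a b) c) d) e)) (m≤m+n _ K))

    K≤D : K ≤ D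
    K≤D = m≤n+m K (suc (((2 + m) + (2 + m) + (2 + m) + (2 + m) + (2 + m)) * M))

  -- Contributions to `threeWalks≤`: `H * H` for each of the two heavy pairs, `H` for equal outer
  -- colours and `D * (H + 1)` for poor walks. The factor 2 pays for the rich walks.
  C₃ : ℕ
  C₃ = 2 * (H * H + H * H + H + D * (H + 1))

-- Two-edge walks, heavy pairs and heavy clusters

module Upper {n : ℕ} (G : Graph n) (c : ProperColouring G)
  (m j : ℕ) (m≡ : m ≡ 4 + 2 * j) (free : ¬ HasRainbowCycle m G c) where

  open Rainbow G c
  open Greedy G c
  open Codegrees G

  open Constants m public

  no-neighbourCycle : ∀ {r u} (Good : Fin n → Set) → (∀ {u} → Good u → adj G r u ≡ true) →
    Extends r m Good (Closable r Good) → ¬ Good u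
  no-neighbourCycle Good good-adj ext g = free (subst (λ ℓ → HasRainbowCycle ℓ G c) (sym m≡)
    (neighbourCycle j Good good-adj (λ p i le → ext p i (≤-trans le (≤-reflexive (sym m≡)))) g))

  heavy : Fin n → Fin n → Bool
  heavy u w = H ≤ᵇ codeg u w

  heavy-≤ : ∀ {u w} → heavy u w ≡ true → H ≤ codeg u w
  heavy-≤ {u} {w} e = ≤ᵇ⇒≤ H (codeg u w) (subst T (sym e) _)

  light-≤ : ∀ {u w} → heavy u w ≡ false → codeg u w ≤ H
  light-≤ {u} {w} e = <⇒≤ (≰⇒> (λ h → subst T e (≤⇒≤ᵇ h)))

  colours≤ : ∀ {r u F Q} → RPath r u F Q → length F ≤ m → length Q ≤ m
  colours≤ p = ≤-trans (≤-reflexive (length-colours p))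

  filter-≼ : ∀ {A : Set} (p : A → Bool) xs → filterᵇ p xs ≼ xs
  filter-≼ p xs = proj₁ ∘ ∈-filterᵇ⁻ p , λ f → ≤-trans (≤-reflexive (∑-filter p xs f))
    (∑-mono xs (λ x → ≤-trans (*-monoˡ-≤ (f x) (⟦⟧≤1 (p x))) (≤-reflexive (+-identityʳ (f x)))))

  -- The cycle v a w a′ w′ … a″ v alternates between the two sides of the core.
  no-core : ∀ v {N B} → N ≼ V → B ≼ V → (∀ {a} → a ∈ N → adj G v a ≡ true) → ¬ Core (adj G) K N B
  no-core v N≼ B≼ N-adj C = no-neighbourCycle (_∈ lefts) adjacent ext left₀∈
    where
    open Core C
    adjacent : ∀ {a} → a ∈ lefts → adj G v a ≡ true
    adjacent a∈ = N-adj (proj₁ lefts≼ a∈)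
    ext : Extends v m (_∈ lefts) (Closable v (_∈ lefts))
    ext {a} {F} {Q} p a∈ le =
      let w , w∈ , aw , w∉ , wa∉ , _ =
            pickVertex rights (≼-atMostOnce (≼-trans rights≼ B≼)) (adj G a) (a ∷ F) a Q a [] id id
              (<-≤-trans (roomy (s≤s (m≤n⇒m≤1+n le)) (m≤n⇒m≤1+n (colours≤ p le)) z≤n) (leftDeg a∈))
          a′ , a′∈ , both , a′∉ , a′w∉ , va′∉ =
            pickVertex lefts (≼-atMostOnce (≼-trans lefts≼ N≼)) (λ a′ → adj G v a′ ∧ adj G w a′) (w ∷ a ∷ F)
              w (col c w a ∷ Q) v (col c w a ∷ Q) (proj₂ ∘ ∧-true) (proj₁ ∘ ∧-true)
              (<-≤-trans (roomy (s≤s (s≤s le)) (s≤s (colours≤ p le)) (s≤s (colours≤ p le)))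
                (≤-trans (rightDeg w∈) (∑-mono∈ lefts λ {a′} a′∈ →
                  ⟦⟧-mono (λ e → ∧-intro (adjacent a′∈) (adj-sym e)))))
          va′ , wa′ = ∧-true both
      in reach (step (step p (adj-sym aw) w∉ wa∉) (adj-sym wa′) a′∉ a′w∉)
           (a′∈ , closing-fresh p w∉ va′ (adj-sym wa′) va′∉) refl

  -- The sum counts the edges between N(v) and `B`; more than `K` per vertex would leave a core.
  -- N(v) and `B` may overlap, since paths avoid their own vertices explicitly.
  local : ∀ v B → B ≼ V → ∑ B (codeg v) ≤ K * (deg v + length B)
  local v B B≼ = ≮⇒≥ λ dense →
    no-core v (filter-≼ (adj G v) V) B≼ (λ a∈ → proj₂ (∈-filterᵇ⁻ (adj G v) {V} a∈))
      (core (adj G) K N B (subst₂ _<_ lenN edges dense))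
    where
    N = filterᵇ (adj G v) V
    lenN : K * (deg v + length B) ≡ K * (length N + length B)
    lenN = cong (λ z → K * (z + length B)) (sym (length-filterᵇ (adj G v) V))
    edges : ∑ B (codeg v) ≡ ∑ N (λ a → ∑ B (A a))
    edges = trans (∑-codeg B v) (sym (∑-filter (adj G v) V _))

  ∑-twoWalks : ∀ v → twoWalks v ≤ H * n
  ∑-twoWalks v = begin
    twoWalks v                  ≡⟨ sym (∑-codeg V v) ⟩
    ∑ V (codeg v)               ≤⟨ local v V ≼-refl ⟩
    K * (deg v + length V) ≤⟨ *-monoʳ-≤ K (+-mono-≤ (deg≤n v) (≤-reflexive (length-allFin n))) ⟩
    K * (n + n)                 ≡⟨ K-double n ⟩
    H * n                       ∎
    where open ≤-Reasoning

  -- Applied to the set B of heavy partners of v, the local bound gives H |B| ≤ K (deg v + |B|), so |B| ≤ deg v.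
  ∑-heavy : ∀ v → ∑ V (λ w → ⟦ heavy v w ⟧ * codeg v w) ≤ H * deg v
  ∑-heavy v = begin
    ∑ V (λ w → ⟦ heavy v w ⟧ * codeg v w) ≡⟨ sym (∑-filter (heavy v) V (codeg v)) ⟩
    ∑ B (codeg v)                         ≤⟨ local v B (filter-≼ (heavy v) V) ⟩
    K * (deg v + length B)                ≤⟨ *-monoʳ-≤ K (+-monoʳ-≤ (deg v) lenB) ⟩
    K * (deg v + deg v)                   ≡⟨ K-double (deg v) ⟩
    H * deg v                             ∎
    where
    open ≤-Reasoning
    B = filterᵇ (heavy v) V
    lenB : length B ≤ deg v
    lenB = *-cancelˡ-≤ K {{K-nonZero}} (+-cancelʳ-≤ (K * length B) _ _ (begin
      K * length B + K * length B ≡⟨ trans (sym (*-distribˡ-+ K (length B) _)) (trans (K-double (length B)) (*-comm H _)) ⟩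
      length B * H                 ≡⟨ sym (∑-const B H) ⟩
      ∑ B (λ _ → H) ≤⟨ ∑-mono∈ B (λ w∈ → heavy-≤ (proj₂ (∈-filterᵇ⁻ (heavy v) {V} w∈))) ⟩
      ∑ B (codeg v)                ≤⟨ local v B (filter-≼ (heavy v) V) ⟩
      K * (deg v + length B)       ≡⟨ *-distribˡ-+ K (deg v) (length B) ⟩
      K * deg v + K * length B     ∎))

  -- The cycle runs x b y b′ y′ … b″ x: consecutive b's are heavy partners in L, joined through fresh common neighbours.
  no-heavy-cluster : ∀ x L → AtMostOnce L → (∀ {b} → b ∈ L → adj G x b ≡ true) →
    (∀ {b} → b ∈ L → K ≤ ∑ L (λ b′ → ⟦ heavy b b′ ⟧)) → ∀ {b} → b ∉ L
  no-heavy-cluster x L once adjacent clustered b∈ = no-neighbourCycle (_∈ L) adjacent ext b∈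
    where
    ext : Extends x m (_∈ L) (Closable x (_∈ L))
    ext {b} {F} {Q} p b∈ le =
      let b′ , b′∈ , hb′ , b′∉ , _ , xb′∉ =
            pickVertex L once (λ b′ → heavy b b′ ∧ adj G x b′) (b ∷ F) x [] x Q (proj₂ ∘ ∧-true) (proj₂ ∘ ∧-true)
              (<-≤-trans (roomy (s≤s (m≤n⇒m≤1+n le)) z≤n (m≤n⇒m≤1+n (colours≤ p le)))
                (≤-trans (clustered b∈) (∑-mono∈ L λ b′∈ → ⟦⟧-mono (λ e → ∧-intro e (adjacent b′∈)))))
          -- The vertex `b′` precedes `y` so that the edge `b y` can avoid the closing colour
          -- `x b′`; the two edges at `y` differ by properness.
          y , _ , both , y∉ , yb∉ , b′y∉ =
            pickVertex V (≼-atMostOnce ≼-refl) (λ y → adj G b y ∧ adj G b′ y) (b ∷ F) b (col c x b′ ∷ Q) b′ Q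
              (proj₁ ∘ ∧-true) (proj₂ ∘ ∧-true)
              (<-≤-trans (roomy (s≤s (m≤n⇒m≤1+n le)) (s≤s (colours≤ p le)) (m≤n⇒m≤1+n (colours≤ p le)))
                (≤-trans K≤H (≤-trans (heavy-≤ (proj₁ (∧-true hb′))) (≤-reflexive (codeg-count b b′)))))
          by , b′y = ∧-true both
      in reach (step (step p (adj-sym by) y∉ (yb∉ ∘ there)) b′y
             (λ { (here e) → adj-≢ b′y e ; (there q) → b′∉ q })
             (λ { (here e) → b′∉ (here (col-unique (adj-sym b′y) (adj-sym by) (trans (colSym c y b′ (adj-sym b′y)) e)))
                ; (there q) → b′y∉ q }))
           (b′∈ , closing-fresh p y∉ (adjacent b′∈) b′y
              (λ { (here e) → yb∉ (here (sym e)) ; (there q) → xb′∉ q })) refl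

-- Three-edge walks in a graph without a rainbow C₂ₖ, k ≥ 3

module ThreeWalks {n : ℕ} (G : Graph n) (c : ProperColouring G)
  (m i : ℕ) (m≡ : m ≡ 4 + 2 * suc i) (free : ¬ HasRainbowCycle m G c) where

  open Rainbow G c
  open Greedy G c
  open Codegrees G
  open Upper G c m (suc i) m≡ free

  sameColour : ℕ → ℕ → Bool
  sameColour γ δ = ⌊ γ ≟ δ ⌋

  light : Fin n → Fin n → Bool
  light u w = not (heavy u w)

  walk : Fin n → Fin n → Fin n → Fin n → Bool
  walk v a b x = adj G v a ∧ (adj G a b ∧ adj G b x)

  -- Lightness bounds the number of walks through a given `b` or a given `a`. Distinct outer colours
  -- let a path that has just used `b x` return to `v` along `a v`.
  good : Fin n → Fin n → Fin n → Fin n → Bool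
  good v a b x = walk v a b x ∧ (light v b ∧ (light a x ∧ not (sameColour (col c v a) (col c b x))))

  -- Lightness of `b b′` serves both sides of the argument: it bounds the ways back from `b′` to `b`
  -- when rich walks are counted, and its failure for most `b′` yields a heavy cluster.
  siblings : Fin n → Fin n → Fin n → Fin n → ℕ
  siblings v a b x = ∑ V (λ a′ → ∑ V (λ b′ → ⟦ good v a′ b′ x ∧ (sameColour (col c a′ b′) (col c a b) ∧ light b b′) ⟧))

  manySiblings : Fin n → Fin n → Fin n → Fin n → Bool
  manySiblings v a b x = 2 * H ≤ᵇ siblings v a b x

  rich poor : Fin n → Fin n → Fin n → Fin n → Bool
  rich v a b x = good v a b x ∧ manySiblings v a b x
  poor v a b x = good v a b x ∧ not (manySiblings v a b x)

  record Good (v a b x : Fin n) : Set where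
    field
      va : adj G v a ≡ true
      ab : adj G a b ≡ true
      bx : adj G b x ≡ true
      light-vb : light v b ≡ true
      light-ax : light a x ≡ true
      va≢bx : col c v a ≢ col c b x

  good⇒Good : ∀ {v a b x} → good v a b x ≡ true → Good v a b x
  good⇒Good {v} {a} {b} {x} e =
    let w , r = ∧-true e
        va , r₁ = ∧-true w
        ab , bx = ∧-true r₁
        vb , r₂ = ∧-true r
        ax , r₃ = ∧-true r₂
    in record { va = va ; ab = ab ; bx = bx ; light-vb = vb ; light-ax = ax
              ; va≢bx = ⌊⌋-false (col c v a ≟ col c b x) (not-false r₃) }

  poor⇒Good : ∀ {v a b x} → poor v a b x ≡ true → Good v a b x
  poor⇒Good = good⇒Good ∘ proj₁ ∘ ∧-true

  poor⇒siblings : ∀ {v a b x} → poor v a b x ≡ true → siblings v a b x < 2 * H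
  poor⇒siblings {v} {a} {b} {x} e = ≰⇒> (λ h → subst T (not-false (proj₂ (∧-true {good v a b x} e))) (≤⇒≤ᵇ h))

  light-codeg : ∀ u w → ⟦ light u w ⟧ * codeg u w ≤ H
  light-codeg u w with heavy u w in e
  ... | true = z≤n
  ... | false = ≤-trans (≤-reflexive (+-identityʳ _)) (light-≤ e)

  module PoorCore (v : Fin n) where

    VV : List (Fin n × Fin n)
    VV = cartesianProduct V V

    paths : List (Fin n × Fin n)
    paths = filterᵇ (λ (a , b) → adj G v a ∧ adj G a b) VV

    -- In a core of this bipartite graph a path from `v` enters by `a b`, alternates between second
    -- vertices `b` and ends `x`, and finally returns to `v` through the first vertex of its last
    -- pair.
    edge : Fin n × Fin n → Fin n → Bool
    edge (a , b) x = poor v a b x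

    module _ (C : Core edge D paths V) where

      open Core C

      ∑-lefts : (f : Fin n → Fin n → ℕ) → ∑ lefts (λ (a , b) → f a b) ≤ ∑ V (λ a → ∑ V (f a))
      ∑-lefts f = ≤-trans (proj₂ lefts≼ _) (≤-trans (proj₂ (filter-≼ _ VV) _) (≤-reflexive (∑-pairs V V _)))

      -- The condition leaves one neighbour `b` of `x`, and lightness of `v b` at most `H` choices
      -- of `a`.
      bound-b : ∀ x (e : Fin n → Bool) → (∀ {b b′} → adj G x b ∧ e b ≡ true → adj G x b′ ∧ e b′ ≡ true → b ≡ b′) →
        ∑ lefts (λ (a , b) → ⟦ poor v a b x ∧ e b ⟧) ≤ M
      bound-b x e unique = begin
        ∑ lefts (λ (a , b) → ⟦ poor v a b x ∧ e b ⟧)                     ≤⟨ ∑-lefts _ ⟩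
        ∑ V (λ a → ∑ V (λ b → ⟦ poor v a b x ∧ e b ⟧)) ≤⟨ ∑-mono V (λ a → ∑-mono V (λ b → pointwise a b)) ⟩
        ∑ V (λ a → ∑ V (λ b → ⟦ adj G x b ∧ e b ⟧ * (⟦ light v b ⟧ * (A v a * A a b)))) ≡⟨ ∑-swap V V _ ⟩
        ∑ V (λ b → ∑ V (λ a → ⟦ adj G x b ∧ e b ⟧ * (⟦ light v b ⟧ * (A v a * A a b))))
          ≡⟨ ∑-cong V (λ b → ∑-*ˡ² V ⟦ adj G x b ∧ e b ⟧ ⟦ light v b ⟧ (λ a → A v a * A a b)) ⟩
        ∑ V (λ b → ⟦ adj G x b ∧ e b ⟧ * (⟦ light v b ⟧ * codeg v b)) ≤⟨ ∑-mono V (λ b → *-monoʳ-≤ ⟦ adj G x b ∧ e b ⟧ (light-codeg v b)) ⟩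
        ∑ V (λ b → ⟦ adj G x b ∧ e b ⟧ * H) ≡⟨ ∑-*ʳ V H _ ⟩
        ∑ V (λ b → ⟦ adj G x b ∧ e b ⟧) * H ≤⟨ *-monoˡ-≤ H (∑-allFin≤1 _ unique) ⟩
        1 * H ≡⟨ *-identityˡ H ⟩
        H                                                                    ≤⟨ H≤M ⟩
        M                                                                    ∎
        where
        open ≤-Reasoning
        pointwise : ∀ a b → ⟦ poor v a b x ∧ e b ⟧ ≤ ⟦ adj G x b ∧ e b ⟧ * (⟦ light v b ⟧ * (A v a * A a b))
        pointwise a b = ≤-trans (⟦⟧-mono {b = (adj G x b ∧ e b) ∧ (light v b ∧ (adj G v a ∧ adj G a b))} λ p →
            let q , eb = ∧-true p
                open Good (poor⇒Good q)
            in ∧-intro (∧-intro (adj-sym bx) eb) (∧-intro light-vb (∧-intro va ab)))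
          (≤-reflexive (⟦∧⟧⁴ (adj G x b ∧ e b) (light v b) (adj G v a) (adj G a b)))

      -- Mirror image of `bound-b`: one `a` remains, and lightness of `a x` bounds the choices of
      -- `b`.
      bound-a : ∀ x (e : Fin n → Bool) → (∀ {a a′} → adj G v a ∧ e a ≡ true → adj G v a′ ∧ e a′ ≡ true → a ≡ a′) →
        ∑ lefts (λ (a , b) → ⟦ poor v a b x ∧ e a ⟧) ≤ M
      bound-a x e unique = begin
        ∑ lefts (λ (a , b) → ⟦ poor v a b x ∧ e a ⟧)                     ≤⟨ ∑-lefts _ ⟩
        ∑ V (λ a → ∑ V (λ b → ⟦ poor v a b x ∧ e a ⟧)) ≤⟨ ∑-mono V (λ a → ∑-mono V (λ b → pointwise a b)) ⟩
        ∑ V (λ a → ∑ V (λ b → ⟦ adj G v a ∧ e a ⟧ * (⟦ light a x ⟧ * (A a b * A b x))))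
          ≡⟨ ∑-cong V (λ a → ∑-*ˡ² V ⟦ adj G v a ∧ e a ⟧ ⟦ light a x ⟧ (λ b → A a b * A b x)) ⟩
        ∑ V (λ a → ⟦ adj G v a ∧ e a ⟧ * (⟦ light a x ⟧ * codeg a x)) ≤⟨ ∑-mono V (λ a → *-monoʳ-≤ ⟦ adj G v a ∧ e a ⟧ (light-codeg a x)) ⟩
        ∑ V (λ a → ⟦ adj G v a ∧ e a ⟧ * H) ≡⟨ ∑-*ʳ V H _ ⟩
        ∑ V (λ a → ⟦ adj G v a ∧ e a ⟧) * H ≤⟨ *-monoˡ-≤ H (∑-allFin≤1 _ unique) ⟩
        1 * H ≡⟨ *-identityˡ H ⟩
        H                                                                    ≤⟨ H≤M ⟩
        M                                                                    ∎
        where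
        open ≤-Reasoning
        pointwise : ∀ a b → ⟦ poor v a b x ∧ e a ⟧ ≤ ⟦ adj G v a ∧ e a ⟧ * (⟦ light a x ⟧ * (A a b * A b x))
        pointwise a b = ≤-trans (⟦⟧-mono {b = (adj G v a ∧ e a) ∧ (light a x ∧ (adj G a b ∧ adj G b x))} λ p →
            let q , ea = ∧-true p
                open Good (poor⇒Good q)
            in ∧-intro (∧-intro va ea) (∧-intro light-ax (∧-intro ab bx)))
          (≤-reflexive (⟦∧⟧⁴ (adj G v a ∧ e a) (light a x) (adj G a b) (adj G b x)))

      -- A large colour class at x would be a heavy cluster in N(x), since poor walks have few light siblings.
      bound-ab : ∀ x γ → ∑ lefts (λ (a , b) → ⟦ poor v a b x ∧ sameColour (col c a b) γ ⟧) ≤ M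
      bound-ab x γ = ≮⇒≥ λ large →
        let (a , b) , ab∈ , e = ∑>0 lefts inClass (≤-trans (s≤s z≤n) large)
        in no-heavy-cluster x L once adjacent (clustered large) (∈-L ab∈ e)
        where
        inClass : Fin n × Fin n → Bool
        inClass (a , b) = poor v a b x ∧ sameColour (col c a b) γ
        L : List (Fin n)
        L = map proj₂ (filterᵇ inClass lefts)
        ∑-L : ∀ f → ∑ L f ≡ ∑ lefts (λ (a , b) → ⟦ inClass (a , b) ⟧ * f b)
        ∑-L f = trans (∑-map proj₂ (filterᵇ inClass lefts) f) (∑-filter inClass lefts _)
        ∈-L : ∀ {β} → β ∈ lefts → inClass β ≡ true → proj₂ β ∈ L
        ∈-L β∈ e = ∈-map⁺ proj₂ (∈-filterᵇ⁺ inClass β∈ e)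
        from-L : ∀ {b} → b ∈ L → ∃ λ a → (a , b) ∈ lefts × inClass (a , b) ≡ true
        from-L b∈ with (a , _) , ab∈ , refl ← ∈-map⁻ proj₂ b∈ = a , ∈-filterᵇ⁻ inClass ab∈
        colour : ∀ {a b} → inClass (a , b) ≡ true → col c a b ≡ γ
        colour {a} {b} e = ⌊⌋-elim (col c a b ≟ γ) (proj₂ (∧-true {poor v a b x} e))
        isGood : ∀ {a b} → inClass (a , b) ≡ true → Good v a b x
        isGood {a} {b} e = poor⇒Good (proj₁ (∧-true {poor v a b x} e))
        -- A vertex `b` comes from one pair only, as the colour `γ` at `b` determines `a`.
        once : AtMostOnce L
        once p unique = begin
          ∑ L (λ b → ⟦ p b ⟧)                                      ≡⟨ ∑-L _ ⟩
          ∑ lefts (λ (a , b) → ⟦ inClass (a , b) ⟧ * ⟦ p b ⟧) ≡⟨ ∑-cong lefts (λ (a , b) → sym (⟦∧⟧ (inClass (a , b)) (p b))) ⟩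
          ∑ lefts (λ (a , b) → ⟦ inClass (a , b) ∧ p b ⟧) ≤⟨ ≤-trans (proj₂ lefts≼ _) (proj₂ (filter-≼ _ VV) _) ⟩
          ∑ VV (λ (a , b) → ⟦ inClass (a , b) ∧ p b ⟧) ≤⟨ ∑≤1 (cartesianProduct⁺ (allFin⁺ n) (allFin⁺ n)) _ same ⟩
          1                                                        ∎
          where
          open ≤-Reasoning
          same : ∀ {β β′} → inClass β ∧ p (proj₂ β) ≡ true → inClass β′ ∧ p (proj₂ β′) ≡ true → β ≡ β′
          same {a , b} {a′ , b′} e e′ with refl ← unique (proj₂ (∧-true {inClass (a , b)} e)) (proj₂ (∧-true {inClass (a′ , b′)} e′)) =
            let q = proj₁ (∧-true {inClass (a , b)} e)
                q′ = proj₁ (∧-true {inClass (a′ , b′)} e′)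
                ab = Good.ab (isGood q)
                ab′ = Good.ab (isGood q′)
            in cong (_, b) (col-unique (adj-sym ab) (adj-sym ab′)
                 (trans (sym (colSym c a b ab)) (trans (colour q) (trans (sym (colour q′)) (colSym c a′ b ab′)))))
        adjacent : ∀ {b} → b ∈ L → adj G x b ≡ true
        adjacent b∈ = let _ , _ , e = from-L b∈ in adj-sym (Good.bx (isGood e))
        clustered : M < ∑ lefts (λ (a , b) → ⟦ poor v a b x ∧ sameColour (col c a b) γ ⟧) →
          ∀ {b} → b ∈ L → K ≤ ∑ L (λ b′ → ⟦ heavy b b′ ⟧)
        clustered large {b} b∈ = let a , _ , e = from-L b∈ in M-split
          (<-≤-trans large (≤-reflexive (begin
            ∑ lefts (λ (a , b) → ⟦ inClass (a , b) ⟧) ≡⟨ ∑-cong lefts (λ β → sym (*-identityʳ _)) ⟩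
            ∑ lefts (λ (a , b) → ⟦ inClass (a , b) ⟧ * 1)      ≡⟨ sym (∑-L (λ _ → 1)) ⟩
            ∑ L (λ _ → 1) ≡⟨ ∑-cong L (λ b′ → dichotomy (heavy b b′)) ⟩
            ∑ L (λ b′ → ⟦ heavy b b′ ⟧ + ⟦ light b b′ ⟧)       ≡⟨ ∑-+ L _ _ ⟩
            ∑ L (λ b′ → ⟦ heavy b b′ ⟧) + ∑ L (λ b′ → ⟦ light b b′ ⟧) ∎)))
          (≤-<-trans (fewLight e) (poor⇒siblings (proj₁ (∧-true {poor _ _ _ x} e))))
          where
          open ≡-Reasoning
          dichotomy : ∀ h → 1 ≡ ⟦ h ⟧ + ⟦ not h ⟧
          dichotomy true = refl
          dichotomy false = refl
          fewLight : ∀ {a} → inClass (a , b) ≡ true → ∑ L (λ b′ → ⟦ light b b′ ⟧) ≤ siblings v a b x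
          fewLight {a} e = ≤-trans (≤-reflexive (∑-L _)) (≤-trans
            (∑-mono lefts λ (a′ , b′) → ≤-trans (≤-reflexive (sym (⟦∧⟧ (inClass (a′ , b′)) (light b b′))))
              (⟦⟧-mono {b = good v a′ b′ x ∧ (sameColour (col c a′ b′) (col c a b) ∧ light b b′)} λ q →
                let q₁ , q₂ = ∧-true {inClass (a′ , b′)} q
                in ∧-intro (proj₁ (∧-true {good v a′ b′ x} (proj₁ (∧-true {poor v a′ b′ x} q₁))))
                     (∧-intro (⌊⌋-true (col c a′ b′ ≟ col c a b) (trans (colour q₁) (sym (colour e)))) q₂)))
            (∑-lefts _))

      -- The edge `b x` is used at once, `a b` and `v a` only if the path closes up next; all three
      -- colours and both vertices are kept fresh.
      Admissible : Fin n → List (Fin n) → List ℕ → Fin n × Fin n → Set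
      Admissible x F Q (a , b) = (a , b) ∈ lefts × Good v a b x × b ∉ F × a ∉ F × col c v a ∉ Q × col c b x ∉ Q × col c a b ∉ Q

      byB byA : Fin n → Fin n × Fin n → Bool
      byB u (a , b) = b == u
      byA u (a , b) = a == u

      byVA byAB : ℕ → Fin n × Fin n → Bool
      byVA γ (a , b) = sameColour (col c v a) γ
      byAB γ (a , b) = sameColour (col c a b) γ

      byBX : Fin n → ℕ → Fin n × Fin n → Bool
      byBX x γ (a , b) = sameColour (col c b x) γ

      exclusions : Fin n → List (Fin n) → List ℕ → List (Fin n × Fin n → Bool)
      exclusions x F Q = map byB F ++ (map byA F ++ (map byVA Q ++ (map (byBX x) Q ++ map byAB Q)))

      length-exclusions : ∀ x F Q → length (exclusions x F Q) ≡ length F + length F + length Q + length Q + length Q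
      length-exclusions x F Q = begin
        length (map byB F ++ (map byA F ++ (map byVA Q ++ (map (byBX x) Q ++ map byAB Q)))) ≡⟨ length-++ (map byB F) ⟩
        length (map byB F) + length (map byA F ++ (map byVA Q ++ (map (byBX x) Q ++ map byAB Q)))
          ≡⟨ cong (length (map byB F) +_) (trans (length-++ (map byA F)) (cong (length (map byA F) +_)
               (trans (length-++ (map byVA Q)) (cong (length (map byVA Q) +_) (length-++ (map (byBX x) Q)))))) ⟩
        length (map byB F) + (length (map byA F) + (length (map byVA Q) + (length (map (byBX x) Q) + length (map byAB Q))))
          ≡⟨ cong₂ _+_ (length-map byB F) (cong₂ _+_ (length-map byA F) (cong₂ _+_ (length-map byVA Q)
               (cong₂ _+_ (length-map (byBX x) Q) (length-map byAB Q)))) ⟩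
        length F + (length F + (length Q + (length Q + length Q))) ≡⟨ reassoc (length F) (length Q) ⟩
        length F + length F + length Q + length Q + length Q        ∎
        where
        open ≡-Reasoning
        reassoc : ∀ f q → f + (f + (q + (q + q))) ≡ f + f + q + q + q
        reassoc = solve-∀

      same== : ∀ {u x y : Fin n} → (x == u) ≡ true → (y == u) ≡ true → x ≡ y
      same== {u} {x} {y} p q = trans (⌊⌋-elim (x F.≟ u) p) (sym (⌊⌋-elim (y F.≟ u) q))

      sameCol : ∀ {γ δ ε} → sameColour δ γ ≡ true → sameColour ε γ ≡ true → δ ≡ ε
      sameCol {γ} {δ} {ε} p q = trans (⌊⌋-elim (δ ≟ γ) p) (sym (⌊⌋-elim (ε ≟ γ) q))

      exclusions-bounded : ∀ x F Q → All (λ f → ∑ lefts (λ β → ⟦ edge β x ∧ f β ⟧) ≤ M) (exclusions x F Q)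
      exclusions-bounded x F Q =
        All.++⁺ (bounded-map byB lefts (λ β → edge β x) F λ u → bound-b x (_== u) λ {b} {b′} p q →
          same== (proj₂ (∧-true {adj G x b} p)) (proj₂ (∧-true {adj G x b′} q)))
        (All.++⁺ (bounded-map byA lefts (λ β → edge β x) F λ u → bound-a x (_== u) λ {a} {a′} p q →
          same== (proj₂ (∧-true {adj G v a} p)) (proj₂ (∧-true {adj G v a′} q)))
        (All.++⁺ (bounded-map byVA lefts (λ β → edge β x) Q λ γ → bound-a x (λ a → sameColour (col c v a) γ) λ {a} {a′} p q →
          let va , s = ∧-true {adj G v a} p
              va′ , s′ = ∧-true {adj G v a′} q
          in col-unique va va′ (sameCol s s′))
        (All.++⁺ (bounded-map (byBX x) lefts (λ β → edge β x) Q λ γ → bound-b x (λ b → sameColour (col c b x) γ) λ {b} {b′} p q →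
          let xb , s = ∧-true {adj G x b} p
              xb′ , s′ = ∧-true {adj G x b′} q
          in col-unique xb xb′ (trans (colSym c x b xb) (trans (sameCol s s′) (colSym c b′ x (adj-sym xb′)))))
        (bounded-map byAB lefts (λ β → edge β x) Q λ γ → bound-ab x γ))))

      exclusions-avoided : ∀ {x} F Q {a b} → (a , b) ∈ lefts → Good v a b x →
        All (λ f → f (a , b) ≡ false) (exclusions x F Q) → Admissible x F Q (a , b)
      exclusions-avoided {x} F Q {a} {b} ab∈ g h₁ =
        ab∈ , g
        , (λ u∈ → ⌊⌋-false (b F.≟ b) (avoided-map byB (All.++⁻ˡ (map byB F) h₁) u∈) refl)
        , (λ u∈ → ⌊⌋-false (a F.≟ a) (avoided-map byA (All.++⁻ˡ (map byA F) h₂) u∈) refl)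
        , (λ γ∈ → ⌊⌋-false (col c v a ≟ col c v a) (avoided-map byVA (All.++⁻ˡ (map byVA Q) h₃) γ∈) refl)
        , (λ γ∈ → ⌊⌋-false (col c b x ≟ col c b x) (avoided-map (byBX x) (All.++⁻ˡ (map (byBX x) Q) h₄) γ∈) refl)
        , (λ γ∈ → ⌊⌋-false (col c a b ≟ col c a b) (avoided-map byAB (All.++⁻ʳ (map (byBX x) Q) h₄) γ∈) refl)
        where
        h₂ = All.++⁻ʳ (map byB F) h₁
        h₃ = All.++⁻ʳ (map byA F) h₂
        h₄ = All.++⁻ʳ (map byVA Q) h₃

      abstract
        pickPath : ∀ {x} → x ∈ rights → ∀ F Q → length F ≤ 2 + m → length Q ≤ 2 + m → ∃ (Admissible x F Q)
        pickPath {x} x∈ F Q lF lQ =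
          let (a , b) , ab∈ , e , avoided = pick lefts M (λ β → edge β x) (exclusions x F Q) (exclusions-bounded x F Q)
                (<-≤-trans (≤-<-trans (≤-reflexive (cong (_* M) (length-exclusions x F Q))) (roomy₅ lF lF lQ lQ lQ)) (rightDeg x∈))
          in (a , b) , exclusions-avoided F Q ab∈ (poor⇒Good e) avoided

      -- The path ends in `b`, and `a` is held in reserve off the path as the way home. As the pair
      -- stays in the core, the path may also grow further, discarding this `a`.
      record Closes (b : Fin n) (F : List (Fin n)) (Q : List ℕ) : Set where
        constructor closes
        field
          {a} : Fin n
          ab∈ : (a , b) ∈ lefts
          va : adj G v a ≡ true
          ab : adj G a b ≡ true
          b≢v : b ≢ v
          a∉ : a ∉ (b ∷ F)
          ab∉ : col c a b ∉ Q
          va∉ : col c v a ∉ Q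

      attach : ∀ {b x F Q} → RPath v b F Q → adj G x b ≡ true → x ∉ (b ∷ F) → col c x b ∉ Q →
        ∃ (Admissible x (x ∷ b ∷ F) (col c x b ∷ Q)) → Reach v Closes (2 + length F)
      attach {b} {x} {F} {Q} p xb x∉ xb∉ ((a′ , b′) , ab∈ , g , b∉ , a∉ , va∉ , bx∉ , ab∉) =
        reach (step (step p xb x∉ xb∉) bx b∉ bx∉) (closes ab∈ va ab b≢v a∉′ ab∉′ va∉′) refl
        where
        open Good g
        b≢v : b′ ≢ v
        b≢v refl = b∉ (there (root∈ p))
        a∉′ : a′ ∉ (b′ ∷ x ∷ b ∷ F)
        a∉′ (here q) = adj-≢ ab q
        a∉′ (there q) = a∉ q
        ab∉′ : col c a′ b′ ∉ (col c b′ x ∷ col c x b ∷ Q)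
        ab∉′ (here q) = a∉ (here (col-unique (adj-sym ab) bx (trans (sym (colSym c a′ b′ ab)) q)))
        ab∉′ (there q) = ab∉ q
        va∉′ : col c v a′ ∉ (col c b′ x ∷ col c x b ∷ Q)
        -- The one clash that freshness cannot exclude, as both edges come with the same pair;
        -- `good` rules it out.
        va∉′ (here q) = va≢bx q
        va∉′ (there q) = va∉ q

      OnPath : Fin n → Set
      OnPath b = ∃ λ a → (a , b) ∈ lefts

      extend : Extends v m OnPath Closes
      extend {b} {F} {Q} p (a , ab∈) le
        using x , x∈ , e , x∉ , xb∉ , _ ← pickVertex rights (≼-atMostOnce rights≼) (poor v a b) (b ∷ F) b Q b []
                (Good.bx ∘ poor⇒Good) (Good.bx ∘ poor⇒Good)
                (<-≤-trans (roomy (s≤s (m≤n⇒m≤1+n le)) (m≤n⇒m≤1+n (colours≤ p le)) z≤n) (≤-trans K≤D (leftDeg ab∈)))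
        = attach p (adj-sym (Good.bx (poor⇒Good e))) x∉ xb∉
            (pickPath x∈ (x ∷ b ∷ F) (col c x b ∷ Q) (s≤s (s≤s le)) (s≤s (m≤n⇒m≤1+n (colours≤ p le))))

      initial : ∀ {x} → ∃ (Admissible x [ v ] []) → ∃ λ a → ∃ λ b → (a , b) ∈ lefts × RPath v b (a ∷ v ∷ []) (col c b a ∷ col c a v ∷ [])
      initial ((a , b) , ab∈ , g , b∉ , _) = a , b , ab∈ ,
        step (step start (adj-sym va) a≢v (λ ())) (adj-sym ab) b∉′ ba∉
        where
        open Good g
        a≢v : a ∉ [ v ]
        a≢v (here e) = adj-≢ va (sym e)
        b∉′ : b ∉ (a ∷ v ∷ [])
        b∉′ (here e) = adj-≢ ab (sym e)
        b∉′ (there q) = b∉ q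
        ba∉ : col c b a ∉ [ col c a v ]
        ba∉ (here e) = b∉ (here (col-unique ab (adj-sym va) (trans (colSym c a b ab) e)))

      finish : ∀ {ℓ} → Reach v Closes ℓ → HasRainbowCycle (suc (suc ℓ)) G c
      finish (reach {b} {F} {Q} p (closes {a} ab∈ va ab b≢v a∉ ab∉ va∉) refl) = close (step p ab a∉ ab∉) va va∉′
        where
        va∉′ : col c v a ∉ (col c a b ∷ Q)
        va∉′ (here e) = b≢v (sym (col-unique (adj-sym va) ab (trans (sym (colSym c v a va)) e)))
        va∉′ (there r) = va∉ r

      -- Two edges out, `suc i` rounds and two edges home make 2 i + 6 = m. A round is indispensable
      -- for `Closes`, so the argument starts with k = 3.
      contradictory : ⊥
      contradictory
        using a , b , ab∈ , p ← initial (pickPath right₀∈ [ v ] [] (s≤s z≤n) z≤n)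
        = free (subst (λ ℓ → HasRainbowCycle ℓ G c) (trans (lem i) (sym m≡))
            (finish (iterate {Inv = OnPath} (λ e → _ , Closes.ab∈ e) extend i p (a , ab∈) (≤-trans bound (≤-reflexive (sym m≡))))))
        where
        lem : ∀ i → suc (suc (2 + 2 * i + 2)) ≡ 4 + 2 * suc i
        lem = solve-∀
        bound : 2 * i + 2 ≤ 4 + 2 * suc i
        bound = ≤-trans (≤-reflexive (trans (+-comm (2 * i) 2) (sym (*-suc 2 i)))) (m≤n+m _ 4)

-- Counting all three-edge walks

module ThreeWalkBound {n : ℕ} (G : Graph n) (c : ProperColouring G)
  (m i : ℕ) (m≡ : m ≡ 4 + 2 * suc i) (free : ¬ HasRainbowCycle m G c) where

  open Rainbow G c
  open Codegrees G
  open Upper G c m (suc i) m≡ free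
  open ThreeWalks G c m i m≡ free

  ∑⁴ : (Fin n → Fin n → Fin n → Fin n → ℕ) → ℕ
  ∑⁴ f = ∑ V (λ v → ∑ V (λ a → ∑ V (λ b → ∑ V (λ x → f v a b x))))

  ∑⁴-mono : ∀ {f g} → (∀ v a b x → f v a b x ≤ g v a b x) → ∑⁴ f ≤ ∑⁴ g
  ∑⁴-mono h = ∑-mono V λ v → ∑-mono V λ a → ∑-mono V λ b → ∑-mono V λ x → h v a b x

  ∑⁴-+ : ∀ f g → ∑⁴ (λ v a b x → f v a b x + g v a b x) ≡ ∑⁴ f + ∑⁴ g
  ∑⁴-+ f g = trans (∑-cong V λ v → trans (∑-cong V λ a → trans (∑-cong V λ b → ∑-+ V _ _) (∑-+ V _ _)) (∑-+ V _ _)) (∑-+ V _ _)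

  threeWalks : ℕ
  threeWalks = ∑ V (λ u → ∑ V (λ w → deg u * (A u w * deg w)))

  ∑⁴-walk : ∑⁴ (λ v a b x → ⟦ walk v a b x ⟧) ≡ threeWalks
  ∑⁴-walk = begin
    ∑⁴ (λ v a b x → ⟦ walk v a b x ⟧)
      ≡⟨ ∑-cong V (λ v → ∑-cong V λ a → ∑-cong V λ b → trans (∑-cong V λ x → ⟦∧⟧³ (adj G v a) (adj G a b) (adj G b x)) (∑-*ˡ² V (A v a) (A a b) (A b))) ⟩
    ∑ V (λ v → ∑ V (λ a → ∑ V (λ b → A v a * (A a b * deg b))))  ≡⟨ ∑-swap V V _ ⟩
    ∑ V (λ a → ∑ V (λ v → ∑ V (λ b → A v a * (A a b * deg b)))) ≡⟨ ∑-cong V (λ a → ∑-swap V V _) ⟩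
    ∑ V (λ a → ∑ V (λ b → ∑ V (λ v → A v a * (A a b * deg b))))
      ≡⟨ ∑-cong V (λ a → ∑-cong V λ b → trans (∑-*ʳ V _ _) (cong (_* (A a b * deg b)) (∑-cong V (λ v → A-sym v a)))) ⟩
    threeWalks ∎
    where open ≡-Reasoning

  -- For fixed `b` there are at most `H * deg b` choices of `v` and `a` by `∑-heavy`, and `deg b`
  -- choices of `x`.
  ∑⁴-heavy₁ : ∑⁴ (λ v a b x → ⟦ walk v a b x ∧ heavy v b ⟧) ≤ H * ∑ V (λ v → deg v * deg v)
  ∑⁴-heavy₁ = begin
    ∑⁴ (λ v a b x → ⟦ walk v a b x ∧ heavy v b ⟧)
      ≡⟨ ∑-cong V (λ v → ∑-cong V λ a → ∑-cong V λ b → trans (∑-cong V λ x → expand v a b x) (∑-*ˡ V (⟦ heavy v b ⟧ * (A v a * A a b)) (A b))) ⟩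
    ∑ V (λ v → ∑ V (λ a → ∑ V (λ b → ⟦ heavy v b ⟧ * (A v a * A a b) * deg b))) ≡⟨ ∑-cong V (λ v → ∑-swap V V _) ⟩
    ∑ V (λ v → ∑ V (λ b → ∑ V (λ a → ⟦ heavy v b ⟧ * (A v a * A a b) * deg b)))
      ≡⟨ ∑-cong V (λ v → ∑-cong V λ b → trans (∑-*ʳ V (deg b) _) (cong (_* deg b) (∑-*ˡ V ⟦ heavy v b ⟧ _))) ⟩
    ∑ V (λ v → ∑ V (λ b → ⟦ heavy v b ⟧ * codeg v b * deg b)) ≡⟨ ∑-swap V V _ ⟩
    ∑ V (λ b → ∑ V (λ v → ⟦ heavy v b ⟧ * codeg v b * deg b)) ≡⟨ ∑-cong V (λ b → ∑-*ʳ V (deg b) _) ⟩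
    ∑ V (λ b → ∑ V (λ v → ⟦ heavy v b ⟧ * codeg v b) * deg b)
      ≤⟨ ∑-mono V (λ b → *-monoˡ-≤ (deg b) (≤-trans (≤-reflexive (∑-cong V λ v →
           cong (λ z → ⟦ H ≤ᵇ z ⟧ * z) (codeg-sym v b))) (∑-heavy b))) ⟩
    ∑ V (λ b → H * deg b * deg b) ≡⟨ ∑-cong V (λ b → *-assoc H (deg b) (deg b)) ⟩
    ∑ V (λ b → H * (deg b * deg b)) ≡⟨ ∑-*ˡ V H _ ⟩
    H * ∑ V (λ v → deg v * deg v)                                                 ∎
    where
    open ≤-Reasoning
    lem : ∀ a b c d → a * (b * c) * d ≡ d * (a * b) * c
    lem = solve-∀
    expand : ∀ v a b x → ⟦ walk v a b x ∧ heavy v b ⟧ ≡ ⟦ heavy v b ⟧ * (A v a * A a b) * A b x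
    expand v a b x = trans (⟦∧⟧ (walk v a b x) (heavy v b)) (trans (cong (_* ⟦ heavy v b ⟧) (⟦∧⟧³ (adj G v a) (adj G a b) (adj G b x)))
      (lem (A v a) (A a b) (A b x) ⟦ heavy v b ⟧))

  ∑⁴-reverse : ∀ f → ∑⁴ f ≡ ∑⁴ (λ v a b x → f x b a v)
  ∑⁴-reverse f = begin
    ∑ V (λ v → ∑ V λ a → ∑ V λ b → ∑ V λ x → f v a b x) ≡⟨ ∑-cong V (λ v → ∑-cong V λ a → ∑-swap V V _) ⟩
    ∑ V (λ v → ∑ V λ a → ∑ V λ x → ∑ V λ b → f v a b x) ≡⟨ ∑-cong V (λ v → ∑-swap V V _) ⟩
    ∑ V (λ v → ∑ V λ x → ∑ V λ a → ∑ V λ b → f v a b x) ≡⟨ ∑-swap V V _ ⟩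
    ∑ V (λ x → ∑ V λ v → ∑ V λ a → ∑ V λ b → f v a b x) ≡⟨ ∑-cong V (λ x → ∑-cong V λ v → ∑-swap V V _) ⟩
    ∑ V (λ x → ∑ V λ v → ∑ V λ b → ∑ V λ a → f v a b x) ≡⟨ ∑-cong V (λ x → ∑-swap V V _) ⟩
    ∑ V (λ x → ∑ V λ b → ∑ V λ v → ∑ V λ a → f v a b x) ≡⟨ ∑-cong V (λ x → ∑-cong V λ b → ∑-swap V V _) ⟩
    ∑ V (λ x → ∑ V λ b → ∑ V λ a → ∑ V λ v → f v a b x) ∎
    where open ≡-Reasoning

  ∑⁴-heavy₂ : ∑⁴ (λ v a b x → ⟦ walk v a b x ∧ heavy a x ⟧) ≤ H * ∑ V (λ v → deg v * deg v)
  ∑⁴-heavy₂ = ≤-trans (≤-reflexive (∑⁴-reverse _)) (≤-trans (∑⁴-mono reversed) ∑⁴-heavy₁)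
    where
    reversed : ∀ v a b x → ⟦ walk x b a v ∧ heavy b v ⟧ ≤ ⟦ walk v a b x ∧ heavy v b ⟧
    reversed v a b x = ⟦⟧-mono λ e →
      let w , h = ∧-true {walk x b a v} e
          xb , r = ∧-true w
          ba , av = ∧-true r
      in ∧-intro (∧-intro (adj-sym av) (∧-intro (adj-sym ba) (adj-sym xb)))
           (trans (cong (H ≤ᵇ_) (codeg-sym v b)) h)

  -- The colour of `v a` determines `x` among the neighbours of `b`.
  ∑⁴-sameColour : ∑⁴ (λ v a b x → ⟦ walk v a b x ∧ sameColour (col c v a) (col c b x) ⟧) ≤ ∑ V twoWalks
  ∑⁴-sameColour = ∑-mono V λ v → ∑-mono V λ a → ≤-trans (∑-mono V (λ b → last v a b)) (≤-reflexive (∑-*ˡ V (A v a) (A a)))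
    where
    open ≤-Reasoning
    pointwise : ∀ v a b x → ⟦ walk v a b x ∧ sameColour (col c v a) (col c b x) ⟧ ≤
      A v a * (A a b * ⟦ adj G b x ∧ sameColour (col c v a) (col c b x) ⟧)
    pointwise v a b x = ≤-trans (⟦⟧-mono {b = adj G v a ∧ (adj G a b ∧ (adj G b x ∧ sameColour (col c v a) (col c b x)))} λ e →
        let w , s = ∧-true {walk v a b x} e
            va , r = ∧-true {adj G v a} w
            ab , bx = ∧-true {adj G a b} r
        in ∧-intro {adj G v a} va (∧-intro {adj G a b} ab (∧-intro {adj G b x} bx s)))
      (≤-reflexive (⟦∧⟧³ (adj G v a) (adj G a b) _))
    last : ∀ v a b → ∑ V (λ x → ⟦ walk v a b x ∧ sameColour (col c v a) (col c b x) ⟧) ≤ A v a * A a b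
    last v a b = begin
      ∑ V (λ x → ⟦ walk v a b x ∧ sameColour (col c v a) (col c b x) ⟧) ≤⟨ ∑-mono V (pointwise v a b) ⟩
      ∑ V (λ x → A v a * (A a b * ⟦ adj G b x ∧ sameColour (col c v a) (col c b x) ⟧)) ≡⟨ ∑-*ˡ² V (A v a) (A a b) _ ⟩
      A v a * (A a b * ∑ V (λ x → ⟦ adj G b x ∧ sameColour (col c v a) (col c b x) ⟧))
        ≤⟨ *-monoʳ-≤ (A v a) (*-monoʳ-≤ (A a b) (∑-allFin≤1 _ λ {x} {y} p q →
             col-unique (proj₁ (∧-true p)) (proj₁ (∧-true q))
               (trans (sym (⌊⌋-elim (col c v a ≟ col c b x) (proj₂ (∧-true {adj G b x} p))))
                 (⌊⌋-elim (col c v a ≟ col c b y) (proj₂ (∧-true {adj G b y} q)))))) ⟩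
      A v a * (A a b * 1) ≡⟨ cong (A v a *_) (*-identityʳ _) ⟩
      A v a * A a b ∎

  -- A rich walk v a b x has 2H light siblings a′ b′; conversely v a b a′ and the colour determine b′, and then
  -- x is one of at most H common neighbours of b and b′.
  ∑⁴-rich : ∑⁴ (λ v a b x → ⟦ rich v a b x ⟧ * (2 * H)) ≤ H * threeWalks
  ∑⁴-rich = begin
    ∑⁴ (λ v a b x → ⟦ rich v a b x ⟧ * (2 * H)) ≤⟨ ∑⁴-mono pointwise ⟩
    ∑⁴ (λ v a b x → ∑ V (λ a′ → ∑ V (λ b′ → g v a b a′ b′ x)))
      ≡⟨ ∑-cong V (λ v → ∑-cong V λ a → ∑-cong V λ b → trans (∑-swap V V _) (∑-cong V λ a′ → ∑-swap V V _)) ⟩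
    ∑⁴ (λ v a b a′ → ∑ V (λ b′ → ∑ V (λ x → g v a b a′ b′ x))) ≤⟨ ∑⁴-mono count ⟩
    ∑⁴ (λ v a b a′ → A v a * A a b * A v a′ * H)
      ≡⟨ ∑-cong V (λ v → ∑-cong V λ a → trans (∑-cong V λ b → trans (∑-cong V λ a′ → *-assoc (A v a * A a b) (A v a′) H)
           (trans (∑-*ˡ V (A v a * A a b) _) (cong (A v a * A a b *_) (∑-*ʳ V H (A v))))) (∑-*ʳ V (deg v * H) _)) ⟩
    ∑ V (λ v → ∑ V (λ a → ∑ V (λ b → A v a * A a b) * (deg v * H)))
      ≡⟨ ∑-cong V (λ v → ∑-cong V λ a → trans (cong (_* (deg v * H)) (∑-*ˡ V (A v a) (A a))) (regroup (A v a) (deg a) (deg v) H)) ⟩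
    ∑ V (λ v → ∑ V (λ a → H * (deg v * (A v a * deg a))))
      ≡⟨ trans (∑-cong V λ v → ∑-*ˡ V H _) (∑-*ˡ V H _) ⟩
    H * threeWalks ∎
    where
    open ≤-Reasoning
    regroup : ∀ p q r s → p * q * (r * s) ≡ s * (r * (p * q))
    regroup = solve-∀
    next : Fin n → Fin n → Fin n → Fin n → Bool
    next a b a′ b′ = adj G a′ b′ ∧ sameColour (col c a′ b′) (col c a b)
    g : Fin n → Fin n → Fin n → Fin n → Fin n → Fin n → ℕ
    g v a b a′ b′ x = A v a * A a b * A v a′ * (⟦ next a b a′ b′ ⟧ * (⟦ light b b′ ⟧ * (A b x * A x b′)))
    expand : ∀ v a b a′ b′ x → ⟦ ((adj G v a ∧ adj G a b) ∧ adj G v a′) ∧ (next a b a′ b′ ∧ (light b b′ ∧ (adj G b x ∧ adj G x b′))) ⟧ ≡ g v a b a′ b′ x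
    expand v a b a′ b′ x = trans (⟦∧⟧ ((adj G v a ∧ adj G a b) ∧ adj G v a′) _) (cong₂ _*_
      (trans (⟦∧⟧ (adj G v a ∧ adj G a b) _) (cong (_* A v a′) (⟦∧⟧ (adj G v a) _)))
      (⟦∧⟧⁴ (next a b a′ b′) (light b b′) (adj G b x) (adj G x b′)))
    pointwise : ∀ v a b x → ⟦ rich v a b x ⟧ * (2 * H) ≤ ∑ V (λ a′ → ∑ V (λ b′ → g v a b a′ b′ x))
    pointwise v a b x with rich v a b x in e
    ... | false = z≤n
    ... | true = begin
      2 * H + 0           ≡⟨ +-identityʳ (2 * H) ⟩
      2 * H ≤⟨ ≤ᵇ⇒≤ (2 * H) _ (subst T (sym (proj₂ (∧-true {good v a b x} e))) _) ⟩
      siblings v a b x    ≤⟨ ∑-mono V (λ a′ → ∑-mono V λ b′ → ≤-trans (⟦⟧-mono (λ q →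
          let g′ , r = ∧-true {good v a′ b′ x} q
              s , l = ∧-true {sameColour (col c a′ b′) (col c a b)} r
              open Good (good⇒Good (proj₁ (∧-true {good v a b x} e)))
              module S = Good (good⇒Good g′)
          in ∧-intro (∧-intro (∧-intro va ab) S.va) (∧-intro (∧-intro S.ab s) (∧-intro l (∧-intro bx (adj-sym S.bx))))))
          (≤-reflexive (expand v a b a′ b′ x))) ⟩
      ∑ V (λ a′ → ∑ V (λ b′ → g v a b a′ b′ x)) ∎
    count : ∀ v a b a′ → ∑ V (λ b′ → ∑ V (λ x → g v a b a′ b′ x)) ≤ A v a * A a b * A v a′ * H
    count v a b a′ = begin
      ∑ V (λ b′ → ∑ V (λ x → P * (⟦ next a b a′ b′ ⟧ * (⟦ light b b′ ⟧ * (A b x * A x b′)))))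
        ≡⟨ ∑-cong V (λ b′ → trans (∑-*ˡ² V P ⟦ next a b a′ b′ ⟧ _) (cong (λ z → P * (⟦ next a b a′ b′ ⟧ * z)) (∑-*ˡ V ⟦ light b b′ ⟧ _))) ⟩
      ∑ V (λ b′ → P * (⟦ next a b a′ b′ ⟧ * (⟦ light b b′ ⟧ * codeg b b′)))
        ≤⟨ ∑-mono V (λ b′ → *-monoʳ-≤ P (*-monoʳ-≤ ⟦ next a b a′ b′ ⟧ (light-codeg b b′))) ⟩
      ∑ V (λ b′ → P * (⟦ next a b a′ b′ ⟧ * H))
        ≡⟨ trans (∑-*ˡ V P _) (cong (P *_) (∑-*ʳ V H _)) ⟩
      P * (∑ V (λ b′ → ⟦ next a b a′ b′ ⟧) * H)
        ≤⟨ *-monoʳ-≤ P (≤-trans (*-monoˡ-≤ H (∑-allFin≤1 _ λ {x} {y} p q →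
             col-unique (proj₁ (∧-true p)) (proj₁ (∧-true q))
               (trans (⌊⌋-elim (col c a′ x ≟ col c a b) (proj₂ (∧-true {adj G a′ x} p)))
                 (sym (⌊⌋-elim (col c a′ y ≟ col c a b) (proj₂ (∧-true {adj G a′ y} q)))))))
             (≤-reflexive (*-identityˡ H))) ⟩
      P * H ∎
      where
      P = A v a * A a b * A v a′

  -- For each `v` the excluded core bounds the poor walks by `D` times the number of two-edge walks
  -- from `v` plus the number of end vertices.
  ∑⁴-poor : ∑⁴ (λ v a b x → ⟦ poor v a b x ⟧) ≤ D * (∑ V twoWalks + n * n)
  ∑⁴-poor = begin
    ∑⁴ (λ v a b x → ⟦ poor v a b x ⟧)        ≤⟨ ∑-mono V bound ⟩
    ∑ V (λ v → D * (twoWalks v + n))         ≡⟨ ∑-*ˡ V D _ ⟩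
    D * ∑ V (λ v → twoWalks v + n) ≡⟨ cong (D *_) (trans (∑-+ V _ _) (cong (∑ V twoWalks +_) (trans (∑-const V n) (cong (_* n) (length-allFin n))))) ⟩
    D * (∑ V twoWalks + n * n)               ∎
    where
    open ≤-Reasoning
    bound : ∀ v → ∑ V (λ a → ∑ V (λ b → ∑ V (λ x → ⟦ poor v a b x ⟧))) ≤ D * (twoWalks v + n)
    bound v = begin
      ∑ V (λ a → ∑ V (λ b → ∑ V (λ x → ⟦ poor v a b x ⟧)))
        ≤⟨ ∑-mono V (λ a → ∑-mono V λ b → ≤-trans (∑-mono V (λ x → pointwise a b x)) (≤-reflexive (∑-*ˡ V ⟦ adj G v a ∧ adj G a b ⟧ (λ x → ⟦ poor v a b x ⟧)))) ⟩
      ∑ V (λ a → ∑ V (λ b → ⟦ adj G v a ∧ adj G a b ⟧ * ∑ V (λ x → ⟦ poor v a b x ⟧))) ≡⟨ sym (∑-pairs V V _) ⟩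
      ∑ VV (λ (a , b) → ⟦ adj G v a ∧ adj G a b ⟧ * ∑ V (λ x → ⟦ poor v a b x ⟧)) ≡⟨ sym (∑-filter _ VV _) ⟩
      ∑ paths (λ β → ∑ V (λ x → ⟦ edge β x ⟧)) ≤⟨ ≮⇒≥ (λ dense → contradictory (core edge D paths V dense)) ⟩
      D * (length paths + length V) ≡⟨ cong (D *_) (cong₂ _+_ len (length-allFin n)) ⟩
      D * (twoWalks v + n)                           ∎
      where
      open PoorCore v
      pointwise : ∀ a b x → ⟦ poor v a b x ⟧ ≤ ⟦ adj G v a ∧ adj G a b ⟧ * ⟦ poor v a b x ⟧
      pointwise a b x = ≤-trans (⟦⟧-mono {b = (adj G v a ∧ adj G a b) ∧ poor v a b x} λ e →
          let open Good (poor⇒Good e) in ∧-intro (∧-intro va ab) e)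
        (≤-reflexive (⟦∧⟧ (adj G v a ∧ adj G a b) _))
      len : length paths ≡ twoWalks v
      len = trans (length-filterᵇ _ VV) (trans (∑-pairs V V _)
        (∑-cong V λ a → trans (∑-cong V λ b → ⟦∧⟧ (adj G v a) (adj G a b)) (∑-*ˡ V (A v a) (A a))))

  walk-cases : ∀ w h₁ h₂ s r → ⟦ w ⟧ ≤ ⟦ w ∧ h₁ ⟧ + (⟦ w ∧ h₂ ⟧ + (⟦ w ∧ s ⟧ +
    (⟦ (w ∧ (not h₁ ∧ (not h₂ ∧ not s))) ∧ r ⟧ + ⟦ (w ∧ (not h₁ ∧ (not h₂ ∧ not s))) ∧ not r ⟧)))
  walk-cases false _ _ _ _ = z≤n
  walk-cases true true _ _ _ = s≤s z≤n
  walk-cases true false true _ _ = s≤s z≤n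
  walk-cases true false false true _ = s≤s z≤n
  walk-cases true false false false true = s≤s z≤n
  walk-cases true false false false false = s≤s z≤n

  ∑-twoWalks² : ∑ V twoWalks ≤ H * (n * n)
  ∑-twoWalks² = begin
    ∑ V twoWalks          ≤⟨ ∑-mono V ∑-twoWalks ⟩
    ∑ V (λ _ → H * n)     ≡⟨ trans (∑-const V _) (cong (_* (H * n)) (length-allFin n)) ⟩
    n * (H * n)           ≡⟨ lem n H ⟩
    H * (n * n)           ∎
    where
    open ≤-Reasoning
    lem : ∀ n H → n * (H * n) ≡ H * (n * n)
    lem = solve-∀

  -- By `∑⁴-rich` at most half of all walks are rich, so they can be moved to the left side.
  -- Multiplying by 2H and cancelling `H * threeWalks` keeps this within ℕ.
  threeWalks≤ : threeWalks ≤ C₃ * (n * n)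
  threeWalks≤ = *-cancelˡ-≤ H {{H-nonZero}} (+-cancelˡ-≤ (H * threeWalks) _ _ (begin
    H * tw + H * tw                       ≡⟨ e₁ H tw ⟩
    2 * H * tw                            ≤⟨ *-monoʳ-≤ (2 * H) total ⟩
    2 * H * (X₁ + (X₂ + (X₃ + (R + X₅)))) ≡⟨ e₂ H X₁ X₂ X₃ R X₅ ⟩
    R * (2 * H) + 2 * H * (X₁ + X₂ + X₃ + X₅)
      ≤⟨ +-mono-≤ richBound (*-monoʳ-≤ (2 * H) (+-mono-≤ (+-mono-≤ (+-mono-≤ (≤-trans ∑⁴-heavy₁ heavyBound) (≤-trans ∑⁴-heavy₂ heavyBound))
           (≤-trans ∑⁴-sameColour ∑-twoWalks²)) (≤-trans ∑⁴-poor (*-monoʳ-≤ D (+-monoˡ-≤ (n * n) ∑-twoWalks²))))) ⟩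
    H * tw + 2 * H * (H * (H * (n * n)) + H * (H * (n * n)) + H * (n * n) + D * (H * (n * n) + n * n))
      ≡⟨ cong (H * tw +_) (e₃ H D (n * n)) ⟩
    H * tw + H * (C₃ * (n * n)) ∎))
    where
    open ≤-Reasoning
    tw = threeWalks
    X₁ = ∑⁴ (λ v a b x → ⟦ walk v a b x ∧ heavy v b ⟧)
    X₂ = ∑⁴ (λ v a b x → ⟦ walk v a b x ∧ heavy a x ⟧)
    X₃ = ∑⁴ (λ v a b x → ⟦ walk v a b x ∧ sameColour (col c v a) (col c b x) ⟧)
    R = ∑⁴ (λ v a b x → ⟦ rich v a b x ⟧)
    X₅ = ∑⁴ (λ v a b x → ⟦ poor v a b x ⟧)
    heavyBound : H * ∑ V (λ v → deg v * deg v) ≤ H * (H * (n * n))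
    heavyBound = *-monoʳ-≤ H (≤-trans (≤-reflexive ∑-degree²) ∑-twoWalks²)
    richBound : R * (2 * H) ≤ H * tw
    richBound = ≤-trans (≤-reflexive (sym (trans (∑-cong V λ v → trans (∑-cong V λ a → trans (∑-cong V λ b → ∑-*ʳ V (2 * H) _)
      (∑-*ʳ V (2 * H) _)) (∑-*ʳ V (2 * H) _)) (∑-*ʳ V (2 * H) _)))) ∑⁴-rich
    total : tw ≤ X₁ + (X₂ + (X₃ + (R + X₅)))
    total = begin
      tw                                    ≡⟨ sym ∑⁴-walk ⟩
      ∑⁴ (λ v a b x → ⟦ walk v a b x ⟧)
        ≤⟨ ∑⁴-mono (λ v a b x → walk-cases (walk v a b x) (heavy v b) (heavy a x) (sameColour (col c v a) (col c b x)) (manySiblings v a b x)) ⟩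
      _ ≡⟨ ∑⁴-+ _ _ ⟩
      _ ≡⟨ cong (X₁ +_) (trans (∑⁴-+ _ _) (cong (X₂ +_) (trans (∑⁴-+ _ _) (cong (X₃ +_) (∑⁴-+ _ _))))) ⟩
      X₁ + (X₂ + (X₃ + (R + X₅))) ∎
    e₁ : ∀ h t → h * t + h * t ≡ 2 * h * t
    e₁ = solve-∀
    e₂ : ∀ h a b c r d → 2 * h * (a + (b + (c + (r + d)))) ≡ r * (2 * h) + 2 * h * (a + b + c + d)
    e₂ = solve-∀
    e₃ : ∀ h d N → 2 * h * (h * (h * N) + h * (h * N) + h * N + d * (h * N + N)) ≡ h * (2 * (h * h + h * h + h + d * (h + 1)) * N)
    e₃ = solve-∀

-- Cycle maps and walks

module _ {A : Set} (p : A → Bool) where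

  and-elim : ∀ {xs x} → and (map p xs) ≡ true → x ∈ xs → p x ≡ true
  and-elim h (here refl) = proj₁ (∧-true h)
  and-elim {y ∷ _} h (there x∈) = and-elim (proj₂ (∧-true {p y} h)) x∈

  and-intro : ∀ xs → (∀ x → p x ≡ true) → and (map p xs) ≡ true
  and-intro [] h = refl
  and-intro (x ∷ xs) h = ∧-intro (h x) (and-intro xs h)

allB-elim : ∀ {m} (p : Fin m → Bool) → allB p ≡ true → ∀ i → p i ≡ true
allB-elim p h i = and-elim p h (∈-allFin i)

allB-intro : ∀ {m} (p : Fin m → Bool) → (∀ i → p i ≡ true) → allB p ≡ true
allB-intro {m} p = and-intro p (allFin m)

module _ {n : ℕ} (G : Graph n) where

  cycleMap-elim : ∀ {m} {f : Fin m → Fin n} → isCycleMapᵇ m G f ≡ true → CycleMap m G f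
  cycleMap-elim {m} {f} h = record
    { inj = λ i j e → distinct i j e (allB-elim _ (allB-elim _ (proj₂ split) i) j)
    ; edges = allB-elim _ (proj₁ split) }
    where
    split = ∧-true {allB (λ i → adj G (f i) (f (nextC i)))} h
    distinct : ∀ i j → f i ≡ f j → ⌊ i F.≟ j ⌋ ∨ not ⌊ f i F.≟ f j ⌋ ≡ true → i ≡ j
    distinct i j e q with i F.≟ j
    ... | yes i≡j = i≡j
    ... | no _ = contradiction e (⌊⌋-false (f i F.≟ f j) (not-false q))

  cycleMap-intro : ∀ {m} {f : Fin m → Fin n} → CycleMap m G f → isCycleMapᵇ m G f ≡ true
  cycleMap-intro {m} {f} C = ∧-intro (allB-intro _ (CycleMap.edges C)) (allB-intro _ λ i → allB-intro _ λ j → distinct i j)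
    where
    distinct : ∀ i j → ⌊ i F.≟ j ⌋ ∨ not ⌊ f i F.≟ f j ⌋ ≡ true
    distinct i j with i F.≟ j
    ... | yes _ = refl
    ... | no i≢j with f i F.≟ f j
    ...   | yes e = contradiction (CycleMap.inj C i j e) i≢j
    ...   | no _ = refl

-- The hypothesis speaks of `φ zero` and `φ ∘ suc`, which compute on the functions built by
-- `allFns`; no extensionality is involved.
∑-allFns≤ : ∀ {n} m (f : (Fin (suc m) → Fin n) → ℕ) (g : Fin n → (Fin m → Fin n) → ℕ) →
  (∀ φ → f φ ≤ g (φ zero) (φ ∘ suc)) → ∑ (allFns (suc m) n) f ≤ ∑ (allFin n) (λ x → ∑ (allFns m n) (g x))
∑-allFns≤ {n} m f g h = ≤-trans (≤-reflexive (∑-concatMap _ (allFin n) f))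
  (∑-mono (allFin n) λ x → ≤-trans (≤-reflexive (∑-map _ (allFns m n) f)) (∑-mono (allFns m n) λ φ → h _))

module Walks {n : ℕ} (G : Graph n) where

  open Codegrees G

  -- Of the injectivity of a cycle only the distinctness from t is kept: the codegree bound of the case k = 2 needs it.
  walkTo : ∀ m → Fin n → Fin n → (Fin m → Fin n) → Bool
  walkTo zero t u f = not (u == t) ∧ adj G u t
  walkTo (suc m) t u f = not (u == t) ∧ (adj G u (f zero) ∧ walkTo m t (f zero) (f ∘ suc))

  -- Entries of powers of the adjacency matrix. The index counts inner vertices, so there is one
  -- more edge.
  walks : ℕ → Fin n → Fin n → ℕ
  walks zero u t = A u t
  walks (suc m) u t = ∑ V (λ x → A u x * walks m x t)

  not-== : ∀ {u t : Fin n} → u ≢ t → not (u == t) ≡ true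
  not-== {u} {t} ne with u F.≟ t
  ... | yes e = contradiction e ne
  ... | no _ = refl

  private
    -- Cyclic successor with the return to the start redirected to `t`, so that dropping the first
    -- vertex keeps the end point.
    successor : ∀ {m} → Fin n → (Fin (suc m) → Fin n) → Fin (suc m) → Fin n
    successor t f i with nextC i
    ... | zero = t
    ... | suc j = f (suc j)

    successor-closed : ∀ {m} (f : Fin (suc m) → Fin n) i → successor (f zero) f i ≡ f (nextC i)
    successor-closed f i with nextC i
    ... | zero = refl
    ... | suc j = refl

    successor-suc : ∀ {m} t (f : Fin (suc (suc m)) → Fin n) i → successor t f (suc i) ≡ successor t (f ∘ suc) i
    successor-suc t f i with nextC i
    ... | zero = refl
    ... | suc j = refl

    walkTo-intro : ∀ m t (f : Fin (suc m) → Fin n) → (∀ i → f i ≢ t) →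
      (∀ i → adj G (f i) (successor t f i) ≡ true) → walkTo m t (f zero) (f ∘ suc) ≡ true
    walkTo-intro zero t f ne h = ∧-intro (not-== (ne zero)) (h zero)
    walkTo-intro (suc m) t f ne h = ∧-intro (not-== (ne zero)) (∧-intro (h zero)
      (walkTo-intro m t (f ∘ suc) (ne ∘ suc) (λ i → subst (λ z → adj G (f (suc i)) z ≡ true) (successor-suc t f i) (h (suc i)))))

  cycle⇒walk : ∀ m (f : Fin (suc (suc m)) → Fin n) → CycleMap (suc (suc m)) G f →
    adj G (f zero) (f (suc zero)) ∧ walkTo m (f zero) (f (suc zero)) (λ i → f (suc (suc i))) ≡ true
  cycle⇒walk m f C = ∧-intro (edges zero) (walkTo-intro m (f zero) (f ∘ suc) (λ i e → case inj (suc i) zero e of λ ())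
    (λ i → subst (λ z → adj G (f (suc i)) z ≡ true) (trans (sym (successor-closed f (suc i))) (successor-suc (f zero) f i)) (edges (suc i))))
    where open CycleMap C

  labelled≤ : ∀ m → labelledCycles (suc (suc m)) G ≤
    ∑ V (λ v → ∑ V (λ u → A v u * ∑ (allFns m n) (λ f → ⟦ walkTo m v u f ⟧)))
  labelled≤ m = begin
    labelledCycles (suc (suc m)) G ≡⟨ length-filterᵇ _ (allFns (suc (suc m)) n) ⟩
    ∑ (allFns (suc (suc m)) n) (λ f → ⟦ isCycleMapᵇ (suc (suc m)) G f ⟧) ≤⟨ ∑-allFns≤ (suc m) _ closing (λ φ →
        ⟦⟧-mono (λ e → cycle⇒walk m φ (cycleMap-elim G e))) ⟩
    ∑ V (λ v → ∑ (allFns (suc m) n) (closing v)) ≤⟨ ∑-mono V (λ v → ∑-allFns≤ m _ (λ u f → A v u * ⟦ walkTo m v u f ⟧)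
        (λ φ → ≤-reflexive (⟦∧⟧ (adj G v (φ zero)) _))) ⟩
    ∑ V (λ v → ∑ V (λ u → ∑ (allFns m n) (λ f → A v u * ⟦ walkTo m v u f ⟧)))
      ≡⟨ ∑-cong V (λ v → ∑-cong V λ u → ∑-*ˡ (allFns m n) (A v u) _) ⟩
    ∑ V (λ v → ∑ V (λ u → A v u * ∑ (allFns m n) (λ f → ⟦ walkTo m v u f ⟧))) ∎
    where
    open ≤-Reasoning
    closing : Fin n → (Fin (suc m) → Fin n) → ℕ
    closing v g = ⟦ adj G v (g zero) ∧ walkTo m v (g zero) (g ∘ suc) ⟧

  drop-≢ : ∀ b c → ⟦ not b ∧ c ⟧ ≤ ⟦ c ⟧
  drop-≢ true c = z≤n
  drop-≢ false c = ≤-refl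

  walkTo-step : ∀ m t u → ∑ (allFns (suc m) n) (λ f → ⟦ walkTo (suc m) t u f ⟧) ≤
    ∑ V (λ x → A u x * ∑ (allFns m n) (λ f → ⟦ walkTo m t x f ⟧))
  walkTo-step m t u = ≤-trans
    (∑-allFns≤ m _ (λ x f → A u x * ⟦ walkTo m t x f ⟧) λ φ →
      ≤-trans (drop-≢ (u == t) _) (≤-reflexive (⟦∧⟧ (adj G u (φ zero)) _)))
    (≤-reflexive (∑-cong V λ x → ∑-*ˡ (allFns m n) (A u x) _))

  walkTo≤walks : ∀ m t u → ∑ (allFns m n) (λ f → ⟦ walkTo m t u f ⟧) ≤ walks m u t
  walkTo≤walks zero t u = ≤-trans (≤-reflexive (+-identityʳ _)) (drop-≢ (u == t) _)
  walkTo≤walks (suc m) t u = ≤-trans (walkTo-step m t u) (∑-mono V λ x → *-monoʳ-≤ (A u x) (walkTo≤walks m t x))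

  labelled≤walks : ∀ m → labelledCycles (suc (suc m)) G ≤ ∑ V (λ v → walks (suc m) v v)
  labelled≤walks m = ≤-trans (labelled≤ m) (∑-mono V λ v → ∑-mono V λ u → *-monoʳ-≤ (A v u) (walkTo≤walks m v u))

  walks-snoc : ∀ m u t → walks (suc m) u t ≡ ∑ V (λ x → walks m u x * A x t)
  walks-snoc zero u t = refl
  walks-snoc (suc m) u t = begin
    ∑ V (λ y → A u y * walks (suc m) y t) ≡⟨ ∑-cong V (λ y → cong (A u y *_) (walks-snoc m y t)) ⟩
    ∑ V (λ y → A u y * ∑ V (λ x → walks m y x * A x t)) ≡⟨ ∑-cong V (λ y → sym (∑-*ˡ V (A u y) _)) ⟩
    ∑ V (λ y → ∑ V (λ x → A u y * (walks m y x * A x t)))         ≡⟨ ∑-swap V V _ ⟩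
    ∑ V (λ x → ∑ V (λ y → A u y * (walks m y x * A x t)))
      ≡⟨ ∑-cong V (λ x → trans (∑-cong V λ y → sym (*-assoc (A u y) _ _)) (∑-*ʳ V (A x t) _)) ⟩
    ∑ V (λ x → walks (suc m) u x * A x t)                         ∎
    where open ≡-Reasoning

  walks-sym : ∀ m u t → walks m u t ≡ walks m t u
  walks-sym zero u t = A-sym u t
  walks-sym (suc m) u t = trans (∑-cong V λ x → trans (*-comm (A u x) _) (cong₂ _*_ (walks-sym m x t) (A-sym u x)))
    (sym (walks-snoc m t u))

  twoSteps : ∀ u (f : Fin n → ℕ) → ∑ V (λ x → A u x * ∑ V (λ y → A x y * f y)) ≡ ∑ V (λ y → codeg u y * f y)
  twoSteps u f = begin
    ∑ V (λ x → A u x * ∑ V (λ y → A x y * f y)) ≡⟨ ∑-cong V (λ x → sym (∑-*ˡ V (A u x) _)) ⟩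
    ∑ V (λ x → ∑ V (λ y → A u x * (A x y * f y)))   ≡⟨ ∑-swap V V _ ⟩
    ∑ V (λ y → ∑ V (λ x → A u x * (A x y * f y)))
      ≡⟨ ∑-cong V (λ y → trans (∑-cong V λ x → sym (*-assoc (A u x) _ _)) (∑-*ʳ V (f y) _)) ⟩
    ∑ V (λ y → codeg u y * f y)                     ∎
    where open ≡-Reasoning

  twoWalks≡ : ∀ u → twoWalks u ≡ ∑ V (codeg u)
  twoWalks≡ u = sym (∑-codeg V u)

-- Upper bounds

-- Reduces by two constructors at a time, matching the removal of two edges from a walk.
double : ℕ → ℕ
double zero = zero
double (suc j) = suc (suc (double j))

double≡ : ∀ j → double j ≡ 2 * j
double≡ zero = refl
double≡ (suc j) = trans (cong (λ z → suc (suc z)) (double≡ j)) (sym (*-suc 2 j))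

^-distribʳ-* : ∀ j a b → (a * b) ^ j ≡ a ^ j * b ^ j
^-distribʳ-* zero a b = refl
^-distribʳ-* (suc j) a b = trans (cong (a * b *_) (^-distribʳ-* j a b)) (lem a b (a ^ j) (b ^ j))
  where
  lem : ∀ a b x y → a * b * (x * y) ≡ a * x * (b * y)
  lem = solve-∀

-- The upper bound for k = 2

module UpperQuadrilateral {n : ℕ} (G : Graph n) (c : ProperColouring G) (free : ¬ HasRainbowCycle 4 G c) where

  open Rainbow G c
  open Greedy G c
  open Codegrees G
  open Walks G

  -- Beside one common neighbour `a`, another one `b` fails only if `b = a`, `b w` has the colour of
  -- `a u`, or `u b` that of `w a`: three exclusions, since all other pairs of edges share a vertex.
  codeg≤3 : ∀ {u w} → u ≢ w → codeg u w ≤ 3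
  codeg≤3 {u} {w} u≢w = ≮⇒≥ λ many → cycle (≤-trans many (≤-reflexive (codeg-count u w)))
    where
    common : Fin n → Bool
    common a = adj G u a ∧ adj G w a
    cycle : 4 ≤ ∑ V (λ a → ⟦ common a ⟧) → ⊥
    cycle h =
      let a , _ , e = ∑>0 V common (≤-trans (s≤s z≤n) h)
          b , _ , e′ , b∉ , bw∉ , ub∉ = pickVertex V (≼-atMostOnce ≼-refl) common [ a ] w [ col c a u ] u [ col c w a ]
            (λ {x} q → proj₂ (∧-true {adj G u x} q)) (λ {x} q → proj₁ (∧-true {adj G u x} q)) h
          ua , wa = ∧-true {adj G u a} e
          ub , wb = ∧-true {adj G u b} e′
      in free (close (path ua wa ub wb (b∉ ∘ here) (bw∉ ∘ here)) ub (closing ua ub wb (b∉ ∘ here) (ub∉ ∘ here)))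
      where
      closing : ∀ {a b} → adj G u a ≡ true → adj G u b ≡ true → adj G w b ≡ true → b ≢ a → col c u b ≢ col c w a →
        col c u b ∉ (col c b w ∷ col c w a ∷ col c a u ∷ [])
      closing {a} {b} ua ub wb b≢a ne (here q) = u≢w (col-unique (adj-sym ub) (adj-sym wb) (trans (colSym c b u (adj-sym ub)) q))
      closing ua ub wb b≢a ne (there (here q)) = ne q
      closing {a} {b} ua ub wb b≢a ne (there (there (here q))) = b≢a (col-unique ub ua (trans q (sym (colSym c u a ua))))
      path : ∀ {a b} → adj G u a ≡ true → adj G w a ≡ true → adj G u b ≡ true → adj G w b ≡ true → b ≢ a → col c b w ≢ col c a u →
        RPath u b (w ∷ a ∷ u ∷ []) (col c b w ∷ col c w a ∷ col c a u ∷ [])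
      path {a} {b} ua wa ub wb b≢a ne = step (step (step start (adj-sym ua) a∉ (λ ())) wa w∉ wa∉) (adj-sym wb) b∉ bw∉
        where
        a∉ : a ∉ [ u ]
        a∉ (here q) = adj-≢ ua (sym q)
        w∉ : w ∉ (a ∷ u ∷ [])
        w∉ (here q) = adj-≢ wa q
        w∉ (there (here q)) = u≢w (sym q)
        wa∉ : col c w a ∉ [ col c a u ]
        wa∉ (here q) = u≢w (sym (col-unique (adj-sym wa) (adj-sym ua) (trans (colSym c a w (adj-sym wa)) q)))
        b∉ : b ∉ (w ∷ a ∷ u ∷ [])
        b∉ (here q) = adj-≢ wb (sym q)
        b∉ (there (here q)) = b≢a q
        b∉ (there (there (here q))) = adj-≢ ub (sym q)
        bw∉ : col c b w ∉ (col c w a ∷ col c a u ∷ [])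
        bw∉ (here q) = b≢a (col-unique wb wa (trans (colSym c w b wb) q))
        bw∉ (there (here q)) = ne q

  -- The codegree is at most 3 off the diagonal; the diagonal entry, a degree, adds at most `n`.
  twoWalks≤ : ∀ v → twoWalks v ≤ 4 * n
  twoWalks≤ v = begin
    twoWalks v                                ≡⟨ twoWalks≡ v ⟩
    ∑ V (codeg v)                             ≤⟨ ∑-mono V pointwise ⟩
    ∑ V (λ w → 3 + ⟦ w == v ⟧ * n)            ≡⟨ ∑-+ V _ _ ⟩
    ∑ V (λ _ → 3) + ∑ V (λ w → ⟦ w == v ⟧ * n)
      ≤⟨ +-mono-≤ (≤-reflexive (trans (∑-const V 3) (trans (cong (_* 3) (length-allFin n)) (*-comm n 3))))
           (≤-trans (≤-reflexive (∑-*ʳ V n _)) (≤-trans (*-monoˡ-≤ n (∑-==≤1 v)) (≤-reflexive (*-identityˡ n)))) ⟩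
    3 * n + n                                 ≡⟨ +-comm (3 * n) n ⟩
    4 * n                                     ∎
    where
    open ≤-Reasoning
    codeg≤deg : ∀ w → codeg v w ≤ n
    codeg≤deg w = ≤-trans (∑-mono V λ a → ≤-trans (*-monoʳ-≤ (A v a) (⟦⟧≤1 (adj G a w))) (≤-reflexive (*-identityʳ _))) (deg≤n v)
    pointwise : ∀ w → codeg v w ≤ 3 + ⟦ w == v ⟧ * n
    pointwise w with w F.≟ v
    ... | yes refl = ≤-trans (codeg≤deg w) (≤-trans (≤-reflexive (sym (+-identityʳ n))) (m≤n+m (n + 0) 3))
    ... | no w≢v = ≤-trans (codeg≤3 (w≢v ∘ sym)) (m≤m+n 3 0)

  -- Each pair of leading edges costs `4 * n`. The last two edges join distinct vertices, because
  -- `walkTo` keeps every vertex away from `t`, and so cost 3.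
  ∑-walkTo : ∀ j t u → ∑ (allFns (1 + double j) n) (λ f → ⟦ walkTo (1 + double j) t u f ⟧) ≤ 3 * (4 * n) ^ j
  ∑-walkTo zero t u = begin
    ∑ (allFns 1 n) (λ f → ⟦ walkTo 1 t u f ⟧)
      ≤⟨ ∑-allFns≤ 0 _ (λ x _ → ⟦ not (u == t) ∧ (adj G u x ∧ adj G x t) ⟧) (λ φ → ⟦⟧-mono λ e →
           let ne , r = ∧-true {not (u == t)} e
               ux , r′ = ∧-true {adj G u (φ zero)} r
           in ∧-intro ne (∧-intro ux (proj₂ (∧-true {not (φ zero == t)} r′)))) ⟩
    ∑ V (λ x → ⟦ not (u == t) ∧ (adj G u x ∧ adj G x t) ⟧ + 0)
      ≡⟨ ∑-cong V (λ x → trans (+-identityʳ _) (⟦∧⟧³ (not (u == t)) (adj G u x) (adj G x t))) ⟩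
    ∑ V (λ x → ⟦ not (u == t) ⟧ * (A u x * A x t))      ≡⟨ ∑-*ˡ V ⟦ not (u == t) ⟧ _ ⟩
    ⟦ not (u == t) ⟧ * codeg u t                        ≤⟨ distinct ⟩
    3                                                   ∎
    where
    open ≤-Reasoning
    distinct : ⟦ not (u == t) ⟧ * codeg u t ≤ 3
    distinct with u F.≟ t
    ... | yes _ = z≤n
    ... | no u≢t = ≤-trans (≤-reflexive (+-identityʳ _)) (codeg≤3 u≢t)
  ∑-walkTo (suc j) t u = begin
    ∑ (allFns (suc (suc m)) n) (λ f → ⟦ walkTo (suc (suc m)) t u f ⟧) ≤⟨ walkTo-step (suc m) t u ⟩
    ∑ V (λ x → A u x * ∑ (allFns (suc m) n) (λ f → ⟦ walkTo (suc m) t x f ⟧))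
      ≤⟨ ∑-mono V (λ x → *-monoʳ-≤ (A u x) (≤-trans (walkTo-step m t x) (∑-mono V λ y → *-monoʳ-≤ (A x y) (∑-walkTo j t y)))) ⟩
    ∑ V (λ x → A u x * ∑ V (λ y → A x y * B))
      ≡⟨ trans (∑-cong V λ x → trans (cong (A u x *_) (∑-*ʳ V B (A x))) (sym (*-assoc (A u x) _ _))) (∑-*ʳ V B _) ⟩
    twoWalks u * B                                      ≤⟨ *-monoˡ-≤ B (twoWalks≤ u) ⟩
    4 * n * B                                           ≡⟨ lem (4 * n) _ ⟩
    3 * (4 * n) ^ suc j                                 ∎
    where
    open ≤-Reasoning
    m = 1 + double j
    B = 3 * (4 * n) ^ j
    lem : ∀ a b → a * (3 * b) ≡ 3 * (a * b)
    lem = solve-∀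

  -- A cycle is an oriented edge with a walk back. By Cauchy-Schwarz the square of the number of
  -- edges is at most 4 n³; with the squared 3 of `∑-walkTo` this makes 36.
  labelled²≤ : ∀ j → labelledCycles (3 + double j) G * labelledCycles (3 + double j) G ≤ 36 * 16 ^ j * n ^ (3 + double j)
  labelled²≤ j = begin
    L * L                        ≤⟨ *-mono-≤ lab lab ⟩
    E * B * (E * B)              ≡⟨ swap E B ⟩
    E * E * (B * B)              ≤⟨ *-monoˡ-≤ (B * B) edges ⟩
    n * (n * (4 * n)) * (B * B)  ≡⟨ cong (n * (n * (4 * n)) *_) (square (4 * n ) j) ⟩
    n * (n * (4 * n)) * (9 * (4 * n) ^ double j) ≡⟨ cong (λ z → n * (n * (4 * n)) * (9 * z)) (power j) ⟩
    n * (n * (4 * n)) * (9 * (16 ^ j * n ^ double j)) ≡⟨ collect n (16 ^ j) (n ^ double j) ⟩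
    36 * 16 ^ j * n ^ (3 + double j) ∎
    where
    open ≤-Reasoning
    L = labelledCycles (3 + double j) G
    E = ∑ V deg
    B = 3 * (4 * n) ^ j
    lab : L ≤ E * B
    lab = ≤-trans (labelled≤ (1 + double j)) (≤-trans
      (∑-mono V λ v → ∑-mono V λ u → *-monoʳ-≤ (A v u) (∑-walkTo j v u))
      (≤-reflexive (trans (∑-cong V λ v → ∑-*ʳ V B (A v)) (∑-*ʳ V B deg))))
    edges : E * E ≤ n * (n * (4 * n))
    edges = begin
      E * E                                 ≤⟨ cauchySchwarz V deg ⟩
      length V * ∑ V (λ v → deg v * deg v)  ≡⟨ cong₂ _*_ (length-allFin n) ∑-degree² ⟩
      n * ∑ V twoWalks                      ≤⟨ *-monoʳ-≤ n (≤-trans (∑-mono V twoWalks≤)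
                                                 (≤-reflexive (trans (∑-const V _) (cong (_* (4 * n)) (length-allFin n))))) ⟩
      n * (n * (4 * n))                     ∎
    swap : ∀ a b → a * b * (a * b) ≡ a * a * (b * b)
    swap = solve-∀
    square : ∀ x j → 3 * x ^ j * (3 * x ^ j) ≡ 9 * x ^ double j
    square x zero = refl
    square x (suc j) = trans (lem₁ x (x ^ j)) (trans (cong (x * x *_) (square x j)) (lem₂ x (x ^ double j)))
      where
      lem₁ : ∀ x y → 3 * (x * y) * (3 * (x * y)) ≡ x * x * (3 * y * (3 * y))
      lem₁ = solve-∀
      lem₂ : ∀ x y → x * x * (9 * y) ≡ 9 * (x * (x * y))
      lem₂ = solve-∀
    power : ∀ j → (4 * n) ^ double j ≡ 16 ^ j * n ^ double j
    power zero = refl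
    power (suc j) = trans (cong (λ z → 4 * n * (4 * n * z)) (power j)) (lem n (16 ^ j) (n ^ double j))
      where
      lem : ∀ n x y → 4 * n * (4 * n * (x * y)) ≡ 16 * x * (n * (n * y))
      lem = solve-∀
    collect : ∀ n x y → n * (n * (4 * n)) * (9 * (x * y)) ≡ 36 * x * (n * (n * (n * y)))
    collect = solve-∀

-- The upper bound for k ≥ 3

module UpperLong {n : ℕ} (G : Graph n) (c : ProperColouring G)
  (m i : ℕ) (m≡ : m ≡ 4 + 2 * suc i) (free : ¬ HasRainbowCycle m G c) where

  open Codegrees G
  open Upper G c m (suc i) m≡ free
  open ThreeWalks G c m i m≡ free using (light; light-codeg)
  open ThreeWalkBound G c m i m≡ free using (threeWalks; threeWalks≤; ∑-twoWalks²)
  open Walks G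

  allWalks : ℕ → ℕ
  allWalks ℓ = ∑ V (λ u → ∑ V (walks ℓ u))

  walksFrom : ℕ → Fin n → ℕ
  walksFrom ℓ u = ∑ V (walks ℓ u)

  walksFrom-suc : ∀ ℓ u → walksFrom (suc ℓ) u ≡ ∑ V (λ x → A u x * walksFrom ℓ x)
  walksFrom-suc ℓ u = trans (∑-swap V V _) (∑-cong V λ x → ∑-*ˡ V (A u x) _)

  allWalks-2 : allWalks 2 ≡ threeWalks
  allWalks-2 = begin
    ∑ V (walksFrom 2) ≡⟨ ∑-cong V (λ u → trans (walksFrom-suc 1 u) (∑-cong V λ x → cong (A u x *_) (walksFrom-suc 0 x))) ⟩
    ∑ V (λ u → ∑ V (λ x → A u x * twoWalks x))               ≡⟨ ∑-swap V V _ ⟩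
    ∑ V (λ x → ∑ V (λ u → A u x * twoWalks x))
      ≡⟨ ∑-cong V (λ x → trans (∑-*ʳ V (twoWalks x) _) (trans (cong (_* twoWalks x) (∑-cong V λ u → A-sym u x)) (sym (∑-*ˡ V (deg x) _)))) ⟩
    threeWalks                                               ∎
    where open ≡-Reasoning

  allWalks-step : ∀ ℓ → allWalks (2 + ℓ) ≤ H * n * allWalks ℓ
  allWalks-step ℓ = begin
    ∑ V (walksFrom (2 + ℓ))
      ≡⟨ ∑-cong V (λ u → trans (walksFrom-suc (suc ℓ) u) (trans (∑-cong V λ x → cong (A u x *_) (walksFrom-suc ℓ x)) (twoSteps u (walksFrom ℓ)))) ⟩
    ∑ V (λ u → ∑ V (λ y → codeg u y * walksFrom ℓ y))   ≡⟨ ∑-swap V V _ ⟩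
    ∑ V (λ y → ∑ V (λ u → codeg u y * walksFrom ℓ y))
      ≡⟨ ∑-cong V (λ y → trans (∑-*ʳ V (walksFrom ℓ y) _) (cong (_* walksFrom ℓ y) (trans (∑-cong V λ u → codeg-sym u y) (sym (twoWalks≡ y))))) ⟩
    ∑ V (λ y → twoWalks y * walksFrom ℓ y) ≤⟨ ∑-mono V (λ y → *-monoˡ-≤ (walksFrom ℓ y) (∑-twoWalks y)) ⟩
    ∑ V (λ y → H * n * walksFrom ℓ y)                   ≡⟨ ∑-*ˡ V (H * n) _ ⟩
    H * n * allWalks ℓ                                  ∎
    where open ≤-Reasoning

  -- Walks with 3 + 2 j edges. Starting the induction at single edges, of which there may be about
  -- n^(3/2) by the two-edge bound, would lose n^(1/2).
  allWalks≤ : ∀ j → allWalks (2 + double j) ≤ C₃ * (n * n) * (H * n) ^ j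
  allWalks≤ zero = ≤-trans (≤-reflexive allWalks-2) (≤-trans threeWalks≤ (≤-reflexive (sym (*-identityʳ _))))
  allWalks≤ (suc j) = ≤-trans (allWalks-step (2 + double j)) (≤-trans (*-monoʳ-≤ (H * n) (allWalks≤ j))
    (≤-reflexive (lem (H * n) (C₃ * (n * n)) ((H * n) ^ j))))
    where
    lem : ∀ a b c → a * (b * c) ≡ b * (a * c)
    lem = solve-∀

  -- The edge into `t` counts at most 1; the other 2 j edges are taken in pairs.
  walks≤ : ∀ j u t → walks (double j) u t ≤ (H * n) ^ j
  walks≤ zero u t = ⟦⟧≤1 (adj G u t)
  walks≤ (suc j) u t = begin
    ∑ V (λ x → A u x * ∑ V (λ y → A x y * walks (double j) y t))
      ≤⟨ ∑-mono V (λ x → *-monoʳ-≤ (A u x) (≤-trans (∑-mono V λ y → *-monoʳ-≤ (A x y) (walks≤ j y t)) (≤-reflexive (∑-*ʳ V B (A x))))) ⟩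
    ∑ V (λ x → A u x * (deg x * B)) ≡⟨ trans (∑-cong V λ x → sym (*-assoc (A u x) _ _)) (∑-*ʳ V B _) ⟩
    twoWalks u * B                    ≤⟨ *-monoˡ-≤ B (∑-twoWalks u) ⟩
    H * n * B                         ∎
    where
    open ≤-Reasoning
    B = (H * n) ^ j

  -- Split a closed walk v₀ v₁ v₂ v₃ v₄ … according to whether (v₀,v₂) or (v₂,v₄) is light: a light pair can be bridged in
  -- at most H ways, and with both pairs heavy there are O(deg v₂) choices for (v₀,v₁) and for (v₃,v₄).
  closedWalks≤ : ∀ j → ∑ V (λ v → walks (4 + double j) v v) ≤
    (2 * H * C₃ + H * H * H) * (n * n) * (H * n) ^ j
  closedWalks≤ j = begin
    ∑ V (λ v → walks (4 + ℓ) v v)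
      ≡⟨ ∑-cong V (λ v → trans (twoSteps v (λ w → walks (2 + ℓ) w v)) (∑-cong V λ w → cong (codeg v w *_) (twoSteps w (λ y → walks ℓ y v)))) ⟩
    ∑ V (λ v → ∑ V (λ w → codeg v w * ∑ V (λ y → codeg w y * walks ℓ y v)))
      ≡⟨ ∑-cong V (λ v → ∑-cong V λ w → sym (∑-*ˡ V (codeg v w) _)) ⟩
    ∑ V (λ v → ∑ V (λ w → ∑ V (λ y → codeg v w * (codeg w y * walks ℓ y v))))
      ≤⟨ ∑-mono V (λ v → ∑-mono V λ w → ∑-mono V λ y → split v w y) ⟩
    ∑ V (λ v → ∑ V (λ w → ∑ V (λ y → f₁ v w y + (f₂ v w y + f₃ v w y))))
      ≡⟨ trans (∑³-+ f₁ (λ v w y → f₂ v w y + f₃ v w y)) (cong (∑³ f₁ +_) (∑³-+ f₂ f₃)) ⟩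
    ∑³ f₁ + (∑³ f₂ + ∑³ f₃)    ≤⟨ +-mono-≤ part₁ (+-mono-≤ part₂ part₃) ⟩
    H * (C₃ * (n * n) * P) + (H * (C₃ * (n * n) * P) + H * H * (H * (n * n)) * P) ≡⟨ collect H C₃ (n * n) P ⟩
    (2 * H * C₃ + H * H * H) * (n * n) * P ∎
    where
    open ≤-Reasoning
    ℓ = double j
    P = (H * n) ^ j
    ∑³ : (Fin n → Fin n → Fin n → ℕ) → ℕ
    ∑³ f = ∑ V (λ v → ∑ V (λ w → ∑ V (λ y → f v w y)))
    ∑³-+ : ∀ f g → ∑³ (λ v w y → f v w y + g v w y) ≡ ∑³ f + ∑³ g
    ∑³-+ f g = trans (∑-cong V λ v → trans (∑-cong V λ w → ∑-+ V _ _) (∑-+ V _ _)) (∑-+ V _ _)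
    f₁ f₂ f₃ : Fin n → Fin n → Fin n → ℕ
    f₁ v w y = H * (codeg w y * walks ℓ y v)
    f₂ v w y = H * (codeg v w * walks ℓ y v)
    f₃ v w y = ⟦ heavy w v ⟧ * codeg w v * (⟦ heavy w y ⟧ * codeg w y) * P
    collect : ∀ h c N P → h * (c * N * P) + (h * (c * N * P) + h * h * (h * N) * P) ≡ (2 * h * c + h * h * h) * N * P
    collect = solve-∀
    split : ∀ v w y → codeg v w * (codeg w y * walks ℓ y v) ≤ f₁ v w y + (f₂ v w y + f₃ v w y)
    split v w y with heavy w v in e₁ | heavy w y in e₂
    ... | false | _ = ≤-trans (*-monoˡ-≤ (codeg w y * walks ℓ y v) (≤-trans (≤-reflexive (codeg-sym v w)) (light-≤ e₁))) (m≤m+n _ _)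
    ... | true | false = begin
      codeg v w * (codeg w y * walks ℓ y v) ≤⟨ *-monoʳ-≤ (codeg v w) (*-monoˡ-≤ (walks ℓ y v) (light-≤ e₂)) ⟩
      codeg v w * (H * walks ℓ y v)           ≡⟨ lem (codeg v w) H _ ⟩
      f₂ v w y ≤⟨ ≤-trans (m≤m+n (f₂ v w y) _) (m≤n+m _ (f₁ v w y)) ⟩
      f₁ v w y + (f₂ v w y + (codeg w v + 0) * 0 * P) ∎
      where
      lem : ∀ a b c → a * (b * c) ≡ b * (a * c)
      lem = solve-∀
    ... | true | true = begin
      codeg v w * (codeg w y * walks ℓ y v) ≤⟨ *-monoʳ-≤ (codeg v w) (*-monoʳ-≤ (codeg w y) (walks≤ j y v)) ⟩
      codeg v w * (codeg w y * P) ≡⟨ trans (cong (_* (codeg w y * P)) (codeg-sym v w)) (lem (codeg w v) (codeg w y) P) ⟩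
      (codeg w v + 0) * (codeg w y + 0) * P ≤⟨ ≤-trans (m≤n+m _ (f₂ v w y)) (m≤n+m _ (f₁ v w y)) ⟩
      f₁ v w y + (f₂ v w y + (codeg w v + 0) * (codeg w y + 0) * P) ∎
      where
      lem : ∀ a b c → a * (b * c) ≡ (a + 0) * (b + 0) * c
      lem = solve-∀
    part₁ : ∑³ f₁ ≤ H * (C₃ * (n * n) * P)
    part₁ = begin
      ∑³ f₁ ≡⟨ trans (∑-cong V λ v → trans (∑-cong V λ w → trans (∑-*ˡ V H _) (cong (H *_) (sym (twoSteps w (λ y → walks ℓ y v))))) (∑-*ˡ V H _)) (∑-*ˡ V H _) ⟩
      H * ∑ V (λ v → ∑ V (λ w → walks (2 + ℓ) w v)) ≡⟨ cong (H *_) (∑-swap V V _) ⟩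
      H * allWalks (2 + ℓ)                          ≤⟨ *-monoʳ-≤ H (allWalks≤ j) ⟩
      H * (C₃ * (n * n) * P)                        ∎
    -- Once the light pair `w y` is bridged, the rest is a walk from `w` through `v` to `y`; the
    -- sums are reordered to read it that way.
    part₂ : ∑³ f₂ ≤ H * (C₃ * (n * n) * P)
    part₂ = begin
      ∑³ f₂ ≡⟨ trans (∑-cong V λ v → trans (∑-cong V λ w → ∑-*ˡ V H _) (∑-*ˡ V H _)) (∑-*ˡ V H _) ⟩
      H * ∑³ (λ v w y → codeg v w * walks ℓ y v) ≡⟨ cong (H *_) (∑-cong V λ v → ∑-swap V V _) ⟩
      H * ∑ V (λ v → ∑ V (λ y → ∑ V (λ w → codeg v w * walks ℓ y v))) ≡⟨ cong (H *_) (∑-swap V V _) ⟩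
      H * ∑ V (λ y → ∑ V (λ v → ∑ V (λ w → codeg v w * walks ℓ y v)))
        ≡⟨ cong (H *_) (trans (∑-cong V λ y → ∑-swap V V _) (∑-swap V V _)) ⟩
      H * ∑ V (λ w → ∑ V (λ y → ∑ V (λ v → codeg v w * walks ℓ y v)))
        ≡⟨ cong (H *_) (∑-cong V λ w → ∑-cong V λ y → trans (∑-cong V λ v → cong₂ _*_ (codeg-sym v w) (walks-sym ℓ y v)) (sym (twoSteps w (λ v → walks ℓ v y)))) ⟩
      H * allWalks (2 + ℓ)                          ≤⟨ *-monoʳ-≤ H (allWalks≤ j) ⟩
      H * (C₃ * (n * n) * P)                        ∎
    part₃ : ∑³ f₃ ≤ H * H * (H * (n * n)) * P
    part₃ = begin
      ∑³ f₃ ≡⟨ trans (∑-swap V V _) (∑-cong V λ w → trans (∑-cong V λ v → trans (∑-*ʳ V P _) (cong (_* P) (∑-*ˡ V (⟦ heavy w v ⟧ * codeg w v) _))) (trans (∑-*ʳ V P _) (cong (_* P) (∑-*ʳ V _ _)))) ⟩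
      ∑ V (λ w → h w * h w * P) ≤⟨ ∑-mono V (λ w → *-monoˡ-≤ P (*-mono-≤ (∑-heavy w) (∑-heavy w))) ⟩
      ∑ V (λ w → H * deg w * (H * deg w) * P) ≡⟨ ∑-*ʳ V P _ ⟩
      ∑ V (λ w → H * deg w * (H * deg w)) * P ≡⟨ cong (_* P) (trans (∑-cong V λ w → lem H (deg w)) (∑-*ˡ V (H * H) _)) ⟩
      H * H * ∑ V (λ w → deg w * deg w) * P ≤⟨ *-monoˡ-≤ P (*-monoʳ-≤ (H * H) (≤-trans (≤-reflexive ∑-degree²) ∑-twoWalks²)) ⟩
      H * H * (H * (n * n)) * P               ∎
      where
      h : Fin n → ℕ
      h w = ∑ V (λ v → ⟦ heavy w v ⟧ * codeg w v)
      lem : ∀ a b → a * b * (a * b) ≡ a * a * (b * b)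
      lem = solve-∀

  labelled≤power : ∀ j → labelledCycles (5 + double j) G ≤ (2 * H * C₃ + H * H * H) * H ^ j * n ^ (2 + j)
  labelled≤power j = begin
    labelledCycles (5 + double j) G ≤⟨ labelled≤walks (3 + double j) ⟩
    ∑ V (λ v → walks (4 + double j) v v)                     ≤⟨ closedWalks≤ j ⟩
    B * (n * n) * (H * n) ^ j ≡⟨ cong (B * (n * n) *_) (^-distribʳ-* j H n) ⟩
    B * (n * n) * (H ^ j * n ^ j)                            ≡⟨ lem B n (H ^ j) (n ^ j) ⟩
    B * H ^ j * n ^ (2 + j)                                  ∎
    where
    open ≤-Reasoning
    B = 2 * H * C₃ + H * H * H
    lem : ∀ b n x y → b * (n * n) * (x * y) ≡ b * x * (n * (n * y))
    lem = solve-∀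

copies≤labelled : ∀ {n} m (G : Graph n) → copiesC m G ≤ labelledCycles m G
copies≤labelled zero G = z≤n
copies≤labelled (suc m) G = m/n≤m (labelledCycles (suc m) G) (2 * suc m)

upperLong : ∀ i j → ExUpper (3 + i) (2 + j) 1 (2 + j)
upperLong i j = (2 * H * C₃ + H * H * H) * H ^ j , 0 , λ n _ G c free → begin
  copiesC (2 * (2 + j) + 1) G ^ 1        ≡⟨ *-identityʳ _ ⟩
  copiesC (2 * (2 + j) + 1) G            ≡⟨ cong (λ m → copiesC m G) index ⟩
  copiesC (5 + double j) G               ≤⟨ copies≤labelled (5 + double j) G ⟩
  labelledCycles (5 + double j) G ≤⟨ UpperLong.labelled≤power G c (2 * (3 + i)) i (lem₁ i) free j ⟩
  (2 * H * C₃ + H * H * H) * H ^ j * n ^ (2 + j) ∎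
  where
  open ≤-Reasoning
  open Constants (2 * (3 + i))
  lem₁ : ∀ i → 2 * (3 + i) ≡ 4 + 2 * suc i
  lem₁ = solve-∀
  lem₂ : ∀ j → 2 * (2 + j) + 1 ≡ 5 + 2 * j
  lem₂ = solve-∀
  index : 2 * (2 + j) + 1 ≡ 5 + double j
  index = trans (lem₂ j) (cong (5 +_) (sym (double≡ j)))

upperQuadrilateral : ∀ j → ExUpper 2 (1 + j) 2 (2 * (1 + j) + 1)
upperQuadrilateral j = 36 * 16 ^ j , 0 , λ n _ G c free → begin
  copiesC (2 * (1 + j) + 1) G ^ 2                 ≡⟨ cong (λ m → copiesC m G ^ 2) index ⟩
  copiesC (3 + double j) G ^ 2 ≡⟨ cong (copiesC (3 + double j) G *_) (*-identityʳ _) ⟩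
  copiesC (3 + double j) G * copiesC (3 + double j) G
    ≤⟨ *-mono-≤ (copies≤labelled (3 + double j) G) (copies≤labelled (3 + double j) G) ⟩
  labelledCycles (3 + double j) G * labelledCycles (3 + double j) G ≤⟨ UpperQuadrilateral.labelled²≤ G c free j ⟩
  36 * 16 ^ j * n ^ (3 + double j) ≡⟨ cong (λ z → 36 * 16 ^ j * n ^ z) (sym index) ⟩
  36 * 16 ^ j * n ^ (2 * (1 + j) + 1)             ∎
  where
  open ≤-Reasoning
  lem : ∀ j → 2 * (1 + j) + 1 ≡ 3 + 2 * j
  lem = solve-∀
  index : 2 * (1 + j) + 1 ≡ 3 + double j
  index = trans (lem j) (cong (3 +_) (sym (double≡ j)))

-- A prime between 2ᵗ and 2ᵗ⁺³

binom : ℕ → ℕ → ℕ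
binom _ zero = 1
binom zero (suc k) = 0
binom (suc n) (suc k) = binom n k + binom n (suc k)

absorption : ∀ n k → suc k * binom (suc n) (suc k) ≡ suc n * binom n k
absorption zero zero = refl
absorption zero (suc k) = *-zeroʳ (suc (suc k))
absorption (suc n) zero = cong suc (absorption n zero)
absorption (suc n) (suc k) = begin
  suc (suc k) * (p + q)                             ≡⟨ lem₁ (suc k) p q ⟩
  suc k * p + p + suc (suc k) * q ≡⟨ cong₂ (λ x y → x + p + y) (absorption n k) (absorption n (suc k)) ⟩
  suc n * binom n k + p + suc n * binom n (suc k) ≡⟨ lem₂ (suc n) (binom n k) (binom n (suc k)) ⟩
  suc (suc n) * p                                   ∎
  where
  open ≡-Reasoning
  p = binom (suc n) (suc k)
  q = binom (suc n) (suc (suc k))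
  lem₁ : ∀ k p q → suc k * (p + q) ≡ k * p + p + suc k * q
  lem₁ = solve-∀
  lem₂ : ∀ n x y → n * x + (x + y) + n * y ≡ suc n * (x + y)
  lem₂ = solve-∀

binom-zero : ∀ n k → n < k → binom n k ≡ 0
binom-zero zero (suc k) _ = refl
binom-zero (suc n) (suc k) (s≤s h) = cong₂ _+_ (binom-zero n k h) (binom-zero n (suc k) (m≤n⇒m≤1+n h))

binom-positive : ∀ n k → k ≤ n → 0 < binom n k
binom-positive n zero _ = s≤s z≤n
binom-positive (suc n) (suc k) (s≤s h) = ≤-trans (binom-positive n k h) (m≤m+n _ _)

binom≤2^ : ∀ n k → binom n k ≤ 2 ^ n
binom≤2^ n zero = m^n>0 2 n
binom≤2^ zero (suc k) = z≤n
binom≤2^ (suc n) (suc k) = +-mono-≤ (binom≤2^ n k) (≤-trans (binom≤2^ n (suc k)) (≤-reflexive (sym (+-identityʳ _))))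

binom-factorial : ∀ a b → binom (a + b) a * (a ! * b !) ≡ (a + b) !
binom-factorial zero b = trans (+-identityʳ _) (+-identityʳ _)
binom-factorial (suc a) b = begin
  binom (suc (a + b)) (suc a) * (suc a * a ! * b !) ≡⟨ lem₁ (binom (suc (a + b)) (suc a)) (suc a) (a !) (b !) ⟩
  suc a * binom (suc (a + b)) (suc a) * (a ! * b !) ≡⟨ cong (_* (a ! * b !)) (absorption (a + b) a) ⟩
  suc (a + b) * binom (a + b) a * (a ! * b !) ≡⟨ *-assoc (suc (a + b)) (binom (a + b) a) (a ! * b !) ⟩
  suc (a + b) * (binom (a + b) a * (a ! * b !)) ≡⟨ cong (suc (a + b) *_) (binom-factorial a b) ⟩
  suc (a + b) * (a + b) !                             ∎
  where
  open ≡-Reasoning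
  lem₁ : ∀ p q r s → p * (q * r * s) ≡ q * p * (r * s)
  lem₁ = solve-∀

partialSum : (ℕ → ℕ) → ℕ → ℕ
partialSum f zero = 0
partialSum f (suc k) = partialSum f k + f k

partialSum-binom : ∀ n k → partialSum (binom (suc n)) (suc k) ≡ partialSum (binom n) (suc k) + partialSum (binom n) k
partialSum-binom n zero = refl
partialSum-binom n (suc k) = trans (cong (_+ (binom n k + binom n (suc k))) (partialSum-binom n k))
  (lem (partialSum (binom n) k) (binom n k) (binom n (suc k)))
  where
  lem : ∀ p x y → p + x + p + (x + y) ≡ p + x + y + (p + x)
  lem = solve-∀

row-sum : ∀ n → partialSum (binom n) (suc n) ≡ 2 ^ n
row-sum zero = refl
row-sum (suc n) = begin
  partialSum (binom (suc n)) (suc (suc n)) ≡⟨ partialSum-binom n (suc n) ⟩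
  partialSum (binom n) (suc n) + binom n (suc n) + partialSum (binom n) (suc n)
    ≡⟨ cong (λ z → partialSum (binom n) (suc n) + z + partialSum (binom n) (suc n)) (binom-zero n (suc n) ≤-refl) ⟩
  partialSum (binom n) (suc n) + 0 + partialSum (binom n) (suc n) ≡⟨ lem (partialSum (binom n) (suc n)) ⟩
  2 * partialSum (binom n) (suc n) ≡⟨ cong (2 *_) (row-sum n) ⟩
  2 ^ suc n                                                            ∎
  where
  open ≡-Reasoning
  lem : ∀ p → p + 0 + p ≡ 2 * p
  lem = solve-∀

partialSum-bound : ∀ f k a d → (∀ i → i < k → a * f i ≤ d) → a * partialSum f k ≤ k * d
partialSum-bound f zero a d h = ≤-reflexive (*-zeroʳ a)
partialSum-bound f (suc k) a d h = begin
  a * (partialSum f k + f k)      ≡⟨ *-distribˡ-+ a _ _ ⟩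
  a * partialSum f k + a * f k ≤⟨ +-mono-≤ (partialSum-bound f k a d (λ i i<k → h i (m≤n⇒m≤1+n i<k))) (h k ≤-refl) ⟩
  k * d + d                       ≡⟨ +-comm (k * d) d ⟩
  suc k * d                       ∎
  where open ≤-Reasoning

-- The entries (n + 1) C(n, k) of the Leibniz triangle satisfy 1/b = 1/g − 1/a for neighbours g, a, b.
leibniz : ∀ d m → (∀ i → 0 < i → i ≤ m → i ∣ d) → ∀ n k → n < m → k ≤ n → suc n * binom n k ∣ d
leibniz d m h n zero n<m _ = subst (_∣ d) (sym (*-identityʳ (suc n))) (h (suc n) (s≤s z≤n) n<m)
leibniz d m h (suc n) (suc k) n<m (s≤s k≤n) =
  *-cancelʳ-∣ a {{>-nonZero (*-mono-≤ {1} {suc (suc n)} {1} (s≤s z≤n) (binom-positive (suc n) k (m≤n⇒m≤1+n k≤n)))}}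
    (subst (_∣ d * a) (*-comm a b) (∣m+n∣m⇒∣n {m = q₂ * (a * b)} (divides q₁ sum) (n∣m*n q₂)))
  where
  g a b : ℕ
  g = suc n * binom n k
  a = suc (suc n) * binom (suc n) k
  b = suc (suc n) * binom (suc n) (suc k)
  g∣d = leibniz d m h n k (<-trans (n<1+n n) n<m) k≤n
  a∣d = leibniz d m h (suc n) k n<m (m≤n⇒m≤1+n k≤n)
  q₁ = _∣_.quotient g∣d
  q₂ = _∣_.quotient a∣d
  open ≡-Reasoning
  harmonic : g * (a + b) ≡ a * b
  harmonic = begin
    g * (a + b) ≡⟨ cong (_* (a + b)) (sym (absorption n k)) ⟩
    suc k * binom (suc n) (suc k) * (a + b) ≡⟨ cong (suc k * binom (suc n) (suc k) *_) (sym (*-distribˡ-+ (suc (suc n)) (binom (suc n) k) (binom (suc n) (suc k)))) ⟩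
    suc k * binom (suc n) (suc k) * (suc (suc n) * binom (suc (suc n)) (suc k))
      ≡⟨ lem (suc k) (binom (suc n) (suc k)) (suc (suc n)) (binom (suc (suc n)) (suc k)) ⟩
    suc k * binom (suc (suc n)) (suc k) * b ≡⟨ cong (_* b) (absorption (suc n) k) ⟩
    a * b                                                      ∎
    where
    lem : ∀ k x n y → k * x * (n * y) ≡ k * y * (n * x)
    lem = solve-∀
  sum : q₂ * (a * b) + d * a ≡ q₁ * (a * b)
  sum = begin
    q₂ * (a * b) + d * a        ≡⟨ cong (_+ d * a) (sym (*-assoc q₂ a b)) ⟩
    q₂ * a * b + d * a          ≡⟨ cong (λ z → z * b + d * a) (sym (_∣_.equality a∣d)) ⟩
    d * b + d * a               ≡⟨ trans (+-comm (d * b) _) (sym (*-distribˡ-+ d a b)) ⟩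
    d * (a + b)                 ≡⟨ cong (_* (a + b)) (_∣_.equality g∣d) ⟩
    q₁ * g * (a + b)            ≡⟨ *-assoc q₁ g _ ⟩
    q₁ * (g * (a + b))          ≡⟨ cong (q₁ *_) harmonic ⟩
    q₁ * (a * b)                ∎

-- All n + 1 Leibniz entries of row `n` divide `d`, so none exceeds it, while they add up to (n + 1)
-- 2ⁿ.
common-multiple-large : ∀ d n → 0 < d → (∀ i → 0 < i → i ≤ suc n → i ∣ d) → 2 ^ n ≤ d
common-multiple-large d n d>0 h = *-cancelˡ-≤ (suc n) (begin
  suc n * 2 ^ n                           ≡⟨ cong (suc n *_) (sym (row-sum n)) ⟩
  suc n * partialSum (binom n) (suc n) ≤⟨ partialSum-bound (binom n) (suc n) (suc n) d (λ k k≤n →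
                                               ∣⇒≤ {{>-nonZero d>0}} (leibniz d (suc n) h n k ≤-refl (≤-pred k≤n))) ⟩
  suc n * d                               ∎)
  where open ≤-Reasoning

prime>1 : ∀ {p} → Prime p → 1 < p
prime>1 {zero} pr = contradiction pr ¬prime[0]
prime>1 {suc zero} pr = contradiction pr ¬prime[1]
prime>1 {suc (suc p)} _ = s≤s (s≤s z≤n)

prime∤1 : ∀ {p} → Prime p → ¬ p ∣ 1
prime∤1 pr p∣1 = <⇒≱ (prime>1 pr) (∣⇒≤ p∣1)

prime∣! : ∀ {p} n → Prime p → p ∣ n ! → p ≤ n
prime∣! zero pr h = contradiction h (prime∤1 pr)
prime∣! (suc n) pr h with euclidsLemma (suc n) (n !) pr h
... | inj₁ q = ∣⇒≤ q
... | inj₂ q = m≤n⇒m≤1+n (prime∣! n pr q)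

∣! : ∀ {i n} → 0 < i → i ≤ n → i ∣ n !
∣! {suc i} _ h = ∣-trans (m∣m*n (i !)) (m≤n⇒m!∣n! h)

primeOr1 : ℕ → ℕ
primeOr1 p = if ⌊ prime? p ⌋ then p else 1

primeOr1-prime : ∀ {p} → Prime p → primeOr1 p ≡ p
primeOr1-prime {p} pr with prime? p
... | yes _ = refl
... | no ¬pr = contradiction pr ¬pr

primeOr1-∣ : ∀ {p} q → Prime p → p ∣ primeOr1 q → p ≤ q
primeOr1-∣ q pr h with prime? q
... | yes pq = ∣⇒≤ {{prime⇒nonZero pq}} h
... | no _ = contradiction h (prime∤1 pr)

-- The product of the primes in the interval (a , a + i].
primorial : ℕ → ℕ → ℕ
primorial a zero = 1
primorial a (suc i) = primeOr1 (a + suc i) * primorial a i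

primorial-∣⇒≤ : ∀ {p} a i → Prime p → p ∣ primorial a i → p ≤ a + i
primorial-∣⇒≤ a zero pr h = contradiction h (prime∤1 pr)
primorial-∣⇒≤ a (suc i) pr h with euclidsLemma (primeOr1 (a + suc i)) (primorial a i) pr h
... | inj₁ q = primeOr1-∣ (a + suc i) pr q
... | inj₂ q = ≤-trans (primorial-∣⇒≤ a i pr q) (+-monoʳ-≤ a (n≤1+n i))

∣primorial : ∀ {p} n → Prime p → p ≤ n → p ∣ primorial 0 n
∣primorial zero pr z≤n = contradiction pr ¬prime[0]
∣primorial {p} (suc n) pr p≤ with m≤n⇒m<n∨m≡n p≤
... | inj₁ (s≤s q) = ∣n⇒∣m*n (primeOr1 (suc n)) (∣primorial n pr q)
... | inj₂ refl = subst (λ z → p ∣ z * primorial 0 n) (sym (primeOr1-prime pr)) (m∣m*n _)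

-- A new prime exceeds all earlier ones, hence divides the cofactor.
primorial-∣ : ∀ a i x → (∀ p → Prime p → a < p → p ≤ a + i → p ∣ x) → primorial a i ∣ x
primorial-∣ a zero x h = 1∣ x
primorial-∣ a (suc i) x h
  with primorial-∣ a i x (λ p pr l u → h p pr l (≤-trans u (+-monoʳ-≤ a (n≤1+n i)))) | prime? (a + suc i)
... | r | no _ = subst (_∣ x) (sym (*-identityˡ _)) r
... | divides q x≡ | yes pr
  with euclidsLemma q (primorial a i) pr (subst ((a + suc i) ∣_) x≡ (h _ pr (m<m+n a (s≤s z≤n)) ≤-refl))
...   | inj₁ p∣q = subst (((a + suc i) * primorial a i) ∣_) (sym x≡) (*-monoˡ-∣ (primorial a i) p∣q)
...   | inj₂ p∣R = contradiction (≤-trans (≤-reflexive (sym (+-suc a i))) (primorial-∣⇒≤ a i pr p∣R)) (n≮n (a + i))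

primorial-split : ∀ n i → primorial 0 (n + i) ≡ primorial n i * primorial 0 n
primorial-split n zero = trans (cong (primorial 0) (+-identityʳ n)) (sym (+-identityʳ _))
primorial-split n (suc i) = begin
  primorial 0 (n + suc i) ≡⟨ cong (primorial 0) (+-suc n i) ⟩
  primeOr1 (suc (n + i)) * primorial 0 (n + i) ≡⟨ cong₂ (λ z w → primeOr1 z * w) (sym (+-suc n i)) (primorial-split n i) ⟩
  primeOr1 (n + suc i) * (primorial n i * primorial 0 n) ≡⟨ sym (*-assoc (primeOr1 (n + suc i)) _ _) ⟩
  primorial n (suc i) * primorial 0 n                           ∎
  where open ≡-Reasoning

-- Chebyshev's argument: a prime in (n , 2n] divides (2n)! but not n!, hence divides the central
-- binomial coefficient.
primorial-upper-half : ∀ n → primorial n n ≤ 2 ^ (n + n)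
primorial-upper-half n = ≤-trans
  (∣⇒≤ {{>-nonZero (binom-positive (n + n) n (m≤m+n n n))}} (primorial-∣ n n (binom (n + n) n) divide))
  (binom≤2^ (n + n) n)
  where
  divide : ∀ p → Prime p → n < p → p ≤ n + n → p ∣ binom (n + n) n
  divide p pr n<p p≤ with euclidsLemma (binom (n + n) n) (n ! * n !) pr
    (subst (p ∣_) (sym (binom-factorial n n)) (∣! (<-trans (s≤s z≤n) (prime>1 pr)) p≤))
  ... | inj₁ q = q
  ... | inj₂ q with euclidsLemma (n !) (n !) pr q
  ...   | inj₁ r = contradiction (prime∣! n pr r) (<⇒≱ n<p)
  ...   | inj₂ r = contradiction (prime∣! n pr r) (<⇒≱ n<p)

primorial≤ : ∀ t → primorial 0 (2 ^ t) ≤ 2 ^ (2 ^ t + 2 ^ t)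
primorial≤ zero = s≤s z≤n
primorial≤ (suc t) = begin
  primorial 0 (2 ^ suc t) ≡⟨ cong (λ z → primorial 0 (n + z)) (+-identityʳ n) ⟩
  primorial 0 (n + n)                         ≡⟨ primorial-split n n ⟩
  primorial n n * primorial 0 n ≤⟨ *-mono-≤ (primorial-upper-half n) (primorial≤ t) ⟩
  2 ^ (n + n) * 2 ^ (n + n)                   ≡⟨ sym (^-distribˡ-+-* 2 (n + n) (n + n)) ⟩
  2 ^ (n + n + (n + n))                       ≡⟨ cong (2 ^_) (lem n) ⟩
  2 ^ (2 ^ suc t + 2 ^ suc t)                 ∎
  where
  open ≤-Reasoning
  n = 2 ^ t
  lem : ∀ n → n + n + (n + n) ≡ n + (n + 0) + (n + (n + 0))
  lem = solve-∀

!≤^ : ∀ n b → n ≤ b → n ! ≤ b ^ n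
!≤^ zero b _ = ≤-refl
!≤^ (suc n) b h = *-mono-≤ h (!≤^ n b (≤-trans (n≤1+n n) h))

primeDivisor : ∀ n → 1 < n → ∃ λ p → Prime p × p ∣ n
primeDivisor n@(suc _) 1<n with factorise n
... | record { factors = [] ; isFactorisation = e } = contradiction e (λ { refl → <-irrefl refl 1<n })
... | record { factors = p ∷ ps ; isFactorisation = e ; factorsPrime = pr ∷ _ } = p , pr , subst (p ∣_) (sym e) (m∣m*n (product ps))

-- A number below 2^(e + 1) has at most `e` prime factors with multiplicity; if none exceeds `s`,
-- each divides its own copy of `s !`.
smooth-∣ : ∀ s e i → 0 < i → i < 2 ^ suc e → i ∣ (s !) ^ e ⊎ ∃ λ p → Prime p × s < p × p ∣ i
smooth-∣ s zero (suc zero) _ _ = inj₁ ∣-refl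
smooth-∣ s zero (suc (suc i)) _ (s≤s (s≤s ()))
smooth-∣ s (suc e) i i>0 i< with m≤n⇒m<n∨m≡n i>0
... | inj₂ refl = inj₁ (1∣ _)
... | inj₁ 1<i with primeDivisor i 1<i
...   | p , pr , p∣i@(divides q i≡) with s <? p
...     | yes s<p = inj₂ (p , pr , s<p , p∣i)
...     | no s≮p = split (smooth-∣ s e q q>0 q<)
  where
  q>0 : 0 < q
  q>0 = n≢0⇒n>0 λ q≡0 → <⇒≢ i>0 (sym (trans i≡ (cong (_* p) q≡0)))
  q< : q < 2 ^ suc e
  q< = *-cancelˡ-< 2 q _ (≤-<-trans (≤-trans (≤-reflexive (*-comm 2 q)) (≤-trans (*-monoʳ-≤ q (prime>1 pr)) (≤-reflexive (sym i≡)))) i<)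
  split : q ∣ (s !) ^ e ⊎ (∃ λ p′ → Prime p′ × s < p′ × p′ ∣ q) → i ∣ (s !) ^ suc e ⊎ ∃ λ p′ → Prime p′ × s < p′ × p′ ∣ i
  split (inj₁ r) = inj₁ (subst₂ _∣_ (sym i≡) (*-comm ((s !) ^ e) (s !)) (*-pres-∣ r (∣! (<-trans (s≤s z≤n) (prime>1 pr)) (≮⇒≥ s≮p))))
  split (inj₂ (p′ , pr′ , s<p′ , p′∣q)) = inj₂ (p′ , pr′ , s<p′ , ∣-trans p′∣q (divides p (trans i≡ (*-comm q p))))

-- Equality holds at 8, the origin of the exponent in `threshold`.
4u²≤2^u : ∀ v → 4 * ((8 + v) * (8 + v)) ≤ 2 ^ (8 + v)
4u²≤2^u zero = ≤-refl
4u²≤2^u (suc v) = begin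
  4 * ((8 + suc v) * (8 + suc v)) ≤⟨ m≤m+n _ (188 + 56 * v + 4 * (v * v)) ⟩
  4 * ((8 + suc v) * (8 + suc v)) + (188 + 56 * v + 4 * (v * v)) ≡⟨ lem v ⟩
  2 * (4 * ((8 + v) * (8 + v)))                              ≤⟨ *-monoʳ-≤ 2 (4u²≤2^u v) ⟩
  2 * 2 ^ (8 + v) ≡⟨ cong (2 ^_) (sym (+-suc 8 v)) ⟩
  2 ^ (8 + suc v)                                            ∎
  where
  open ≤-Reasoning
  lem : ∀ v → 4 * ((8 + suc v) * (8 + suc v)) + (188 + 56 * v + 4 * (v * v)) ≡ 2 * (4 * ((8 + v) * (8 + v)))
  lem = solve-∀

-- If there is no prime in (n , 8 n], 8 n = s², then every i ≤ 8 n divides (s!)^(2u) times the product of the primes up to n,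
-- which is too small to be a common multiple.
prime-in-range : ∀ u t → 4 * (u * u) ≤ 2 ^ u → 3 + t ≡ u + u → ∃ λ p → Prime p × 2 ^ t < p × p ≤ 2 ^ (u + u)
prime-in-range u t small t≡ with anyUpTo? (λ p → prime? p ×-dec (2 ^ t <? p)) (suc (2 ^ (u + u)))
... | yes (p , p≤ , pr , t<p) = p , pr , t<p , ≤-pred p≤
... | no none = contradiction (≤-trans (common-multiple-large d N′ d>0 common) d≤) (<⇒≱ (^-monoʳ-< 2 (s≤s (s≤s z≤n)) small′))
  where
  open ≤-Reasoning
  n = 2 ^ t
  s = 2 ^ u
  e = u + u
  N = 2 ^ e
  N′ = pred N
  d = (s !) ^ e * primorial 0 n
  N≡ : N ≡ suc N′
  N≡ = sym (suc-pred N {{m^n≢0 2 e}})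
  N≡s² : N ≡ s * s
  N≡s² = ^-distribˡ-+-* 2 u u
  N≡8n : N ≡ 8 * n
  N≡8n = trans (cong (2 ^_) (sym t≡)) (^-distribˡ-+-* 2 3 t)
  half : u * s * e ≤ 4 * n
  half = *-cancelˡ-≤ 2 (begin
    2 * (u * s * (u + u))    ≡⟨ lem u s ⟩
    s * (4 * (u * u))        ≤⟨ *-monoʳ-≤ s small ⟩
    s * s                    ≡⟨ sym N≡s² ⟩
    N                        ≡⟨ N≡8n ⟩
    8 * n                    ≡⟨ *-assoc 2 4 n ⟩
    2 * (4 * n)              ∎)
    where
    lem : ∀ u s → 2 * (u * s * (u + u)) ≡ s * (4 * (u * u))
    lem = solve-∀
  -- Out of 8 n, the factorials use at most 4 n and the primorial 2 n; the remaining 2 n give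
  -- strictness.
  small′ : u * s * e + (n + n) < N′
  small′ = ≤-pred (begin
    2 + (u * s * e + (n + n)) ≤⟨ +-mono-≤ (*-monoʳ-≤ 2 (m^n>0 2 t)) (+-monoˡ-≤ (n + n) half) ⟩
    2 * n + (4 * n + (n + n))        ≡⟨ lem n ⟩
    8 * n                            ≡⟨ trans (sym N≡8n) N≡ ⟩
    suc N′                           ∎)
    where
    lem : ∀ n → 2 * n + (4 * n + (n + n)) ≡ 8 * n
    lem = solve-∀
  primorial>0 : ∀ i → 0 < primorial 0 i
  primorial>0 zero = s≤s z≤n
  primorial>0 (suc i) with prime? (suc i)
  ... | yes _ = ≤-trans (primorial>0 i) (m≤m+n _ _)
  ... | no _ = ≤-trans (primorial>0 i) (m≤m+n _ _)
  d>0 : 0 < d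
  d>0 = *-mono-≤ {1} {_} {1} (m^n>0 (s !) {{s !≢0}} e) (primorial>0 n)
  common : ∀ i → 0 < i → i ≤ suc N′ → i ∣ d
  common i i>0 i≤′ with smooth-∣ s e i i>0 (≤-<-trans (≤-trans i≤′ (≤-reflexive (sym N≡))) (^-monoʳ-< 2 (s≤s (s≤s z≤n)) (n<1+n e)))
  ... | inj₁ r = ∣m⇒∣m*n (primorial 0 n) r
  -- Since i ≤ s², beside a prime above `s` there is only a cofactor of at most `s`, which divides a
  -- single `s !`.
  ... | inj₂ (p , pr , s<p , p∣i@(divides q i≡)) = subst (_∣ d) (sym i≡) (*-pres-∣ q∣ (∣primorial n pr p≤n))
    where
    i≤ : i ≤ N
    i≤ = ≤-trans i≤′ (≤-reflexive (sym N≡))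
    p≤n : p ≤ n
    p≤n = ≮⇒≥ λ n<p → none (p , s≤s (≤-trans (∣⇒≤ {{>-nonZero i>0}} p∣i) i≤) , pr , n<p)
    q≤s : q ≤ s
    q≤s = ≮⇒≥ λ s<q → <⇒≱ (*-mono-< s<q s<p) (≤-trans (≤-reflexive (sym i≡)) (≤-trans i≤ (≤-reflexive N≡s²)))
    q∣ : q ∣ (s !) ^ e
    q∣ = ∣-trans (∣! (n≢0⇒n>0 λ q≡0 → <⇒≢ i>0 (sym (trans i≡ (cong (_* p) q≡0)))) q≤s)
      (subst (λ z → s ! ∣ (s !) ^ z) t≡ (m∣m*n _))
  d≤ : d ≤ 2 ^ (u * s * e + (n + n))
  d≤ = begin
    (s !) ^ e * primorial 0 n ≤⟨ *-mono-≤ (^-monoˡ-≤ e (!≤^ s s ≤-refl)) (primorial≤ t) ⟩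
    (s ^ s) ^ e * 2 ^ (n + n) ≡⟨ cong (λ z → z ^ e * 2 ^ (n + n)) (^-*-assoc 2 u s) ⟩
    (2 ^ (u * s)) ^ e * 2 ^ (n + n) ≡⟨ cong (_* 2 ^ (n + n)) (^-*-assoc 2 (u * s) e) ⟩
    2 ^ (u * s * e) * 2 ^ (n + n)          ≡⟨ sym (^-distribˡ-+-* 2 (u * s * e) (n + n)) ⟩
    2 ^ (u * s * e + (n + n))              ∎

n<2^n : ∀ n → n < 2 ^ n
n<2^n zero = s≤s z≤n
n<2^n (suc n) = +-mono-≤ (m^n>0 2 n) (≤-trans (n<2^n n) (m≤m+n _ 0))

power-bracket : ∀ b → 1 < b → ∀ d u n → b ^ u ≤ n → n < b ^ (d + u) → ∃ λ w → u ≤ w × b ^ w ≤ n × n < b ^ suc w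
power-bracket b 1<b zero u n l h = contradiction l (<⇒≱ h)
power-bracket b 1<b (suc d) u n l h with n <? b ^ suc u
... | yes h′ = u , ≤-refl , l , h′
... | no h′ = let w , u≤ , r = power-bracket b 1<b d (suc u) n (≮⇒≥ h′) (<-≤-trans h (≤-reflexive (cong (b ^_) (sym (+-suc d u)))))
              in w , ≤-trans (n≤1+n u) u≤ , r

-- 1024 = 16 · 8²: `n` is below 16 times 16ᵘ, and the prime exceeds an eighth of 4ᵘ.
prime-between-powers : ∀ u t n → 4 * (u * u) ≤ 2 ^ u → 3 + t ≡ u + u → 16 ^ u ≤ n → n < 16 ^ suc u →
  ∃ λ p → Prime p × p * p ≤ n × n ≤ 1024 * (p * p)
prime-between-powers u t n small t≡ lower upper =
  let p , pr , t<p , p≤ = prime-in-range u t small t≡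
  in p , pr , ≤-trans (*-mono-≤ p≤ p≤) (≤-trans (≤-reflexive square) lower)
   , ≤-trans (<⇒≤ upper) (≤-trans (≤-reflexive square′) (*-monoʳ-≤ 1024 (*-mono-≤ (<⇒≤ t<p) (<⇒≤ t<p))))
  where
  square : 2 ^ (u + u) * 2 ^ (u + u) ≡ 16 ^ u
  square = trans (sym (^-distribˡ-+-* 2 (u + u) (u + u))) (trans (cong (2 ^_) (lem u)) (sym (^-*-assoc 2 4 u)))
    where
    lem : ∀ u → u + u + (u + u) ≡ 4 * u
    lem = solve-∀
  square′ : 16 ^ suc u ≡ 1024 * (2 ^ t * 2 ^ t)
  square′ = trans (^-*-assoc 2 4 (suc u)) (trans (cong (2 ^_) (trans (lem u) (trans (cong (λ z → 4 + (z + z)) (sym t≡)) (lem′ t))))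
    (trans (^-distribˡ-+-* 2 10 (t + t)) (cong (1024 *_) (^-distribˡ-+-* 2 t t))))
    where
    lem : ∀ u → 4 * suc u ≡ 4 + (u + u + (u + u))
    lem = solve-∀
    lem′ : ∀ t → 4 + (3 + t + (3 + t)) ≡ 10 + (t + t)
    lem′ = solve-∀

abstract
  threshold : ℕ
  threshold = 16 ^ 8

  prime-square : ∀ n → threshold ≤ n → ∃ λ p → Prime p × p * p ≤ n × n ≤ 1024 * (p * p)
  prime-square n large = from (power-bracket 16 (s≤s (s≤s z≤n)) n 8 n large
      (<-≤-trans (n<2^n n) (≤-trans (^-monoˡ-≤ n (s≤s (s≤s (z≤n {14})))) (^-monoʳ-≤ 16 (m≤m+n n 8)))))
    where
    lem : ∀ v → 3 + (13 + (v + v)) ≡ 8 + v + (8 + v)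
    lem = solve-∀
    from : (∃ λ u → 8 ≤ u × 16 ^ u ≤ n × n < 16 ^ suc u) → ∃ λ p → Prime p × p * p ≤ n × n ≤ 1024 * (p * p)
    from (u , 8≤u , lower , upper) =
      let v , v≡ = m≤n⇒∃[o]m+o≡n 8≤u
      in prime-between-powers u (13 + (v + v)) n (subst (λ z → 4 * (z * z) ≤ 2 ^ z) v≡ (4u²≤2^u v))
           (trans (lem v) (cong (λ z → z + z) v≡)) lower upper

-- Lower bounds for the number of cycles

∑-allFns : ∀ {n} m (f : (Fin (suc m) → Fin n) → ℕ) (g : Fin n → (Fin m → Fin n) → ℕ) →
  (∀ φ → f φ ≡ g (φ zero) (φ ∘ suc)) → ∑ (allFns (suc m) n) f ≡ ∑ (allFin n) (λ x → ∑ (allFns m n) (g x))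
∑-allFns {n} m f g h = trans (∑-concatMap _ (allFin n) f)
  (∑-cong (allFin n) λ x → trans (∑-map _ (allFns m n) f) (∑-cong (allFns m n) λ φ → h _))

agree : ∀ {n} m → (Fin m → Fin n) → (Fin m → Fin n) → Bool
agree zero f g = true
agree (suc m) f g = (f zero == g zero) ∧ agree m (f ∘ suc) (g ∘ suc)

agree-elim : ∀ {n} m (f g : Fin m → Fin n) → agree m f g ≡ true → ∀ i → f i ≡ g i
agree-elim (suc m) f g h zero = ⌊⌋-elim (f zero F.≟ g zero) (proj₁ (∧-true h))
agree-elim (suc m) f g h (suc i) = agree-elim m (f ∘ suc) (g ∘ suc) (proj₂ (∧-true {f zero == g zero} h)) i

agree-intro : ∀ {n} m (f g : Fin m → Fin n) → (∀ i → f i ≡ g i) → agree m f g ≡ true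
agree-intro zero f g h = refl
agree-intro (suc m) f g h = ∧-intro (⌊⌋-true (f zero F.≟ g zero) (h zero)) (agree-intro m (f ∘ suc) (g ∘ suc) (h ∘ suc))

∑-== : ∀ {n} (u : Fin n) → ∑ (allFin n) (λ x → ⟦ x == u ⟧) ≡ 1
∑-== {n} u = ≤-antisym (∑-==≤1 u)
  (≤-trans (≤-reflexive (sym (cong ⟦_⟧ (==-refl u)))) (∑-member (λ x → ⟦ x == u ⟧) (∈-allFin u)))

-- Up to pointwise equality, `allFns` lists every function exactly once.
∑-agree : ∀ {n} m (g : Fin m → Fin n) → ∑ (allFns m n) (λ f → ⟦ agree m f g ⟧) ≡ 1
∑-agree zero g = refl
∑-agree {n} (suc m) g = begin
  ∑ (allFns (suc m) n) (λ f → ⟦ agree (suc m) f g ⟧)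
    ≡⟨ ∑-allFns m _ (λ x f → ⟦ x == g zero ⟧ * ⟦ agree m f (g ∘ suc) ⟧) (λ φ → ⟦∧⟧ (φ zero == g zero) _) ⟩
  ∑ (allFin n) (λ x → ∑ (allFns m n) (λ f → ⟦ x == g zero ⟧ * ⟦ agree m f (g ∘ suc) ⟧))
    ≡⟨ ∑-cong (allFin n) (λ x → trans (∑-*ˡ (allFns m n) ⟦ x == g zero ⟧ _)
         (trans (cong (⟦ x == g zero ⟧ *_) (∑-agree m (g ∘ suc))) (*-identityʳ _))) ⟩
  ∑ (allFin n) (λ x → ⟦ x == g zero ⟧)   ≡⟨ ∑-== (g zero) ⟩
  1                                      ∎
  where open ≡-Reasoning

length-allFns : ∀ m n → length (allFns m n) ≡ n ^ m
length-allFns zero n = refl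
length-allFns (suc m) n = begin
  length (allFns (suc m) n)                           ≡⟨ length≡∑ (allFns (suc m) n) ⟩
  ∑ (allFns (suc m) n) (λ _ → 1) ≡⟨ ∑-allFns {n} m (λ _ → 1) (λ _ _ → 1) (λ _ → refl) ⟩
  ∑ (allFin n) (λ _ → ∑ (allFns m n) (λ _ → 1))       ≡⟨ ∑-const (allFin n) _ ⟩
  length (allFin n) * ∑ (allFns m n) (λ _ → 1) ≡⟨ cong₂ _*_ (length-allFin n) (trans (sym (length≡∑ (allFns m n))) (length-allFns m n)) ⟩
  n ^ suc m                                           ∎
  where open ≡-Reasoning

cycleMap-resp : ∀ {n m} {G : Graph n} {f g : Fin m → Fin n} → (∀ i → f i ≡ g i) → CycleMap m G g → CycleMap m G f
cycleMap-resp {G = G} h C = record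
  { inj = λ i j e → inj i j (trans (sym (h i)) (trans e (h j)))
  ; edges = λ i → trans (cong₂ (adj G) (h i) (h (nextC i))) (edges i) }
  where open CycleMap C

-- Double counting of the pairs of `φ` and a listed `f` that agrees with `F φ`: every `φ` has
-- exactly one `f`, and an `f` has at most one `φ`, and only if it is a cycle.
labelled-lower : ∀ {n m r a} (G : Graph n) (F : (Fin r → Fin a) → Fin m → Fin n) → (∀ φ → CycleMap m G (F φ)) →
  (∀ φ ψ → (∀ i → F φ i ≡ F ψ i) → ∀ i → φ i ≡ ψ i) → a ^ r ≤ labelledCycles m G
labelled-lower {n} {m} {r} {a} G F cyc inj = begin
  a ^ r ≡⟨ sym (length-allFns r a) ⟩
  length Φ                                                                ≡⟨ length≡∑ Φ ⟩
  ∑ Φ (λ _ → 1) ≡⟨ ∑-cong Φ (λ φ → sym (∑-agree m (F φ))) ⟩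
  ∑ Φ (λ φ → ∑ fs (λ f → ⟦ agree m f (F φ) ⟧)) ≡⟨ ∑-swap Φ fs _ ⟩
  ∑ fs (λ f → ∑ Φ (λ φ → ⟦ agree m f (F φ) ⟧)) ≤⟨ ∑-mono fs bound ⟩
  ∑ fs (λ f → ⟦ isCycleMapᵇ m G f ⟧) ≡⟨ sym (length-filterᵇ _ fs) ⟩
  labelledCycles m G                                                      ∎
  where
  open ≤-Reasoning
  Φ = allFns r a
  fs = allFns m n
  bound : ∀ f → ∑ Φ (λ φ → ⟦ agree m f (F φ) ⟧) ≤ ⟦ isCycleMapᵇ m G f ⟧
  bound f with 0 <? ∑ Φ (λ φ → ⟦ agree m f (F φ) ⟧)
  ... | no none = ≤-trans (≮⇒≥ none) z≤n
  ... | yes some =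
    let φ , _ , e = ∑>0 Φ (λ φ → agree m f (F φ)) some
        same = agree-elim m f (F φ) e
    in begin
    ∑ Φ (λ ψ → ⟦ agree m f (F ψ) ⟧)
      ≤⟨ ∑-mono Φ (λ ψ → ⟦⟧-mono λ e′ → agree-intro r ψ φ (inj ψ φ λ i → trans (sym (agree-elim m f (F ψ) e′ i)) (same i))) ⟩
    ∑ Φ (λ ψ → ⟦ agree r ψ φ ⟧)       ≡⟨ ∑-agree r φ ⟩
    1 ≡⟨ sym (cong ⟦_⟧ (cycleMap-intro G (cycleMap-resp {G = G} same (cyc φ)))) ⟩
    ⟦ isCycleMapᵇ m G f ⟧             ∎

-- The hypothesis `2 * m ≤ x` makes the rounded quotient in `copiesC` positive, so the remainder
-- costs only a factor 2.
copies-lower : ∀ {n} m (G : Graph n) x → 0 < m → x ≤ labelledCycles m G → 2 * m ≤ x → x ≤ 4 * m * copiesC m G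
copies-lower (suc m) G x _ x≤ large = begin
  x                                  ≤⟨ x≤ ⟩
  L                                  ≡⟨ m≡m%n+[m/n]*n L d ⟩
  L % d + c * d                      ≤⟨ +-monoˡ-≤ (c * d) (<⇒≤ (m%n<n L d)) ⟩
  d + c * d ≤⟨ +-monoˡ-≤ (c * d) (≤-trans (≤-reflexive (sym (*-identityˡ d))) (*-monoˡ-≤ d c≥1)) ⟩
  c * d + c * d                      ≡⟨ lem c (suc m) ⟩
  4 * suc m * c                      ∎
  where
  open ≤-Reasoning
  d = 2 * suc m
  L = labelledCycles (suc m) G
  c = L / d
  c≥1 : 1 ≤ c
  c≥1 = m≥n⇒m/n>0 (≤-trans large x≤)
  lem : ∀ c m → c * (2 * m) + c * (2 * m) ≡ 4 * m * c
  lem = solve-∀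

nextC-view : ∀ {m} (i : Fin m) → toℕ (nextC i) ≡ suc (toℕ i) ⊎ (suc (toℕ i) ≡ m × toℕ (nextC i) ≡ 0)
nextC-view {suc zero} zero = inj₂ (refl , refl)
nextC-view {suc (suc m)} zero = inj₁ refl
nextC-view {suc (suc m)} (suc i) with nextC i | nextC-view i
... | zero | inj₂ (e , _) = inj₂ (cong suc e , refl)
... | suc j | inj₁ e = inj₁ (cong suc e)

nextC-≢ : ∀ {m} (i : Fin (suc (suc m))) → nextC i ≢ i
nextC-≢ i e with nextC-view i
... | inj₁ s = <⇒≢ (n<1+n _) (trans (sym (cong toℕ e)) s)
... | inj₂ (l , z) with () ← trans (sym l) (cong suc (trans (sym (cong toℕ e)) z))

-- Both extremal graphs contain no C₂ₖ at all, so any proper colouring will do.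
sumColouring : ∀ {n} (G : Graph n) → ProperColouring G
sumColouring G = record
  { col = λ u v → toℕ u + toℕ v
  ; colSym = λ u v _ → +-comm (toℕ u) (toℕ v)
  ; proper = λ u v w _ _ v≢w e → v≢w (F.toℕ-injective (+-cancelˡ-≡ (toℕ u) _ _ e)) }

-- The polarity graph over ℤ/p: (a , b) ~ (c , d) iff b + d ≡ a c

¬∣small : ∀ {p x} → p ∣ x → x < p → x ≡ 0
¬∣small {p} {zero} _ _ = refl
¬∣small {p} {suc x} d h = contradiction (∣⇒≤ d) (<⇒≱ h)

residue-unique-≤ : ∀ {p x y} → x ≤ y → y < p → p ∣ ℤ.∣ ⁺ x ℤ.- ⁺ y ∣ → x ≡ y
residue-unique-≤ {p} {x} {y} x≤y y<p d = ≤-antisym x≤y (m∸n≡0⇒m≤n (¬∣small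
  (subst (p ∣_) (trans (cong ℤ.∣_∣ (ℤ.[+m]-[+n]≡m⊖n x y)) (ℤ.∣⊖∣-≤ x≤y)) d) (≤-<-trans (m∸n≤m y x) y<p)))

residue-unique : ∀ {p x y} → x < p → y < p → ⁺ p ℤ.∣ (⁺ x ℤ.- ⁺ y) → x ≡ y
residue-unique {p} {x} {y} x<p y<p d with ≤-total x y
... | inj₁ x≤y = residue-unique-≤ x≤y y<p (ℤ.∣⇒∣ᵤ d)
... | inj₂ y≤x = sym (residue-unique-≤ y≤x x<p (subst (p ∣_) (ℤ.∣i-j∣≡∣j-i∣ (⁺ x) (⁺ y)) (ℤ.∣⇒∣ᵤ d)))

true-iff : ∀ {a b} → (a ≡ true → b ≡ true) → (b ≡ true → a ≡ true) → a ≡ b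
true-iff {true} {true} f g = refl
true-iff {true} {false} f g = sym (f refl)
true-iff {false} {true} f g = g refl
true-iff {false} {false} f g = refl

module Polarity (p : ℕ) (pr : Prime p) (n : ℕ) (p²≤n : p * p ≤ n) where

  instance
    p≢0 : NonZero p
    p≢0 = prime⇒nonZero pr

  -- Vertices below `p * p` encode pairs of residues as digits in base `p`; `related` leaves the
  -- others isolated.
  fst snd : Fin n → ℕ
  fst u = toℕ u / p
  snd u = toℕ u % p

  form : ℕ → ℕ → ℕ → ℕ → ℤ
  form a b a′ b′ = (⁺ b ℤ.+ ⁺ b′) ℤ.- ⁺ a ℤ.* ⁺ a′

  related : Fin n → Fin n → Bool
  related u v = ⌊ toℕ u <? p * p ⌋ ∧ (⌊ toℕ v <? p * p ⌋ ∧ (not (u == v) ∧ ⌊ ⁺ p ℤ.∣? form (fst u) (snd u) (fst v) (snd v) ⌋))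

  record Related (u v : Fin n) : Set where
    constructor rel
    field
      u< : toℕ u < p * p
      v< : toℕ v < p * p
      u≢v : u ≢ v
      divisible : ⁺ p ℤ.∣ form (fst u) (snd u) (fst v) (snd v)

  related-elim : ∀ {u v} → related u v ≡ true → Related u v
  related-elim {u} {v} e =
    let e₁ , r₁ = ∧-true {⌊ toℕ u <? p * p ⌋} e
        e₂ , r₂ = ∧-true {⌊ toℕ v <? p * p ⌋} r₁
        e₃ , e₄ = ∧-true {not (u == v)} r₂
    in rel (⌊⌋-elim (toℕ u <? p * p) e₁) (⌊⌋-elim (toℕ v <? p * p) e₂) (⌊⌋-false (u F.≟ v) (not-false e₃))
         (⌊⌋-elim (⁺ p ℤ.∣? form (fst u) (snd u) (fst v) (snd v)) e₄)

  related-intro : ∀ {u v} → Related u v → related u v ≡ true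
  related-intro {u} {v} (rel u< v< u≢v d) = ∧-intro (⌊⌋-true (toℕ u <? p * p) u<) (∧-intro (⌊⌋-true (toℕ v <? p * p) v<)
    (∧-intro distinct (⌊⌋-true (⁺ p ℤ.∣? form (fst u) (snd u) (fst v) (snd v)) d)))
    where
    distinct : not (u == v) ≡ true
    distinct with u F.≟ v
    ... | yes e = contradiction e u≢v
    ... | no _ = refl

  Related-sym : ∀ {u v} → Related u v → Related v u
  Related-sym {u} {v} (rel u< v< u≢v d) = rel v< u< (u≢v ∘ sym) (subst (⁺ p ℤ.∣_) (lem (⁺ fst u) (⁺ snd u) (⁺ fst v) (⁺ snd v)) d)
    where
    lem : ∀ a b c d → (b ℤ.+ d) ℤ.- a ℤ.* c ≡ (d ℤ.+ b) ℤ.- c ℤ.* a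
    lem = ℤSolver.solve-∀

  graph : Graph n
  graph = record
    { adj = related
    ; sym = λ u v → true-iff (related-intro ∘ Related-sym ∘ related-elim) (related-intro ∘ Related-sym ∘ related-elim)
    ; irref = λ v → loopless v (related v v) refl }
    where
    loopless : ∀ v b → related v v ≡ b → b ≡ false
    loopless v true e = contradiction refl (Related.u≢v (related-elim {v} {v} e))
    loopless v false e = refl

  decode : ∀ {u v} → fst u ≡ fst v → snd u ≡ snd v → u ≡ v
  decode {u} {v} e₁ e₂ = F.toℕ-injective (trans (m≡m%n+[m/n]*n (toℕ u) p)
    (trans (cong₂ (λ x y → x + y * p) e₂ e₁) (sym (m≡m%n+[m/n]*n (toℕ v) p))))

  fst<p : ∀ {u} → toℕ u < p * p → fst u < p
  fst<p h = m<n*o⇒m/o<n h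

  common-fst : ∀ {u u′ w} → Related u w → Related u′ w → fst u ≡ fst u′ → u ≡ u′
  common-fst {u} {u′} {w} r r′ e = decode e (residue-unique (m%n<n (toℕ u) p) (m%n<n (toℕ u′) p)
    (subst (⁺ p ℤ.∣_) (trans (cong (λ z → form z (snd u) (fst w) (snd w) ℤ.- form (fst u′) (snd u′) (fst w) (snd w)) e)
        (lem (⁺ snd u) (⁺ snd u′) (⁺ fst u′) (⁺ fst w) (⁺ snd w)))
      (ℤ.∣m∣n⇒∣m-n (Related.divisible r) (Related.divisible r′))))
    where
    lem : ∀ b b′ a c d → ((b ℤ.+ d) ℤ.- a ℤ.* c) ℤ.- ((b′ ℤ.+ d) ℤ.- a ℤ.* c) ≡ b ℤ.- b′
    lem = ℤSolver.solve-∀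

  difference : ∀ {u u′ w} → Related u w → Related u′ w →
    ⁺ p ℤ.∣ ((⁺ snd u ℤ.- ⁺ snd u′) ℤ.- (⁺ fst u ℤ.- ⁺ fst u′) ℤ.* ⁺ fst w)
  difference {u} {u′} {w} r r′ = subst (⁺ p ℤ.∣_) (lem (⁺ fst u) (⁺ snd u) (⁺ fst u′) (⁺ snd u′) (⁺ fst w) (⁺ snd w))
    (ℤ.∣m∣n⇒∣m-n (Related.divisible r) (Related.divisible r′))
    where
    lem : ∀ a b a′ b′ c d → ((b ℤ.+ d) ℤ.- a ℤ.* c) ℤ.- ((b′ ℤ.+ d) ℤ.- a′ ℤ.* c) ≡ (b ℤ.- b′) ℤ.- (a ℤ.- a′) ℤ.* c
    lem = ℤSolver.solve-∀

  -- Around a quadrilateral the two differences leave (a − a′)(c′ − c) ≡ 0.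
  quadrilateral-free : ∀ {u w u′ w′} → Related u w → Related u′ w → Related u′ w′ → Related u w′ → u ≢ u′ → w ≡ w′
  quadrilateral-free {u} {w} {u′} {w′} r₁ r₂ r₃ r₄ u≢u′ = conclude (euclidsLemma ℤ.∣ a ℤ.- a′ ∣ ℤ.∣ c′ ℤ.- c ∣ pr
      (subst (p ∣_) (ℤ.abs-* (a ℤ.- a′) (c′ ℤ.- c)) (ℤ.∣⇒∣ᵤ product-divisible)))
    where
    a a′ c c′ : ℤ
    a = ⁺ fst u
    a′ = ⁺ fst u′
    c = ⁺ fst w
    c′ = ⁺ fst w′
    lem : ∀ x y c c′ → (x ℤ.- y ℤ.* c) ℤ.- (x ℤ.- y ℤ.* c′) ≡ y ℤ.* (c′ ℤ.- c)
    lem = ℤSolver.solve-∀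
    product-divisible : ⁺ p ℤ.∣ (a ℤ.- a′) ℤ.* (c′ ℤ.- c)
    product-divisible = subst (⁺ p ℤ.∣_) (lem (⁺ snd u ℤ.- ⁺ snd u′) (a ℤ.- a′) c c′)
      (ℤ.∣m∣n⇒∣m-n (difference r₁ r₂) (difference r₄ r₃))
    conclude : (p ∣ ℤ.∣ a ℤ.- a′ ∣) ⊎ (p ∣ ℤ.∣ c′ ℤ.- c ∣) → w ≡ w′
    conclude (inj₁ d) = contradiction
      (common-fst r₁ r₂ (residue-unique (fst<p (Related.u< r₁)) (fst<p (Related.u< r₂)) (ℤ.∣ᵤ⇒∣ d))) u≢u′
    conclude (inj₂ d) = sym (common-fst (Related-sym r₄) (Related-sym r₁)
      (residue-unique (fst<p (Related.v< r₄)) (fst<p (Related.v< r₁)) (ℤ.∣ᵤ⇒∣ d)))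

  no-quadrilateral : ∀ (f : Fin 4 → Fin n) → ¬ CycleMap 4 graph f
  no-quadrilateral f C = case same of λ ()
    where
    open CycleMap C
    e : ∀ i → Related (f i) (f (nextC i))
    e i = related-elim (edges i)
    same : suc zero ≡ suc (suc (suc zero))
    same = inj (suc zero) (suc (suc (suc zero)))
      (quadrilateral-free (e zero) (Related-sym (e (suc zero))) (e (suc (suc zero))) (Related-sym (e (suc (suc (suc zero)))))
        (λ q → case inj zero (suc (suc zero)) q of λ ()))

  vertex : ∀ a b → a < p → b < p → Fin n
  vertex a b a<p b<p = fromℕ< {b + a * p} (≤-trans (≤-trans (+-monoˡ-≤ (a * p) b<p) (*-monoˡ-≤ p a<p)) p²≤n)

  vertex< : ∀ {a b} a<p b<p → toℕ (vertex a b a<p b<p) < p * p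
  vertex< {a} a<p b<p = ≤-trans (≤-reflexive (cong suc (F.toℕ-fromℕ< _))) (≤-trans (+-monoˡ-≤ (a * p) b<p) (*-monoˡ-≤ p a<p))

  fst-vertex : ∀ {a b} a<p b<p → fst (vertex a b a<p b<p) ≡ a
  fst-vertex {a} {b} a<p b<p = begin
    toℕ (vertex a b a<p b<p) / p  ≡⟨ cong (_/ p) (F.toℕ-fromℕ< _) ⟩
    (b + a * p) / p               ≡⟨ +-distrib-/-∣ʳ b (divides a refl) ⟩
    b / p + a * p / p             ≡⟨ cong₂ _+_ (m<n⇒m/n≡0 b<p) (m*n/n≡m a p) ⟩
    a                             ∎
    where open ≡-Reasoning

  snd-vertex : ∀ {a b} a<p b<p → snd (vertex a b a<p b<p) ≡ b
  snd-vertex {a} {b} a<p b<p = trans (cong (_% p) (F.toℕ-fromℕ< _)) (trans ([m+kn]%n≡m%n b a p) (m<n⇒m%n≡m b<p))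

  -- Given the first coordinates α around an odd cycle, the second coordinates are forced by
  -- β (t + 1) = α t · α (t + 1) − β t; the cycle closes up iff 2 β 0 is a prescribed residue.
  module OddCycle (l r : ℕ) (p≡ : p ≡ suc (2 * r)) (α : Fin (suc (2 * suc l)) → ℕ) (α<p : ∀ i → α i < p)
    (α-inj : ∀ {i j} → α i ≡ α j → i ≡ j) where

    m : ℕ
    m = suc (2 * suc l)

    -- Extended by 0 past the cycle, so that `β` can recurse over ℕ.
    edgeTerm : ℕ → ℤ
    edgeTerm t with t <? m
    ... | yes h = ⁺ α (fromℕ< h) ℤ.* ⁺ α (nextC (fromℕ< h))
    ... | no _ = ⁺ 0

    edgeTerm-toℕ : ∀ i → edgeTerm (toℕ i) ≡ ⁺ α i ℤ.* ⁺ α (nextC i)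
    edgeTerm-toℕ i with toℕ i <? m
    ... | yes h = cong (λ k → ⁺ α k ℤ.* ⁺ α (nextC k)) (F.fromℕ<-toℕ i h)
    ... | no h = contradiction (F.toℕ<n i) h

    β : ℤ → ℕ → ℤ
    β x zero = x
    β x (suc t) = edgeTerm t ℤ.- β x t

    β-even : ∀ x t → β x (double t) ≡ β (⁺ 0) (double t) ℤ.+ x
    β-even x zero = sym (ℤ.+-identityˡ x)
    β-even x (suc t) = trans (cong (λ z → edgeTerm (suc (double t)) ℤ.- (edgeTerm (double t) ℤ.- z)) (β-even x t))
      (lem (edgeTerm (suc (double t))) (edgeTerm (double t)) (β (⁺ 0) (double t)) x)
      where
      lem : ∀ a b c x → a ℤ.- (b ℤ.- (c ℤ.+ x)) ≡ (a ℤ.- (b ℤ.- c)) ℤ.+ x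
      lem = ℤSolver.solve-∀

    turn : ℤ
    turn = β (⁺ 0) m

    -- After an odd number of steps the starting value enters with a minus sign, so closing up means
    -- 2 β₀ ≡ `turn`; modulo p = 2 r + 1 the inverse of 2 is `suc r`.
    β₀ : ℤ
    β₀ = ⁺ suc r ℤ.* turn

    β-closes : ⁺ p ℤ.∣ (β β₀ m ℤ.- β₀)
    β-closes = ℤ.divides (ℤ.- turn) (begin
      β β₀ m ℤ.- β₀                                        ≡⟨ cong (ℤ._- β₀) odd ⟩
      (turn ℤ.- β₀) ℤ.- β₀                                 ≡⟨ lem (⁺ r) turn ⟩
      (ℤ.- turn) ℤ.* (⁺ 1 ℤ.+ ⁺ 2 ℤ.* ⁺ r)                 ≡⟨ cong ((ℤ.- turn) ℤ.*_) p≡′ ⟩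
      (ℤ.- turn) ℤ.* ⁺ p                                   ∎)
      where
      open ≡-Reasoning
      p≡′ : ⁺ 1 ℤ.+ ⁺ 2 ℤ.* ⁺ r ≡ ⁺ p
      p≡′ = trans (cong (λ z → ⁺ 1 ℤ.+ z) (sym (ℤ.pos-* 2 r))) (cong ⁺_ (sym p≡))
      lem : ∀ r t → (t ℤ.- (⁺ 1 ℤ.+ r) ℤ.* t) ℤ.- (⁺ 1 ℤ.+ r) ℤ.* t ≡ (ℤ.- t) ℤ.* (⁺ 1 ℤ.+ ⁺ 2 ℤ.* r)
      lem = ℤSolver.solve-∀
      odd : β β₀ m ≡ turn ℤ.- β₀
      odd = subst (λ z → edgeTerm z ℤ.- β β₀ z ≡ (edgeTerm z ℤ.- β (⁺ 0) z) ℤ.- β₀) (double≡ (suc l))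
        (trans (cong (λ z → edgeTerm (double (suc l)) ℤ.- z) (β-even β₀ (suc l))) (lem′ (edgeTerm (double (suc l))) (β (⁺ 0) (double (suc l))) β₀))
        where
        lem′ : ∀ a b x → a ℤ.- (b ℤ.+ x) ≡ (a ℤ.- b) ℤ.- x
        lem′ = ℤSolver.solve-∀

    residue : ℕ → ℕ
    residue t = β β₀ t ℤ.%ℕ p

    residue< : ∀ t → residue t < p
    residue< t = ℤ.n%ℕd<d (β β₀ t) p

    residue-∣ : ∀ t → ⁺ p ℤ.∣ (⁺ residue t ℤ.- β β₀ t)
    residue-∣ t = ℤ.divides (ℤ.- q) (trans (cong (λ z → ⁺ residue t ℤ.- z) (ℤ.a≡a%ℕn+[a/ℕn]*n (β β₀ t) p)) (lem (⁺ residue t) q (⁺ p)))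
      where
      q = β β₀ t ℤ./ℕ p
      lem : ∀ r q p → r ℤ.- (r ℤ.+ q ℤ.* p) ≡ (ℤ.- q) ℤ.* p
      lem = ℤSolver.solve-∀

    cycle : Fin m → Fin n
    cycle i = vertex (α i) (residue (toℕ i)) (α<p i) (residue< (toℕ i))

    fst-cycle : ∀ i → fst (cycle i) ≡ α i
    fst-cycle i = fst-vertex (α<p i) (residue< (toℕ i))

    consecutive : ∀ i → ⁺ p ℤ.∣ ((⁺ residue (toℕ i) ℤ.+ ⁺ residue (toℕ (nextC i))) ℤ.- ⁺ α i ℤ.* ⁺ α (nextC i))
    consecutive i with nextC-view i
    ... | inj₁ e = subst (⁺ p ℤ.∣_) eq (ℤ.∣m∣n⇒∣m+n (residue-∣ (toℕ i)) (residue-∣ (suc (toℕ i))))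
      where
      lem : ∀ a b x e → (a ℤ.- x) ℤ.+ (b ℤ.- (e ℤ.- x)) ≡ (a ℤ.+ b) ℤ.- e
      lem = ℤSolver.solve-∀
      eq : (⁺ residue (toℕ i) ℤ.- β β₀ (toℕ i)) ℤ.+ (⁺ residue (suc (toℕ i)) ℤ.- β β₀ (suc (toℕ i))) ≡
           (⁺ residue (toℕ i) ℤ.+ ⁺ residue (toℕ (nextC i))) ℤ.- ⁺ α i ℤ.* ⁺ α (nextC i)
      eq = trans (lem (⁺ residue (toℕ i)) (⁺ residue (suc (toℕ i))) (β β₀ (toℕ i)) (edgeTerm (toℕ i)))
        (cong₂ (λ s z → (⁺ residue (toℕ i) ℤ.+ ⁺ residue s) ℤ.- z) (sym e) (edgeTerm-toℕ i))
    ... | inj₂ (last , first) = subst (⁺ p ℤ.∣_) eq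
        (ℤ.∣m∣n⇒∣m-n (ℤ.∣m∣n⇒∣m+n (residue-∣ (toℕ i)) (residue-∣ 0)) (subst (λ z → ⁺ p ℤ.∣ (β β₀ z ℤ.- β₀)) (sym last) β-closes))
      where
      lem : ∀ a b x y e → ((a ℤ.- x) ℤ.+ (b ℤ.- y)) ℤ.- ((e ℤ.- x) ℤ.- y) ≡ (a ℤ.+ b) ℤ.- e
      lem = ℤSolver.solve-∀
      eq : ((⁺ residue (toℕ i) ℤ.- β β₀ (toℕ i)) ℤ.+ (⁺ residue 0 ℤ.- β₀)) ℤ.- (β β₀ (suc (toℕ i)) ℤ.- β₀) ≡
           (⁺ residue (toℕ i) ℤ.+ ⁺ residue (toℕ (nextC i))) ℤ.- ⁺ α i ℤ.* ⁺ α (nextC i)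
      eq = trans (lem (⁺ residue (toℕ i)) (⁺ residue 0) (β β₀ (toℕ i)) β₀ (edgeTerm (toℕ i)))
        (cong₂ (λ s z → (⁺ residue (toℕ i) ℤ.+ ⁺ residue s) ℤ.- z) (sym first) (edgeTerm-toℕ i))

    cycle-inj : ∀ i j → cycle i ≡ cycle j → i ≡ j
    cycle-inj i j e = α-inj (trans (sym (fst-cycle i)) (trans (cong fst e) (fst-cycle j)))

    cycle-map : CycleMap m graph cycle
    cycle-map = record { inj = cycle-inj ; edges = λ i → related-intro (rel
        (vertex< (α<p i) (residue< (toℕ i))) (vertex< (α<p (nextC i)) (residue< (toℕ (nextC i))))
        (λ e → nextC-≢ i (sym (cycle-inj i (nextC i) e)))
        (subst (⁺ p ℤ.∣_) (sym (form-cycle i)) (consecutive i))) }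
      where
      form-cycle : ∀ i → form (fst (cycle i)) (snd (cycle i)) (fst (cycle (nextC i))) (snd (cycle (nextC i))) ≡
        (⁺ residue (toℕ i) ℤ.+ ⁺ residue (toℕ (nextC i))) ℤ.- ⁺ α i ℤ.* ⁺ α (nextC i)
      form-cycle i = cong₂ ℤ._-_
        (cong₂ (λ x y → ⁺ x ℤ.+ ⁺ y) (snd-vertex (α<p i) (residue< (toℕ i))) (snd-vertex (α<p (nextC i)) (residue< (toℕ (nextC i)))))
        (cong₂ (λ x y → ⁺ x ℤ.* ⁺ y) (fst-cycle i) (fst-cycle (nextC i)))

  -- Each position owns a block of `q` residues, so its first coordinate is chosen freely and
  -- distinctness is automatic.
  labelled≥ : ∀ l r q → p ≡ suc (2 * r) → suc (2 * suc l) * q ≤ p → q ^ suc (2 * suc l) ≤ labelledCycles (suc (2 * suc l)) graph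
  labelled≥ l r q p≡ small = labelled-lower graph (λ φ → OddCycle.cycle l r p≡ (α φ) (α<p φ) (α-inj φ))
    (λ φ → OddCycle.cycle-map l r p≡ (α φ) (α<p φ) (α-inj φ))
    (λ φ ψ e i → F.combine-injectiveʳ i (φ i) i (ψ i) (F.toℕ-injective (trans
      (sym (OddCycle.fst-cycle l r p≡ (α φ) (α<p φ) (α-inj φ) i)) (trans (cong fst (e i))
      (OddCycle.fst-cycle l r p≡ (α ψ) (α<p ψ) (α-inj ψ) i)))))
    where
    α : (Fin (suc (2 * suc l)) → Fin q) → Fin (suc (2 * suc l)) → ℕ
    α φ i = toℕ (F.combine i (φ i))
    α<p : ∀ φ i → α φ i < p
    α<p φ i = <-≤-trans (F.toℕ<n (F.combine i (φ i))) small
    α-inj : ∀ φ {i j} → α φ i ≡ α φ j → i ≡ j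
    α-inj φ {i} {j} e = F.combine-injectiveˡ i (φ i) j (φ j) (F.toℕ-injective e)

-- An odd cycle with every other vertex blown up

data Half : ℕ → Set where
  even : ∀ c → Half (double c)
  odd : ∀ c → Half (suc (double c))

half : ∀ t → Half t
half zero = even zero
half (suc t) with half t
... | even c = odd c
... | odd c = even (suc c)

double-injective : ∀ {a b} → double a ≡ double b → a ≡ b
double-injective {zero} {zero} _ = refl
double-injective {suc a} {suc b} e = cong suc (double-injective (suc-injective (suc-injective e)))

odd≢even : ∀ a {b} → suc (double a) ≢ double b
odd≢even zero {suc b} ()
odd≢even (suc a) {suc b} e = odd≢even a (suc-injective (suc-injective e))

double-cancel-< : ∀ {a b} → double a < double b → a < b
double-cancel-< {zero} {suc b} _ = s≤s z≤n
double-cancel-< {suc a} {suc b} (s≤s (s≤s h)) = s≤s (double-cancel-< h)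

isOdd : ℕ → Bool
isOdd zero = false
isOdd (suc n) = not (isOdd n)

isOdd-double : ∀ c → isOdd (double c) ≡ false
isOdd-double zero = refl
isOdd-double (suc c) = cong (λ z → not (not z)) (isOdd-double c)

argmax : ∀ {m} (g : Fin (suc m) → ℕ) → ∃ λ i → ∀ j → g j ≤ g i
argmax {zero} g = zero , λ { zero → ≤-refl }
argmax {suc m} g with argmax (g ∘ suc)
... | i , max with ≤-total (g zero) (g (suc i))
...   | inj₁ h = suc i , λ { zero → h ; (suc j) → max j }
...   | inj₂ h = zero , λ { zero → ≤-refl ; (suc j) → ≤-trans (max j) h }

module Unrolled {n : ℕ} {G : Graph n} (m : ℕ) .{{_ : NonZero m}} {f : Fin m → Fin n} (C : CycleMap m G f) where

  open CycleMap C

  abstract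
    index : ℕ → Fin m
    index t = fromℕ< (m%n<n t m)

    toℕ-index : ∀ t → toℕ (index t) ≡ t % m
    toℕ-index t = F.toℕ-fromℕ< _

    suc-% : ∀ t → suc t % m ≡ suc (t % m) % m
    suc-% t = trans (cong (λ z → suc z % m) (m≡m%n+[m/n]*n t m)) ([m+kn]%n≡m%n (suc (t % m)) (t / m) m)

    index-suc : ∀ t → nextC (index t) ≡ index (suc t)
    index-suc t = F.toℕ-injective (trans (next (nextC-view (index t))) (sym (toℕ-index (suc t))))
      where
      next : (toℕ (nextC (index t)) ≡ suc (toℕ (index t)) ⊎ (suc (toℕ (index t)) ≡ m × toℕ (nextC (index t)) ≡ 0)) →
        toℕ (nextC (index t)) ≡ suc t % m
      next (inj₁ e) = trans e (trans (cong suc (toℕ-index t)) (sym (trans (suc-% t) (m<n⇒m%n≡m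
        (subst (_< m) (trans e (cong suc (toℕ-index t))) (F.toℕ<n (nextC (index t))))))))
      next (inj₂ (l , z)) = trans z (sym (trans (suc-% t) (trans (cong (_% m) (trans (cong suc (sym (toℕ-index t))) l)) (n%n≡0 m))))

    -- The cycle as a periodic sequence: local arguments become statements about `t + d`, without
    -- wrapping indices.
    at : ℕ → Fin n
    at t = f (index t)

    at-adj : ∀ t → adj G (at t) (at (suc t)) ≡ true
    at-adj t = subst (λ i → adj G (at t) (f i) ≡ true) (index-suc t) (edges (index t))

    at-toℕ : ∀ i → at (toℕ i) ≡ f i
    at-toℕ i = cong f (F.toℕ-injective (trans (toℕ-index (toℕ i)) (m<n⇒m%n≡m (F.toℕ<n i))))

    at-image : ∀ t → ∃ λ i → at t ≡ f i
    at-image t = index t , refl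

    at-period : ∀ t → at (t + m) ≡ at t
    at-period t = cong f (F.toℕ-injective (trans (toℕ-index (t + m)) (trans ([m+n]%n≡m%n t m) (sym (toℕ-index t)))))

    at-distinct : ∀ t d → 0 < d → d < m → at (t + d) ≢ at t
    at-distinct t d d>0 d<m e = <⇒≱ d<m (∣⇒≤ {{>-nonZero d>0}} (∣m+n∣m⇒∣n {m = t / m * m} (divides ((t + d) / m) quotients) (n∣m*n (t / m))))
      where
      same : (t + d) % m ≡ t % m
      same = trans (sym (toℕ-index (t + d))) (trans (cong toℕ (inj _ _ e)) (toℕ-index t))
      open ≡-Reasoning
      quotients : t / m * m + d ≡ (t + d) / m * m
      quotients = +-cancelˡ-≡ (t % m) _ _ (begin
        t % m + (t / m * m + d)              ≡⟨ sym (+-assoc (t % m) _ d) ⟩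
        t % m + t / m * m + d                ≡⟨ cong (_+ d) (sym (m≡m%n+[m/n]*n t m)) ⟩
        t + d                                ≡⟨ m≡m%n+[m/n]*n (t + d) m ⟩
        (t + d) % m + (t + d) / m * m        ≡⟨ cong (_+ (t + d) / m * m) same ⟩
        t % m + (t + d) / m * m              ∎)

module Blowup (l : ℕ) .{{_ : NonZero l}} (n : ℕ) where

  -- Levels 0 to 2 l are the positions on C₂ₗ₊₁. The first l + 1 vertices occupy the even levels,
  -- one each; the rest are spread over the odd levels by residue modulo `l`.
  levelOf : ℕ → ℕ
  levelOf x with x ≤? l
  ... | yes _ = double x
  ... | no _ = suc (double ((x ∸ suc l) % l))

  level : Fin n → ℕ
  level v = levelOf (toℕ v)

  -- `Wrap` isolates the closing edge of C₂ₗ₊₁. It joins two levels that are not blown up, so it is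
  -- a single edge, and the only one that does not change the parity of the level.
  Wrap Near : ℕ → ℕ → Set
  Wrap a b = (a ≡ 0 × b ≡ double l) ⊎ (a ≡ double l × b ≡ 0)
  Near a b = Wrap a b ⊎ (suc a ≡ b ⊎ suc b ≡ a)

  wrap? : ∀ a b → Dec (Wrap a b)
  wrap? a b = (a ≟ 0 ×-dec b ≟ double l) ⊎-dec (a ≟ double l ×-dec b ≟ 0)

  near? : ∀ a b → Dec (Near a b)
  near? a b = wrap? a b ⊎-dec (suc a ≟ b ⊎-dec suc b ≟ a)

  Near-sym : ∀ {a b} → Near a b → Near b a
  Near-sym (inj₁ (inj₁ (x , y))) = inj₁ (inj₂ (y , x))
  Near-sym (inj₁ (inj₂ (x , y))) = inj₁ (inj₁ (y , x))
  Near-sym (inj₂ (inj₁ x)) = inj₂ (inj₂ x)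
  Near-sym (inj₂ (inj₂ x)) = inj₂ (inj₁ x)

  double-l≢0 : double l ≢ 0
  double-l≢0 e = ≢-nonZero⁻¹ l (double-injective {l} {0} e)

  Near-irrefl : ∀ {a} → ¬ Near a a
  Near-irrefl (inj₁ (inj₁ (x , y))) = double-l≢0 (trans (sym y) x)
  Near-irrefl (inj₁ (inj₂ (x , y))) = double-l≢0 (trans (sym x) y)
  Near-irrefl (inj₂ (inj₁ x)) = <-irrefl (sym x) ≤-refl
  Near-irrefl (inj₂ (inj₂ x)) = <-irrefl (sym x) ≤-refl

  graph : Graph n
  graph = record
    { adj = λ u v → ⌊ near? (level u) (level v) ⌋
    ; sym = λ u v → true-iff (swap u v) (swap v u)
    ; irref = λ v → loopless v ⌊ near? (level v) (level v) ⌋ refl }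
    where
    swap : ∀ u v → ⌊ near? (level u) (level v) ⌋ ≡ true → ⌊ near? (level v) (level u) ⌋ ≡ true
    swap u v e = ⌊⌋-true (near? (level v) (level u)) (Near-sym (⌊⌋-elim (near? (level u) (level v)) e))
    loopless : ∀ v b → ⌊ near? (level v) (level v) ⌋ ≡ b → b ≡ false
    loopless v true e = contradiction (⌊⌋-elim (near? (level v) (level v)) e) Near-irrefl
    loopless v false _ = refl

  levelOf-even : ∀ x c → levelOf x ≡ double c → x ≡ c
  levelOf-even x c e with x ≤? l
  ... | yes _ = double-injective e
  ... | no _ = contradiction e (odd≢even _)

  even-unique : ∀ c {u v} → level u ≡ double c → level v ≡ double c → u ≡ v
  even-unique c {u} {v} e e′ = F.toℕ-injective (trans (levelOf-even (toℕ u) c e) (sym (levelOf-even (toℕ v) c e′)))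

  module NoEvenCycle (i : ℕ) {f : Fin (double (3 + i)) → Fin n} (C : CycleMap (double (3 + i)) graph f) where

    m : ℕ
    m = double (3 + i)

    open Unrolled {G = graph} m C

    L : ℕ → ℕ
    L t = level (at t)

    near : ∀ t → Near (L t) (L (suc t))
    near t = ⌊⌋-elim (near? (L t) (L (suc t))) (at-adj t)

    apart : ∀ t d → 0 < d → d ≤ 4 → at (t + d) ≢ at t
    apart t d d>0 d≤4 = at-distinct t d d>0 (s≤s (≤-trans d≤4 (s≤s (s≤s (s≤s (s≤s z≤n))))))

    opposite : ∀ t d → 0 < d → d < m → at (t + d) ≡ at (suc t) → at (suc (t + d)) ≢ at t
    opposite t (suc zero) _ _ _ e = apart t 2 (s≤s z≤n) (s≤s (s≤s z≤n)) (trans (cong at (+-suc t 1)) e)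
    opposite t (suc (suc d)) _ d<m e _ = at-distinct (suc t) (suc d) (s≤s z≤n) (<-trans (n<1+n _) d<m) (trans (cong at (sym (+-suc t (suc d)))) e)

    -- A cycle uses an edge at most once; `opposite` excludes a second use in the reverse direction.
    Wrap-unique : ∀ t d → 0 < d → d < m → Wrap (L t) (L (suc t)) → ¬ Wrap (L (t + d)) (L (suc (t + d)))
    Wrap-unique t d d>0 d<m (inj₁ (x , y)) (inj₁ (x′ , y′)) = at-distinct t d d>0 d<m (even-unique 0 x′ x)
    Wrap-unique t d d>0 d<m (inj₂ (x , y)) (inj₂ (x′ , y′)) = at-distinct t d d>0 d<m (even-unique l x′ x)
    Wrap-unique t d d>0 d<m (inj₁ (x , y)) (inj₂ (x′ , y′)) = opposite t d d>0 d<m (even-unique l x′ y) (even-unique 0 y′ x)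
    Wrap-unique t d d>0 d<m (inj₂ (x , y)) (inj₁ (x′ , y′)) = opposite t d d>0 d<m (even-unique 0 x′ y) (even-unique l y′ x)

    -- Away from a wrapping edge the level changes parity at every step, but the cycle has even length.
    no-wrap : ∀ t → ¬ Wrap (L t) (L (suc t))
    no-wrap t w = case trans (sym (alternate (suc (double (2 + i))) ≤-refl)) closed of last-odd
      where
      wrap-even₁ : ∀ {a b} → Wrap a b → isOdd a ≡ false
      wrap-even₁ (inj₁ (x , _)) = cong isOdd x
      wrap-even₁ (inj₂ (x , _)) = trans (cong isOdd x) (isOdd-double l)
      wrap-even₂ : ∀ {a b} → Wrap a b → isOdd b ≡ false
      wrap-even₂ (inj₁ (_ , y)) = trans (cong isOdd y) (isOdd-double l)
      wrap-even₂ (inj₂ (_ , y)) = cong isOdd y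
      flip : ∀ {a b} → suc a ≡ b ⊎ suc b ≡ a → isOdd b ≡ not (isOdd a)
      flip (inj₁ refl) = refl
      flip {b = b} (inj₂ refl) = not-not (isOdd b)
        where
        not-not : ∀ x → x ≡ not (not x)
        not-not true = refl
        not-not false = refl
      alternate : ∀ d → d < m → isOdd (L (suc t + d)) ≡ isOdd d
      alternate zero _ = trans (cong (λ z → isOdd (L z)) (+-identityʳ (suc t))) (wrap-even₂ w)
      alternate (suc d) d<m = trans (cong (λ z → isOdd (L z)) (+-suc (suc t) d)) (step (near (suc t + d)))
        where
        step : Near (L (suc t + d)) (L (suc (suc t + d))) → isOdd (L (suc (suc t + d))) ≡ not (isOdd d)
        step (inj₁ w′) = contradiction (subst (λ z → Wrap (L z) (L (suc z))) (sym (+-suc t d)) w′) (Wrap-unique t (suc d) (s≤s z≤n) d<m w)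
        step (inj₂ s) = trans (flip s) (cong not (alternate d (<-trans (n<1+n d) d<m)))
      closed : isOdd (L (suc t + suc (double (2 + i)))) ≡ false
      closed = trans (cong isOdd (trans (cong L (sym (+-suc t (suc (double (2 + i)))))) (cong level (at-period t)))) (wrap-even₁ w)
      last-odd : isOdd (suc (double (2 + i))) ≢ false
      last-odd e with () ← trans (sym e) (cong not (isOdd-double (2 + i)))

    steps : ∀ t → suc (L t) ≡ L (suc t) ⊎ suc (L (suc t)) ≡ L t
    steps t with near t
    ... | inj₁ w = contradiction w (no-wrap t)
    ... | inj₂ r = r

    differ : ∀ t d → 0 < d → d ≤ 4 → at (d + t) ≢ at t
    differ t d p q e = apart t d p q (trans (cong at (+-comm t d)) e)

    -- At a vertex of maximal level the cycle turns back, which it can do only within a quadrilateral.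
    no-peak : ∀ t → ¬ (∀ s → L s ≤ L (2 + t))
    no-peak t below = peak (half (L (2 + t))) refl
      where
      before : suc (L (1 + t)) ≡ L (2 + t)
      before = case steps (1 + t) of λ
        { (inj₁ e) → e
        ; (inj₂ e) → contradiction (below (1 + t)) (<⇒≱ (≤-reflexive e)) }
      after : suc (L (3 + t)) ≡ L (2 + t)
      after = case steps (2 + t) of λ
        { (inj₂ e) → e
        ; (inj₁ e) → contradiction (below (3 + t)) (<⇒≱ (≤-reflexive e)) }
      -- From a peak at an even level, turning up again revisits its only vertex, while descending
      -- on both sides meets the only vertex two levels below at positions four apart. This needs a
      -- length above 4.
      corner : ∀ c → L (2 + t) ≡ double (suc c) → suc (L t) ≡ L (1 + t) ⊎ suc (L (1 + t)) ≡ L t →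
        suc (L (3 + t)) ≡ L (4 + t) ⊎ suc (L (4 + t)) ≡ L (3 + t) → ⊥
      corner c e (inj₂ x) _ = differ t 2 (s≤s z≤n) (s≤s (s≤s z≤n)) (even-unique (suc c) e (trans (sym x) (trans before e)))
      corner c e (inj₁ _) (inj₁ y) = differ (2 + t) 2 (s≤s z≤n) (s≤s (s≤s z≤n)) (even-unique (suc c) (trans (sym y) (trans after e)) e)
      corner c e (inj₁ x) (inj₂ y) = differ t 4 (s≤s z≤n) ≤-refl
        (even-unique c (suc-injective (trans y (suc-injective (trans after e)))) (suc-injective (trans x (suc-injective (trans before e)))))
      peak : ∀ {x} → Half x → L (2 + t) ≡ x → ⊥
      -- At an odd peak both neighbours are the only vertex of the level below.
      peak (odd c) e = differ (1 + t) 2 (s≤s z≤n) (s≤s (s≤s z≤n))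
        (even-unique c (suc-injective (trans after e)) (suc-injective (trans before e)))
      peak (even zero) e = 1+n≢0 (trans before e)
      peak (even (suc c)) e = corner c e (steps t) (steps (3 + t))

    contradictory : ⊥
    contradictory =
      let k , max = argmax (λ k → level (f k))
      -- `no-peak` looks back two positions, so the maximum is taken one period later, at k + m.
      in no-peak (toℕ k + double (2 + i)) λ s →
        let k′ , e = at-image s
        in ≤-trans (≤-reflexive (cong level e)) (≤-trans (max k′) (≤-reflexive (sym (cong level
             (trans (cong at (lem (toℕ k) (double (2 + i)))) (trans (at-period (toℕ k)) (at-toℕ k)))))))
      where
      lem : ∀ a b → 2 + (a + b) ≡ a + (2 + b)
      lem = solve-∀

  module Copies (q : ℕ) (fits : suc l + l * q ≤ n) where

    module _ (φ : Fin l → Fin q) where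

      choice : ℕ → ℕ
      choice c with c <? l
      ... | yes h = toℕ (φ (fromℕ< h))
      ... | no _ = 0

      choice-toℕ : ∀ c → choice (toℕ c) ≡ toℕ (φ c)
      choice-toℕ c with toℕ c <? l
      ... | yes h = cong (toℕ ∘ φ) (F.fromℕ<-toℕ c h)
      ... | no h = contradiction (F.toℕ<n c) h

      choice-< : ∀ c → c < l → choice c < q
      choice-< c c<l with c <? l
      ... | yes h = F.toℕ<n _
      ... | no h = contradiction c<l h

      -- Adding multiples of `l` keeps the residue and so moves within one blown-up level.
      place : ∀ {t} → Half t → ℕ
      place (even c) = c
      place (odd c) = suc l + (c + choice c * l)

      place-level : ∀ {t} (h : Half t) → t < suc (double l) → place h < n × levelOf (place h) ≡ t
      place-level (even c) t< = ≤-trans (s≤s c≤l) (≤-trans (m≤m+n (suc l) (l * q)) fits) , core-level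
        where
        c≤l : c ≤ l
        c≤l = ≤-pred (double-cancel-< {c} {suc l} (m≤n⇒m≤1+n t<))
        core-level : levelOf c ≡ double c
        core-level with c ≤? l
        ... | yes _ = refl
        ... | no h = contradiction c≤l h
      place-level (odd c) t< = <-≤-trans (+-monoʳ-< (suc l) inBlob) fits , blob-level
        where
        c<l : c < l
        c<l = double-cancel-< (≤-pred t<)
        inBlob : c + choice c * l < l * q
        inBlob = ≤-trans (+-monoˡ-≤ (choice c * l) c<l) (≤-trans (*-monoˡ-≤ l (choice-< c c<l)) (≤-reflexive (*-comm q l)))
        blob-level : levelOf (suc l + (c + choice c * l)) ≡ suc (double c)
        blob-level with suc l + (c + choice c * l) ≤? l
        ... | yes h = contradiction (≤-trans (m≤m+n (suc l) _) h) (n≮n l)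
        ... | no _ = cong (suc ∘ double) (trans (cong (_% l) (m+n∸m≡n (suc l) (c + choice c * l)))
                       (trans ([m+kn]%n≡m%n c (choice c) l) (m<n⇒m%n≡m c<l)))

      cycle : Fin (suc (double l)) → Fin n
      cycle k = fromℕ< (proj₁ (place-level (half (toℕ k)) (F.toℕ<n k)))

      toℕ-cycle : ∀ k → toℕ (cycle k) ≡ place (half (toℕ k))
      toℕ-cycle k = F.toℕ-fromℕ< _

      level-cycle : ∀ k → level (cycle k) ≡ toℕ k
      level-cycle k = trans (cong levelOf (toℕ-cycle k)) (proj₂ (place-level (half (toℕ k)) (F.toℕ<n k)))

      cycle-map : CycleMap (suc (double l)) graph cycle
      cycle-map = record
        { inj = λ j k e → F.toℕ-injective (trans (sym (level-cycle j)) (trans (cong level e) (level-cycle k)))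
        ; edges = λ k → ⌊⌋-true (near? (level (cycle k)) (level (cycle (nextC k))))
            (subst₂ Near (sym (level-cycle k)) (sym (level-cycle (nextC k))) (next k (nextC-view k))) }
        where
        next : ∀ k → (toℕ (nextC k) ≡ suc (toℕ k) ⊎ (suc (toℕ k) ≡ suc (double l) × toℕ (nextC k) ≡ 0)) → Near (toℕ k) (toℕ (nextC k))
        next k (inj₁ e) = inj₂ (inj₁ (sym e))
        next k (inj₂ (a , b)) = inj₁ (inj₂ (suc-injective a , b))

    place-odd : ∀ φ {t} (h : Half t) c → t ≡ suc (double c) → place φ h ≡ suc l + (c + choice φ c * l)
    place-odd φ (even c′) c e = contradiction (sym e) (odd≢even c)
    place-odd φ (odd c′) c e with refl ← double-injective {c′} {c} (suc-injective e) = refl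

    labelled≥ : q ^ l ≤ labelledCycles (suc (double l)) graph
    labelled≥ = labelled-lower graph cycle cycle-map λ φ ψ e c →
      F.toℕ-injective (trans (sym (choice-toℕ φ c)) (trans (recover φ ψ e c) (choice-toℕ ψ c)))
      where
      double-mono-< : ∀ {a b} → a < b → suc (double a) < suc (double b)
      double-mono-< {zero} {suc b} _ = s≤s (s≤s z≤n)
      double-mono-< {suc a} {suc b} (s≤s h) = s≤s (s≤s (double-mono-< h))
      recover : ∀ φ ψ → (∀ k → cycle φ k ≡ cycle ψ k) → ∀ c → choice φ (toℕ c) ≡ choice ψ (toℕ c)
      recover φ ψ e c = *-cancelʳ-≡ _ _ l (+-cancelˡ-≡ (toℕ c) _ _ (+-cancelˡ-≡ (suc l) _ _
        (trans (sym (placed φ)) (trans (cong toℕ (e k)) (placed ψ)))))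
        where
        k : Fin (suc (double l))
        k = fromℕ< (double-mono-< (F.toℕ<n c))
        placed : ∀ χ → toℕ (cycle χ k) ≡ suc l + (toℕ c + choice χ (toℕ c) * l)
        placed χ = trans (toℕ-cycle χ k) (place-odd χ (half (toℕ k)) (toℕ c) (F.toℕ-fromℕ< (double-mono-< (F.toℕ<n c))))

-- Constants of the lower bounds

lowerLong : ∀ i j → ExLower (3 + i) (2 + j) 1 (2 + j)
-- `B` comes from n ≤ B q for blobs of size `q`, and `4 * M` from passing to copies; the threshold
-- ensures q ≥ 2 M, as `copies-lower` requires.
lowerLong i j = B ^ l * (4 * M) , suc l + l * (2 * M) , construct
  where
  l = 2 + j
  M = suc (double l)
  B = suc l + l + l
  index : 2 * l + 1 ≡ M
  index = trans (+-comm (2 * l) 1) (cong suc (sym (double≡ l)))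
  construct : ∀ n → suc l + l * (2 * M) ≤ n → Σ (Graph n) λ G → Σ (ProperColouring G) λ c → RainbowC2kFree (3 + i) G c ×
    (n ^ l ≤ B ^ l * (4 * M) * copiesC (2 * l + 1) G ^ 1)
  construct n large = graph , sumColouring graph , free , bound
    where
    open Blowup l n
    q = (n ∸ suc l) / l
    free : RainbowC2kFree (3 + i) graph (sumColouring graph)
    free = subst (λ m → ¬ HasRainbowCycle m graph (sumColouring graph)) (double≡ (3 + i))
      (λ (f , C , _) → NoEvenCycle.contradictory i C)
    sucl≤n : suc l ≤ n
    sucl≤n = ≤-trans (m≤m+n (suc l) _) large
    fits : suc l + l * q ≤ n
    fits = ≤-trans (+-monoʳ-≤ (suc l) (≤-trans (≤-reflexive (*-comm l q)) (m/n*n≤m (n ∸ suc l) l))) (≤-reflexive (m+[n∸m]≡n sucl≤n))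
    2M≤q : 2 * M ≤ q
    2M≤q = ≤-trans (≤-reflexive (sym (m*n/n≡m (2 * M) l)))
      (/-monoˡ-≤ l (≤-trans (≤-reflexive (trans (*-comm (2 * M) l) (sym (m+n∸m≡n (suc l) (l * (2 * M)))))) (∸-monoˡ-≤ (suc l) large)))
    q≥1 : 1 ≤ q
    q≥1 = ≤-trans (s≤s z≤n) 2M≤q
    n≤ : n ≤ B * q
    n≤ = begin
      n                                           ≡⟨ sym (m+[n∸m]≡n sucl≤n) ⟩
      suc l + (n ∸ suc l) ≡⟨ cong (suc l +_) (m≡m%n+[m/n]*n (n ∸ suc l) l) ⟩
      suc l + ((n ∸ suc l) % l + q * l) ≤⟨ +-monoʳ-≤ (suc l) (+-monoˡ-≤ (q * l) (<⇒≤ (m%n<n (n ∸ suc l) l))) ⟩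
      suc l + (l + q * l)                         ≡⟨ sym (+-assoc (suc l) l (q * l)) ⟩
      suc l + l + q * l ≤⟨ +-mono-≤ (≤-trans (≤-reflexive (sym (*-identityʳ (suc l + l)))) (*-monoʳ-≤ (suc l + l) q≥1))
                                                       (≤-reflexive (*-comm q l)) ⟩
      (suc l + l) * q + l * q                     ≡⟨ sym (*-distribʳ-+ q (suc l + l) l) ⟩
      B * q                                       ∎
      where open ≤-Reasoning
    bound : n ^ l ≤ B ^ l * (4 * M) * copiesC (2 * l + 1) graph ^ 1
    bound = begin
      n ^ l                                                 ≤⟨ ^-monoˡ-≤ l n≤ ⟩
      (B * q) ^ l                                           ≡⟨ ^-distribʳ-* l B q ⟩
      B ^ l * q ^ l ≤⟨ *-monoʳ-≤ (B ^ l) (copies-lower M graph (q ^ l) (s≤s z≤n) (Copies.labelled≥ q fits)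
                                                                 (≤-trans 2M≤q (≤-trans (≤-reflexive (sym (*-identityʳ q)))
                                                                   (*-monoʳ-≤ q (m^n>0 q {{>-nonZero q≥1}} (suc j)))))) ⟩
      B ^ l * (4 * M * copiesC M graph) ≡⟨ sym (*-assoc (B ^ l) (4 * M) _) ⟩
      B ^ l * (4 * M) * copiesC M graph ≡⟨ cong (λ m → B ^ l * (4 * M) * copiesC m graph) (sym index) ⟩
      B ^ l * (4 * M) * copiesC (2 * l + 1) graph ≡⟨ cong (B ^ l * (4 * M) *_) (sym (*-identityʳ _)) ⟩
      B ^ l * (4 * M) * copiesC (2 * l + 1) graph ^ 1       ∎
      where open ≤-Reasoning

odd-prime : ∀ {p} → Prime p → 2 < p → ∃ λ r → p ≡ suc (2 * r)
odd-prime {p} pr 2<p = from (half p) refl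
  where
  from : ∀ {x} → Half x → p ≡ x → ∃ λ r → p ≡ suc (2 * r)
  from (odd r) e = r , trans e (cong suc (double≡ r))
  from (even r) e with prime⇒irreducible pr (divides r (trans e (trans (double≡ r) (*-comm 2 r))))
  ... | inj₂ 2≡p = contradiction 2≡p (<⇒≢ 2<p)

lowerQuadrilateral : ∀ l → ExLower 2 (suc l) 2 (2 * suc l + 1)
-- 4096 (M M) comes from n ≤ 1024 p² and p ≤ 2 M q, and 16 (M M) is the square of the loss in
-- `copies-lower`. Requiring p ≥ `p₀` gives q ≥ 2 M and makes `p` odd.
lowerQuadrilateral l = (4096 * (M * M)) ^ M * (16 * (M * M)) , threshold + 1024 * (p₀ * p₀) , λ n large →
    construct n (≤-trans (m≤n+m (1024 * (p₀ * p₀)) threshold) large) (prime-square n (≤-trans (m≤m+n threshold _) large))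
  where
  M = suc (2 * suc l)
  p₀ = 2 * M * M
  index : 2 * suc l + 1 ≡ M
  index = +-comm (2 * suc l) 1
  construct : ∀ n → 1024 * (p₀ * p₀) ≤ n → (∃ λ p → Prime p × p * p ≤ n × n ≤ 1024 * (p * p)) →
    Σ (Graph n) λ G → Σ (ProperColouring G) λ c → RainbowC2kFree 2 G c ×
      (n ^ (2 * suc l + 1) ≤ (4096 * (M * M)) ^ M * (16 * (M * M)) * copiesC (2 * suc l + 1) G ^ 2)
  construct n large (p , pr , p²≤n , n≤p²) = graph , sumColouring graph , (λ (f , C , _) → no-quadrilateral f C) , bound
    where
    open Polarity p pr n p²≤n
    q = p / M
    p₀≤p : p₀ ≤ p
    p₀≤p = ≮⇒≥ λ p<p₀ → <⇒≱ (*-monoʳ-< 1024 (*-mono-< p<p₀ p<p₀)) (≤-trans large n≤p²)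
    2M≤q : 2 * M ≤ q
    2M≤q = ≤-trans (≤-reflexive (sym (m*n/n≡m (2 * M) M))) (/-monoˡ-≤ M p₀≤p)
    2M≤p₀ : 2 * M ≤ p₀
    2M≤p₀ = ≤-trans (≤-reflexive (sym (*-identityʳ (2 * M)))) (*-monoʳ-≤ (2 * M) {1} {M} (s≤s z≤n))
    2<p : 2 < p
    2<p = ≤-trans (≤-trans (s≤s (*-monoʳ-≤ 2 {1} {suc l} (s≤s z≤n))) (m≤m+n M (M + 0))) (≤-trans 2M≤p₀ p₀≤p)
    p≤ : p ≤ 2 * M * q
    p≤ = begin
      p                  ≡⟨ m≡m%n+[m/n]*n p M ⟩
      p % M + q * M      ≤⟨ +-mono-≤ (<⇒≤ (m%n<n p M)) (≤-reflexive (*-comm q M)) ⟩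
      M + M * q ≤⟨ +-monoˡ-≤ (M * q) (≤-trans (≤-reflexive (sym (*-identityʳ M))) (*-monoʳ-≤ M (≤-trans (s≤s z≤n) 2M≤q))) ⟩
      M * q + M * q      ≡⟨ lem M q ⟩
      2 * M * q          ∎
      where
      open ≤-Reasoning
      lem : ∀ m q → m * q + m * q ≡ 2 * m * q
      lem = solve-∀
    copies : q ^ M ≤ 4 * M * copiesC M graph
    copies = copies-lower M graph (q ^ M) (s≤s z≤n)
      (let r , p≡ = odd-prime pr 2<p in labelled≥ l r q p≡ (≤-trans (≤-reflexive (*-comm M q)) (m/n*n≤m p M)))
      (≤-trans 2M≤q (≤-trans (≤-reflexive (sym (*-identityʳ q))) (*-monoʳ-≤ q (m^n>0 q {{>-nonZero (≤-trans (s≤s z≤n) 2M≤q)}} (2 * suc l)))))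
    n≤ : n ≤ 4096 * (M * M) * (q * q)
    n≤ = ≤-trans n≤p² (≤-trans (*-monoʳ-≤ 1024 (*-mono-≤ p≤ p≤)) (≤-reflexive (trans (cong (1024 *_) (lem M q)) (assemble 1024 4 (M * M) (q * q)))))
      where
      lem : ∀ m q → 2 * m * q * (2 * m * q) ≡ 4 * (m * m * (q * q))
      lem = solve-∀
      assemble : ∀ a b x y → a * (b * (x * y)) ≡ a * b * x * y
      assemble a b x y = trans (sym (*-assoc a b (x * y))) (sym (*-assoc (a * b) x y))
    bound : n ^ (2 * suc l + 1) ≤ (4096 * (M * M)) ^ M * (16 * (M * M)) * copiesC (2 * suc l + 1) graph ^ 2
    bound = begin
      n ^ (2 * suc l + 1)                                ≡⟨ cong (n ^_) index ⟩
      n ^ M                                              ≤⟨ ^-monoˡ-≤ M n≤ ⟩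
      (A * (q * q)) ^ M ≡⟨ trans (^-distribʳ-* M A (q * q)) (cong (A ^ M *_) (^-distribʳ-* M q q)) ⟩
      A ^ M * (q ^ M * q ^ M) ≤⟨ *-monoʳ-≤ (A ^ M) (*-mono-≤ copies copies) ⟩
      A ^ M * (4 * M * c * (4 * M * c))                  ≡⟨ collect (A ^ M) M c ⟩
      A ^ M * (16 * (M * M)) * c ^ 2 ≡⟨ cong (λ m → A ^ M * (16 * (M * M)) * copiesC m graph ^ 2) (sym index) ⟩
      A ^ M * (16 * (M * M)) * copiesC (2 * suc l + 1) graph ^ 2 ∎
      where
      open ≤-Reasoning
      A c : ℕ
      A = 4096 * (M * M)
      c = copiesC M graph
      collect : ∀ a m c → a * (4 * m * c * (4 * m * c)) ≡ a * (16 * (m * m)) * (c * (c * 1))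
      collect = solve-∀

theorem2p3 : (k l : ℕ) → 2 ≤ k → 2 ≤ l →
    (3 ≤ k → ExUpper k l 1 l × ExLower k l 1 l) ×
    (k ≡ 2 → ExUpper k l 2 (2 * l + 1) × ExLower k l 2 (2 * l + 1))
theorem2p3 k (suc (suc j)) _ (s≤s (s≤s z≤n)) =
  (λ 3≤k → case m≤n⇒∃[o]m+o≡n 3≤k of λ { (i , refl) → upperLong i j , lowerLong i j }) ,
  (λ { refl → upperQuadrilateral (suc j) , lowerQuadrilateral (suc j) })
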